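{- Let $P\in\mathbb{Z}[x]$. Then $\mathbb{Z}[x]=\mathcal{N}[x]+(P)$ holds for some finite set $\mathcal{N}\subset\mathbb{Z}$ if and only if $P$ has no complex root $\alpha$ with $|\alpha|<1$.
   Context: For a finite set $\mathcal{N}\subset\mathbb{Z}$, $\mathcal{N}[x]:=\{d_0+d_1x+\dots+d_kx^k : k\ge 0,\ d_j\in\mathcal{N}\}$ denotes the set of polynomials all of whose coefficients lie in $\mathcal{N}$. For $P\in\mathbb{Z}[x]$, $(P)$ denotes the principal ideal of $\mathbb{Z}[x]$ generated by $P$, and $\mathcal{N}[x]+(P)=\{R+S : R\in\mathcal{N}[x], S\in(P)\}$. -}

module Defs where

open import Data.Nat using (ℕ; zero; suc)
import Data.Nat as ℕ
open import Data.Integer as ℤ using (ℤ)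
open import Data.Rational as ℚ using (ℚ; _/_; 0ℚ; 1ℚ)
open import Data.List using (List; []; _∷_)
open import Data.List.Relation.Unary.All using (All)
open import Data.List.Membership.Propositional using (_∈_)
open import Data.Product using (Σ; ∃; _×_; _,_)
open import Relation.Binary.PropositionalEquality using (_≡_)
open import Relation.Nullary using (¬_)

-- Polynomials in ℤ[x], as coefficient lists (constant term first).

Poly : Set
Poly = List ℤ

coeff : Poly → ℕ → ℤ
coeff []       _       = ℤ.0ℤ
coeff (a ∷ _)  zero    = a
coeff (_ ∷ as) (suc i) = coeff as i

-- equality of polynomials: all coefficients agree (trailing zeros irrelevant)
_≈ₚ_ : Poly → Poly → Set
A ≈ₚ B = ∀ i → coeff A i ≡ coeff B i

_+ₚ_ : Poly → Poly → Poly
[]       +ₚ bs       = bs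
(a ∷ as) +ₚ []       = a ∷ as
(a ∷ as) +ₚ (b ∷ bs) = (a ℤ.+ b) ∷ (as +ₚ bs)

scaleₚ : ℤ → Poly → Poly
scaleₚ c []       = []
scaleₚ c (b ∷ bs) = (c ℤ.* b) ∷ scaleₚ c bs

_*ₚ_ : Poly → Poly → Poly
[]       *ₚ bs = []
(a ∷ as) *ₚ bs = scaleₚ a bs +ₚ (ℤ.0ℤ ∷ (as *ₚ bs))

-- 𝒩[x]: polynomials d₀ + d₁x + … + dₖxᵏ (k ≥ 0) with every dⱼ ∈ 𝒩
-- (𝒩 a finite set of integers, given as a list)
InNX : List ℤ → Poly → Set
InNX 𝒩 R = Σ ℤ λ d₀ → Σ (List ℤ) λ ds → (R ≡ d₀ ∷ ds) × All (_∈ 𝒩) R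

CoversZX : List ℤ → Poly → Set
CoversZX 𝒩 P = ∀ (A : Poly) → Σ Poly λ R → Σ Poly λ Q → InNX 𝒩 R × (A ≈ₚ (R +ₚ (P *ₚ Q)))

-- Complex numbers as limits of Cauchy sequences of Gaussian rationals
-- ℚ(i) = ℚ × ℚ (real part, imaginary part).

ℚi : Set
ℚi = ℚ × ℚ

_+ᵢ_ : ℚi → ℚi → ℚi
(a , b) +ᵢ (c , d) = (a ℚ.+ c , b ℚ.+ d)

_-ᵢ_ : ℚi → ℚi → ℚi
(a , b) -ᵢ (c , d) = (a ℚ.- c , b ℚ.- d)

_*ᵢ_ : ℚi → ℚi → ℚi
(a , b) *ᵢ (c , d) = (a ℚ.* c ℚ.- b ℚ.* d , a ℚ.* d ℚ.+ b ℚ.* c)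

normSq : ℚi → ℚ
normSq (a , b) = a ℚ.* a ℚ.+ b ℚ.* b

fromℤᵢ : ℤ → ℚi
fromℤᵢ n = (n / 1 , 0ℚ)

evalᵢ : Poly → ℚi → ℚi
evalᵢ []       z = (0ℚ , 0ℚ)
evalᵢ (a ∷ as) z = fromℤᵢ a +ᵢ (z *ᵢ evalᵢ as z)

IsCauchy : (ℕ → ℚi) → Set
IsCauchy q = ∀ (k : ℕ) → ∃ λ N → ∀ m n → N ℕ.≤ m → N ℕ.≤ n →
               normSq (q m -ᵢ q n) ℚ.≤ ℤ.+ 1 / suc k

TendsToZero : (ℕ → ℚ) → Set
TendsToZero s = ∀ (k : ℕ) → ∃ λ N → ∀ n → N ℕ.≤ n → s n ℚ.≤ ℤ.+ 1 / suc k

-- P has a complex root α with |α| < 1, where α = lim qₙ: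
--   P(α) = lim P(qₙ) = 0, and |α|² = lim |qₙ|² < 1.
HasRootInOpenDisk : Poly → Set
HasRootInOpenDisk P =
  Σ (ℕ → ℚi) λ q → IsCauchy q
    × TendsToZero (λ n → normSq (evalᵢ P (q n)))
    × Σ ℚ λ r → (r ℚ.< 1ℚ) × ∃ λ N → ∀ n → N ℕ.≤ n → normSq (q n) ℚ.≤ r

{-# OPTIONS --safe #-}
module Submission where

-- The sup norm and the ℓ¹ norm of a polynomial are those of its coefficients.
--
-- A root α with |α| < 1 forbids a covering: every integer c would be R(α) with R ∈ 𝒩[x],
-- hence |c| ≤ max |𝒩| / (1 - |α|).
--
-- Conversely, rounding the coefficients of Q to integers changes P Q by at most the ℓ¹ norm
-- of P in sup norm, so it suffices to find for every A some Q ∈ ℚ(i)[x] such that A - P Q has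
-- sup norm at most 1.  If P = 1 - w x with |w| ≤ 1, then Q can be chosen so that
-- 1 - (1 - w x) Q is the average of 1, w x, …, (w x)ᵐ, whose sup norm tends to 0; the
-- existence of such approximate divisions passes to products.  In general P/P(0) is close to a
-- product of factors 1 - w x by an approximate fundamental theorem of algebra over ℚ(i)
-- (Argand's descent), and the error is harmless because the ℓ¹ norm of Q can be bounded before
-- the w's are chosen.  Should some |w| exceed 1 noticeably, then 1/w is an approximate root of
-- P, and approximate factorisations of increasing accuracy refine it to a Cauchy sequence
-- converging to a root in the open disk.

open import Defs
open import Data.Integer using (ℤ)
open import Data.List using (List)
open import Data.Product using (Σ)
open import Relation.Nullary using (¬_)
open import Function.Bundles using (_⇔_)

open import Defs using () renaming (_+ᵢ_ to infixl 6 _⊕_; _-ᵢ_ to infixl 6 _⊖_; _*ᵢ_ to infixl 7 _⊗_)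
open import Algebra.Bundles using (CommutativeRing)
open import Data.Empty using (⊥; ⊥-elim)
import Data.Integer as ℤ
import Data.Integer.DivMod as ℤD
import Data.Integer.Properties as ℤP
open import Data.Integer.Tactic.RingSolver using () renaming (solve-∀ to solveℤ-∀)
open import Data.List using ([]; _∷_; _++_; _∷ʳ_; applyUpTo; foldl; foldr; InitLast; initLast; _∷ʳ′_; length; map; reverse; upTo)
open import Data.List.Membership.Propositional using (_∈_; find)
open import Data.List.Membership.Propositional.Properties using (∈-++⁺ˡ; ∈-++⁺ʳ; ∈-map⁺; ∈-upTo⁺)
open import Data.List.Properties using (++-identityʳ; ∷ʳ-++; length-++; length-reverse; reverse-foldr)
open import Data.List.Relation.Unary.All as All using (All; []; _∷_)
open import Data.List.Relation.Unary.All.Properties using (¬All⇒Any¬)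
open import Data.List.Relation.Unary.Any using (here; there)
open import Data.Nat as ℕ using (ℕ; zero; suc; _∸_)
open import Data.Nat.Divisibility using (_∣_; divides; _∣?_)
import Data.Nat.Properties as ℕP
open import Data.Nat.Tactic.RingSolver using () renaming (solve-∀ to solveℕ-∀)
open import Data.Product using (∃; _,_; _×_; proj₁; proj₂)
open import Data.Product.Properties using (≡-dec)
open import Data.Rational
open import Data.Rational.Properties
open import Data.Rational.Unnormalised as ℚᵘ using (mkℚᵘ)
import Data.Rational.Unnormalised.Properties as ℚᵘP
open import Data.Sum using (_⊎_; inj₁; inj₂)
open import Function using (_∘_)
open import Function.Bundles using (mk⇔)
open import Level using (0ℓ)
open import Relation.Binary.PropositionalEquality
open import Relation.Nullary using (Dec; yes; no)
open import Relation.Nullary.Decidable using (dec⇒maybe; from-no; from-yes)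
open import Tactic.RingSolver using (solve-∀)
open import Tactic.RingSolver.Core.AlmostCommutativeRing using (AlmostCommutativeRing; fromCommutativeRing)

-- All computations take place in ℚ(i), which offers no square roots, no roots of unity and no
-- attained minima, and this dictates the form of the argument. A root has to be exhibited as a
-- Cauchy sequence with explicit moduli, and the choice between dividing and finding a root is a
-- test of finitely many rational inequalities. The delicate case of division is a root on the unit
-- circle: the terms of the geometric series for 1 / (1 - w x) do not decay there, yet its averages
-- still invert 1 - w x up to a small error in sup norm. That norm is enough because only the size
-- of single digits matters; since the error allowed before rounding is 1 for every A, one digit set
-- serves all A. In the descent, suitable powers of 3 + 4i take the place of the n-th roots of -1 in
-- Argand's argument: none of them lies on a coordinate axis, so repeated squaring drives them
-- strictly into the left half-plane.

ℚ-ring : AlmostCommutativeRing 0ℓ 0ℓ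
ℚ-ring = fromCommutativeRing +-*-commutativeRing λ x → dec⇒maybe (0ℚ ≟ x)

halves : ∀ p → ½ * p + ½ * p ≡ p
halves = solve-∀ ℚ-ring

p²q²≡[pq]² : ∀ p q → p * p * (q * q) ≡ p * q * (p * q)
p²q²≡[pq]² = solve-∀ ℚ-ring

-- The ring ℚ(i)

0ᵢ 1ᵢ : ℚi
0ᵢ = 0ℚ , 0ℚ
1ᵢ = 1ℚ , 0ℚ

⊝_ : ℚi → ℚi
⊝ (a , b) = - a , - b

infix 8 ⊝_

private
  assoc-re : ∀ a b c d e f → (a * c - b * d) * e - (a * d + b * c) * f ≡ a * (c * e - d * f) - b * (c * f + d * e)
  assoc-re = solve-∀ ℚ-ring
  assoc-im : ∀ a b c d e f → (a * c - b * d) * f + (a * d + b * c) * e ≡ a * (c * f + d * e) + b * (c * e - d * f)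
  assoc-im = solve-∀ ℚ-ring

⊗-assoc : ∀ u v w → (u ⊗ v) ⊗ w ≡ u ⊗ (v ⊗ w)
⊗-assoc (a , b) (c , d) (e , f) = cong₂ _,_ (assoc-re a b c d e f) (assoc-im a b c d e f)

⊕-⊗-commutativeRing : CommutativeRing 0ℓ 0ℓ
⊕-⊗-commutativeRing = record
  { Carrier = ℚi
  ; _≈_ = _≡_
  ; _+_ = _⊕_
  ; _*_ = _⊗_
  ; -_ = ⊝_
  ; 0# = 0ᵢ
  ; 1# = 1ᵢ
  ; isCommutativeRing = record
    { isRing = record
      { +-isAbelianGroup = record
        { isGroup = record
          { isMonoid = record
            { isSemigroup = record
              { isMagma = record { isEquivalence = isEquivalence ; ∙-cong = cong₂ _⊕_ }
              ; assoc = λ (a , b) (c , d) (e , f) → cong₂ _,_ (+-assoc a c e) (+-assoc b d f) }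
            ; identity = (λ (a , b) → cong₂ _,_ (+-identityˡ a) (+-identityˡ b))
                       , (λ (a , b) → cong₂ _,_ (+-identityʳ a) (+-identityʳ b)) }
          ; inverse = (λ (a , b) → cong₂ _,_ (+-inverseˡ a) (+-inverseˡ b))
                    , (λ (a , b) → cong₂ _,_ (+-inverseʳ a) (+-inverseʳ b))
          ; ⁻¹-cong = cong ⊝_ }
        ; comm = λ (a , b) (c , d) → cong₂ _,_ (+-comm a c) (+-comm b d) }
      ; *-cong = cong₂ _⊗_
      ; *-assoc = ⊗-assoc
      ; *-identity = (λ (a , b) → cong₂ _,_ (idˡ-re a b) (idˡ-im a b))
                   , (λ (a , b) → cong₂ _,_ (idʳ-re a b) (idʳ-im a b))
      ; distrib = (λ (a , b) (c , d) (e , f) → cong₂ _,_ (dˡ-re a b c d e f) (dˡ-im a b c d e f))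
                , (λ (a , b) (c , d) (e , f) → cong₂ _,_ (dʳ-re a b c d e f) (dʳ-im a b c d e f)) }
    ; *-comm = λ (a , b) (c , d) → cong₂ _,_ (comm-re a b c d) (comm-im a b c d) } }
  where
  idˡ-re : ∀ a b → 1ℚ * a - 0ℚ * b ≡ a
  idˡ-re = solve-∀ ℚ-ring
  idˡ-im : ∀ a b → 1ℚ * b + 0ℚ * a ≡ b
  idˡ-im = solve-∀ ℚ-ring
  idʳ-re : ∀ a b → a * 1ℚ - b * 0ℚ ≡ a
  idʳ-re = solve-∀ ℚ-ring
  idʳ-im : ∀ a b → a * 0ℚ + b * 1ℚ ≡ b
  idʳ-im = solve-∀ ℚ-ring
  dˡ-re : ∀ a b c d e f → a * (c + e) - b * (d + f) ≡ (a * c - b * d) + (a * e - b * f)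
  dˡ-re = solve-∀ ℚ-ring
  dˡ-im : ∀ a b c d e f → a * (d + f) + b * (c + e) ≡ (a * d + b * c) + (a * f + b * e)
  dˡ-im = solve-∀ ℚ-ring
  dʳ-re : ∀ a b c d e f → (c + e) * a - (d + f) * b ≡ (c * a - d * b) + (e * a - f * b)
  dʳ-re = solve-∀ ℚ-ring
  dʳ-im : ∀ a b c d e f → (c + e) * b + (d + f) * a ≡ (c * b + d * a) + (e * b + f * a)
  dʳ-im = solve-∀ ℚ-ring
  comm-re : ∀ a b c d → a * c - b * d ≡ c * a - d * b
  comm-re = solve-∀ ℚ-ring
  comm-im : ∀ a b c d → a * d + b * c ≡ c * b + d * a
  comm-im = solve-∀ ℚ-ring

_≟ᵢ_ : (u v : ℚi) → _
_≟ᵢ_ = ≡-dec _≟_ _≟_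

ℚi-ring : AlmostCommutativeRing 0ℓ 0ℓ
ℚi-ring = fromCommutativeRing ⊕-⊗-commutativeRing λ x → dec⇒maybe (0ᵢ ≟ᵢ x)

module ℚi = CommutativeRing ⊕-⊗-commutativeRing

private
  -- The solver handles ⊕, ⊗ and ⊝ only. As u ⊖ v unfolds to u ⊕ (⊝ v), identities with subtraction
  -- are solved in this form and then restated.
  telescope-⊝ : ∀ u v w → u ⊕ (⊝ w) ≡ (u ⊕ (⊝ v)) ⊕ (v ⊕ (⊝ w))
  telescope-⊝ = solve-∀ ℚi-ring
  difference-⊝ : ∀ u v w → u ⊕ (⊝ v) ≡ (u ⊕ (⊝ w)) ⊕ (⊝ (v ⊕ (⊝ w)))
  difference-⊝ = solve-∀ ℚi-ring
  u≡u⊝0 : ∀ u → u ≡ u ⊕ (⊝ 0ᵢ)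
  u≡u⊝0 = solve-∀ ℚi-ring

telescope : ∀ u v w → u ⊖ w ≡ (u ⊖ v) ⊕ (v ⊖ w)
telescope = telescope-⊝

difference : ∀ u v w → u ⊖ v ≡ (u ⊖ w) ⊖ (v ⊖ w)
difference = difference-⊝

u≡u⊖0 : ∀ u → u ≡ u ⊖ 0ᵢ
u≡u⊖0 = u≡u⊝0

0⊕z⊗0≡0 : ∀ z → 0ᵢ ⊕ z ⊗ 0ᵢ ≡ 0ᵢ
0⊕z⊗0≡0 = solve-∀ ℚi-ring

horner-scale : ∀ c a z v → c ⊗ a ⊕ z ⊗ (c ⊗ v) ≡ c ⊗ (a ⊕ z ⊗ v)
horner-scale = solve-∀ ℚi-ring

-- Ordered field arithmetic

infixl 1 _≤≡_
infixr 2 _≡≤_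

_≤≡_ : ∀ {a b c : ℚ} → a ≤ b → b ≡ c → a ≤ c
a≤b ≤≡ refl = a≤b

_≡≤_ : ∀ {a b c : ℚ} → a ≡ b → b ≤ c → a ≤ c
refl ≡≤ b≤c = b≤c

module _ {a b : ℚ} where

  -- Reduces a nonlinear inequality to a ring identity: the difference e of the two sides is written
  -- down as an evidently nonnegative expression.
  ≤-from-slack : ∀ e → 0ℚ ≤ e → a + e ≡ b → a ≤ b
  ≤-from-slack e 0≤e eq = subst₂ _≤_ (+-identityʳ a) eq (+-monoʳ-≤ a 0≤e)

  0≤b-a : a ≤ b → 0ℚ ≤ b - a
  0≤b-a a≤b = subst (_≤ b - a) (+-inverseʳ a) (+-monoˡ-≤ (- a) a≤b)

  0<b-a : a < b → 0ℚ < b - a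
  0<b-a a<b = subst (_< b - a) (+-inverseʳ a) (+-monoˡ-< (- a) a<b)

  *-monoˡ : ∀ {c} → 0ℚ ≤ c → a ≤ b → c * a ≤ c * b
  *-monoˡ {c} 0≤c = *-monoˡ-≤-nonNeg c {{nonNegative 0≤c}}

  *-monoʳ : ∀ {c} → 0ℚ ≤ c → a ≤ b → a * c ≤ b * c
  *-monoʳ {c} 0≤c = *-monoʳ-≤-nonNeg c {{nonNegative 0≤c}}

  0≤a+b : 0ℚ ≤ a → 0ℚ ≤ b → 0ℚ ≤ a + b
  0≤a+b 0≤a 0≤b = subst (_≤ a + b) (+-identityˡ 0ℚ) (+-mono-≤ 0≤a 0≤b)

  0<a+b : 0ℚ < a → 0ℚ ≤ b → 0ℚ < a + b
  0<a+b 0<a 0≤b = subst (_< a + b) (+-identityˡ 0ℚ) (+-mono-<-≤ 0<a 0≤b)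

  0<a*b : 0ℚ < a → 0ℚ < b → 0ℚ < a * b
  0<a*b 0<a 0<b = positive⁻¹ (a * b) {{pos*pos⇒pos a {{positive 0<a}} b {{positive 0<b}}}}

  0≤a*b : 0ℚ ≤ a → 0ℚ ≤ b → 0ℚ ≤ a * b
  0≤a*b 0≤a 0≤b = nonNegative⁻¹ (a * b)
    {{nonNeg*nonNeg⇒nonNeg a {{nonNegative 0≤a}} b {{nonNegative 0≤b}}}}

*-mono : ∀ {a b c d} → 0ℚ ≤ b → 0ℚ ≤ c → a ≤ b → c ≤ d → a * c ≤ b * d
*-mono 0≤b 0≤c a≤b c≤d = ≤-trans (*-monoʳ 0≤c a≤b) (*-monoˡ 0≤b c≤d)

≤-+ʳ : ∀ {a b} → 0ℚ ≤ b → a ≤ a + b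
≤-+ʳ {a} {b} 0≤b = ≤-from-slack b 0≤b refl

≤-+ˡ : ∀ {a b} → 0ℚ ≤ b → a ≤ b + a
≤-+ˡ {a} {b} 0≤b = ≤-from-slack b 0≤b (+-comm a b)

0≤1 : 0ℚ ≤ 1ℚ
0≤1 = from-yes (0ℚ ≤? 1ℚ)

0<1 : 0ℚ < 1ℚ
0<1 = from-yes (0ℚ <? 1ℚ)

0<½ : 0ℚ < ½
0<½ = from-yes (0ℚ <? ½)

p≤∣p∣ : ∀ p → p ≤ ∣ p ∣
p≤∣p∣ p with ≤-total 0ℚ p
... | inj₁ 0≤p = ≤-reflexive (sym (0≤p⇒∣p∣≡p 0≤p))
... | inj₂ p≤0 = ≤-trans p≤0 (0≤∣p∣ p)

∣p∣≤ : ∀ {p b} → p ≤ b → - p ≤ b → ∣ p ∣ ≤ b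
∣p∣≤ {p} p≤b -p≤b with ∣p∣≡p∨∣p∣≡-p p
... | inj₁ eq = subst (_≤ _) (sym eq) p≤b
... | inj₂ eq = subst (_≤ _) (sym eq) -p≤b

∣p∣*∣p∣≡p*p : ∀ p → ∣ p ∣ * ∣ p ∣ ≡ p * p
∣p∣*∣p∣≡p*p p with ∣p∣≡p∨∣p∣≡-p p
... | inj₁ eq = cong₂ _*_ eq eq
... | inj₂ eq = trans (cong₂ _*_ eq eq) (neg² p)
  where
  neg² : ∀ p → - p * - p ≡ p * p
  neg² = solve-∀ ℚ-ring

0≤p*p : ∀ p → 0ℚ ≤ p * p
0≤p*p p = subst (0ℚ ≤_) (∣p∣*∣p∣≡p*p p) (0≤a*b (0≤∣p∣ p) (0≤∣p∣ p))

-- Replaces taking square roots: absolute values are compared through their squares.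
p*p≤q*q⇒p≤q : ∀ {p q} → 0ℚ ≤ q → p * p ≤ q * q → p ≤ q
p*p≤q*q⇒p≤q {p} {q} 0≤q p²≤q² with p ≤? q
... | yes p≤q = p≤q
... | no p≰q = ⊥-elim (<-irrefl refl (≤-<-trans p²≤q² (≤-<-trans (*-monoˡ 0≤q (<⇒≤ q<p))
    (*-monoˡ-<-pos p {{positive (≤-<-trans 0≤q q<p)}} q<p))))
  where
  q<p : q < p
  q<p = ≰⇒> p≰q

opaque
  reciprocal : ∀ {p} → 0ℚ < p → Σ ℚ λ r → 0ℚ < r × p * r ≡ 1ℚ
  reciprocal {p} 0<p = 1/ p , positive⁻¹ (1/ p) {{1/pos⇒pos p}} , *-inverseʳ p
    where
    instance
      p>0 : Positive p
      p>0 = positive 0<p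
      p≢0 : NonZero p
      p≢0 = pos⇒nonZero p

-- Integers and natural numbers as rationals, and the Archimedean property

toℚᵘ-/1 : ∀ i → toℚᵘ (i / 1) ℚᵘ.≃ mkℚᵘ i 0
toℚᵘ-/1 i = toℚᵘ-fromℚᵘ (mkℚᵘ i 0)

/1-+ : ∀ i j → (i ℤ.+ j) / 1 ≡ i / 1 + j / 1
/1-+ i j = toℚᵘ-injective (begin
  toℚᵘ ((i ℤ.+ j) / 1)              ≈⟨ toℚᵘ-/1 (i ℤ.+ j) ⟩
  mkℚᵘ (i ℤ.+ j) 0
    ≈⟨ ℚᵘ.*≡* (cong (ℤ._* ℤ.+ 1) (sym (cong₂ ℤ._+_ (ℤP.*-identityʳ i) (ℤP.*-identityʳ j)))) ⟩
  mkℚᵘ i 0 ℚᵘ.+ mkℚᵘ j 0            ≈⟨ ℚᵘP.+-cong (toℚᵘ-/1 i) (toℚᵘ-/1 j) ⟨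
  toℚᵘ (i / 1) ℚᵘ.+ toℚᵘ (j / 1)    ≈⟨ toℚᵘ-homo-+ (i / 1) (j / 1) ⟨
  toℚᵘ (i / 1 + j / 1) ∎)
  where open ℚᵘP.≃-Reasoning

/1-* : ∀ i j → (i ℤ.* j) / 1 ≡ i / 1 * (j / 1)
/1-* i j = toℚᵘ-injective (begin
  toℚᵘ ((i ℤ.* j) / 1)              ≈⟨ toℚᵘ-/1 (i ℤ.* j) ⟩
  mkℚᵘ i 0 ℚᵘ.* mkℚᵘ j 0            ≈⟨ ℚᵘP.*-cong (toℚᵘ-/1 i) (toℚᵘ-/1 j) ⟨
  toℚᵘ (i / 1) ℚᵘ.* toℚᵘ (j / 1)    ≈⟨ toℚᵘ-homo-* (i / 1) (j / 1) ⟨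
  toℚᵘ (i / 1 * (j / 1)) ∎)
  where open ℚᵘP.≃-Reasoning

/1-neg : ∀ i → (ℤ.- i) / 1 ≡ - (i / 1)
/1-neg i = toℚᵘ-injective (begin
  toℚᵘ ((ℤ.- i) / 1)    ≈⟨ toℚᵘ-/1 (ℤ.- i) ⟩
  ℚᵘ.- mkℚᵘ i 0         ≈⟨ ℚᵘP.-‿cong (toℚᵘ-/1 i) ⟨
  ℚᵘ.- toℚᵘ (i / 1)     ≈⟨ toℚᵘ-homo‿- (i / 1) ⟨
  toℚᵘ (- (i / 1)) ∎)
  where open ℚᵘP.≃-Reasoning

/1-mono-≤ : ∀ {i j} → i ℤ.≤ j → i / 1 ≤ j / 1
/1-mono-≤ {i} {j} i≤j = toℚᵘ-cancel-≤
  (ℚᵘP.≤-respˡ-≃ (ℚᵘP.≃-sym (toℚᵘ-/1 i)) (ℚᵘP.≤-respʳ-≃ (ℚᵘP.≃-sym (toℚᵘ-/1 j))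
    (ℚᵘ.*≤* (ℤP.*-monoʳ-≤-nonNeg (ℤ.+ 1) i≤j))))

/1-cancel-≤ : ∀ {i j} → i / 1 ≤ j / 1 → i ℤ.≤ j
/1-cancel-≤ {i} {j} p with i ℤ.≤? j
... | yes i≤j = i≤j
... | no i≰j = ⊥-elim (<-irrefl refl (<-≤-trans (<-≤-trans step (/1-mono-≤ (ℤP.i<j⇒suc[i]≤j (ℤP.≰⇒> i≰j)))) p))
  where
  step : j / 1 < ℤ.suc j / 1
  step = subst (j / 1 <_) (sym (/1-+ (ℤ.+ 1) j)) (subst (_< 1ℚ + j / 1) (+-identityˡ (j / 1)) (+-monoˡ-< (j / 1) 0<1))

opaque
  fromℕ : ℕ → ℚ
  fromℕ n = ℤ.+ n / 1

  fromℕ-def : ∀ n → fromℕ n ≡ ℤ.+ n / 1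
  fromℕ-def n = refl

  fromℕ-0 : fromℕ 0 ≡ 0ℚ
  fromℕ-0 = refl

  fromℕ-suc : ∀ n → fromℕ (suc n) ≡ 1ℚ + fromℕ n
  fromℕ-suc n = /1-+ (ℤ.+ 1) (ℤ.+ n)

  0≤fromℕ : ∀ n → 0ℚ ≤ fromℕ n
  0≤fromℕ n = /1-mono-≤ {ℤ.+ 0} {ℤ.+ n} (ℤ.+≤+ ℕ.z≤n)

  ∣i∣/1 : ∀ i → ∣ i / 1 ∣ ≡ fromℕ ℤ.∣ i ∣
  ∣i∣/1 (ℤ.+ n) = 0≤p⇒∣p∣≡p (0≤fromℕ n)
  ∣i∣/1 ℤ.-[1+ n ] = trans (cong ∣_∣ (/1-neg (ℤ.+ suc n)))
    (trans (∣-p∣≡∣p∣ (fromℕ (suc n))) (0≤p⇒∣p∣≡p (0≤fromℕ (suc n))))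

floor-≤ : ∀ p → floor p / 1 ≤ p
floor-≤ p@(mkℚ n d-1 _) = toℚᵘ-cancel-≤ (ℚᵘP.≤-respˡ-≃ (ℚᵘP.≃-sym (toℚᵘ-/1 (floor p)))
  (ℚᵘ.*≤* (subst ((floor p ℤ.* ℤ.+ suc d-1) ℤ.≤_) (sym (ℤP.*-identityʳ n)) (ℤD.[n/d]*d≤n n (ℤ.+ suc d-1)))))

p≤1+floor : ∀ p → p ≤ 1ℚ + floor p / 1
p≤1+floor p@(mkℚ n d-1 _) = subst (p ≤_) (/1-+ (ℤ.+ 1) (floor p)) (toℚᵘ-cancel-≤
  (ℚᵘP.≤-respʳ-≃ (ℚᵘP.≃-sym (toℚᵘ-/1 (ℤ.suc (floor p))))
    (ℚᵘ.*≤* (subst (ℤ._≤ (ℤ.suc (floor p) ℤ.* ℤ.+ suc d-1)) (sym (ℤP.*-identityʳ n))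
      (ℤP.<⇒≤ (subst (λ f → n ℤ.< ℤ.suc f ℤ.* ℤ.+ suc d-1) (sym (ℤD.div-pos-is-/ℕ n (suc d-1)))
        (ℤD.n<s[n/ℕd]*d n (suc d-1))))))))

opaque
  archimedean : ∀ p → Σ ℕ λ n → p ≤ fromℕ n
  archimedean p = ℤ.∣ s ∣ , ≤-trans (p≤1+floor p)
    (subst₂ _≤_ (/1-+ (ℤ.+ 1) (floor p)) (∣i∣/1 s) (p≤∣p∣ (s / 1)))
    where
    s : ℤ
    s = ℤ.suc (floor p)

opaque
  unfolding fromℕ

  1/suc : ℕ → ℚ
  1/suc k = ℤ.+ 1 / suc k

  1/suc-def : ∀ k → 1/suc k ≡ ℤ.+ 1 / suc k
  1/suc-def k = refl

  suc*1/suc : ∀ k → fromℕ (suc k) * 1/suc k ≡ 1ℚ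
  suc*1/suc k = toℚᵘ-injective (begin
    toℚᵘ (fromℕ (suc k) * 1/suc k)              ≈⟨ toℚᵘ-homo-* (fromℕ (suc k)) (1/suc k) ⟩
    toℚᵘ (fromℕ (suc k)) ℚᵘ.* toℚᵘ (1/suc k)    ≈⟨ ℚᵘP.*-cong (toℚᵘ-/1 (ℤ.+ suc k)) (toℚᵘ-fromℚᵘ (mkℚᵘ (ℤ.+ 1) k)) ⟩
    mkℚᵘ (ℤ.+ suc k) 0 ℚᵘ.* mkℚᵘ (ℤ.+ 1) k
      ≈⟨ ℚᵘ.*≡* (cong (λ m → ℤ.+ suc m) (trans (ℕP.*-identityʳ _)
        (trans (ℕP.*-identityʳ k) (trans (sym (ℕP.+-identityʳ k)) (sym (ℕP.+-identityʳ _)))))) ⟩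
    mkℚᵘ (ℤ.+ 1) 0                                ∎)
    where open ℚᵘP.≃-Reasoning

  0<1/suc : ∀ k → 0ℚ < 1/suc k
  0<1/suc k = positive⁻¹ (1/suc k) {{normalize-pos 1 (suc k)}}

opaque
  1/suc-small : ∀ {ε} → 0ℚ < ε → ∃ λ k → 1/suc k ≤ ε
  1/suc-small {ε} 0<ε with reciprocal 0<ε
  ... | r , 0<r , εr≡1 with archimedean r
  ... | n , r≤n = n , (begin
    1/suc n                             ≡⟨ *-identityˡ _ ⟨
    1ℚ * 1/suc n                        ≡⟨ cong (_* 1/suc n) εr≡1 ⟨
    ε * r * 1/suc n
      ≤⟨ *-monoʳ (<⇒≤ (0<1/suc n)) (*-monoˡ (<⇒≤ 0<ε) (≤-trans r≤n
        (subst (fromℕ n ≤_) (sym (fromℕ-suc n)) (≤-+ˡ 0≤1)))) ⟩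
    ε * fromℕ (suc n) * 1/suc n         ≡⟨ *-assoc ε _ _ ⟩
    ε * (fromℕ (suc n) * 1/suc n)       ≡⟨ cong (ε *_) (suc*1/suc n) ⟩
    ε * 1ℚ                              ≡⟨ *-identityʳ ε ⟩
    ε                                   ∎)
    where open ≤-Reasoning

0<⊓ : ∀ {a b} → 0ℚ < a → 0ℚ < b → 0ℚ < a ⊓ b
0<⊓ {a} {b} 0<a 0<b with ≤-total a b
... | inj₁ a≤b = subst (0ℚ <_) (sym (p≤q⇒p⊓q≡p a≤b)) 0<a
... | inj₂ b≤a = subst (0ℚ <_) (sym (p≥q⇒p⊓q≡q b≤a)) 0<b

opaque
  -- r = m / (1 + M), where the 1 avoids a division by 0. Tolerances are chosen this way whenever a
  -- known factor M is going to magnify them.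
  shrink : ∀ M {m} → 0ℚ ≤ M → 0ℚ < m → Σ ℚ λ r → 0ℚ < r × r * M ≤ m
  shrink M {m} 0≤M 0<m with reciprocal (0<a+b {1ℚ} {M} 0<1 0≤M)
  ... | s , 0<s , eq = m * s , 0<a*b 0<m 0<s , (begin
    m * s * M            ≡⟨ *-assoc m s M ⟩
    m * (s * M)          ≤⟨ *-monoˡ (<⇒≤ 0<m) (*-monoˡ (<⇒≤ 0<s) (≤-+ˡ 0≤1)) ⟩
    m * (s * (1ℚ + M))   ≡⟨ cong (m *_) (trans (*-comm s _) eq) ⟩
    m * 1ℚ               ≡⟨ *-identityʳ m ⟩
    m                    ∎)
    where open ≤-Reasoning

[1+n]p-np≡p : ∀ n p → (1ℚ + n) * p - n * p ≡ p
[1+n]p-np≡p = solve-∀ ℚ-ring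

fromℕ-mono : ∀ {i j} → i ℕ.≤ j → fromℕ i ≤ fromℕ j
fromℕ-mono {j = j} ℕ.z≤n = fromℕ-0 ≡≤ 0≤fromℕ j
fromℕ-mono {suc i} {suc j} (ℕ.s≤s i≤j) = fromℕ-suc i ≡≤ +-monoʳ-≤ 1ℚ (fromℕ-mono i≤j) ≤≡ sym (fromℕ-suc j)

-- Absolute values on ℚ(i)

conj : ℚi → ℚi
conj (a , b) = a , - b

real : ℚ → ℚi
real r = r , 0ℚ

-- Unlike |·|, this norm takes rational values; it agrees with |·| up to a factor √2.
opaque
  N₁ : ℚi → ℚ
  N₁ (a , b) = ∣ a ∣ + ∣ b ∣

  N₁-def : ∀ a b → N₁ (a , b) ≡ ∣ a ∣ + ∣ b ∣
  N₁-def a b = refl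

  N₁-real : ∀ r → N₁ (real r) ≡ ∣ r ∣
  N₁-real r = +-identityʳ ∣ r ∣

  0≤N₁ : ∀ u → 0ℚ ≤ N₁ u
  0≤N₁ (a , b) = 0≤a+b (0≤∣p∣ a) (0≤∣p∣ b)

  N₁-⊝ : ∀ u → N₁ (⊝ u) ≡ N₁ u
  N₁-⊝ (a , b) = cong₂ _+_ (∣-p∣≡∣p∣ a) (∣-p∣≡∣p∣ b)

  N₁-conj : ∀ u → N₁ (conj u) ≡ N₁ u
  N₁-conj (a , b) = cong (∣ a ∣ +_) (∣-p∣≡∣p∣ b)

  N₁-real-part : ∀ u → N₁ (real (proj₁ u)) ≤ N₁ u
  N₁-real-part (a , b) = +-monoʳ-≤ (∣ a ∣) (0≤∣p∣ b)

  re≤N₁ : ∀ u → proj₁ u ≤ N₁ u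
  re≤N₁ (a , b) = ≤-trans (p≤∣p∣ a) (≤-+ʳ (0≤∣p∣ b))

  N₁-⊕ : ∀ u v → N₁ (u ⊕ v) ≤ N₁ u + N₁ v
  N₁-⊕ (a , b) (c , d) = subst (∣ a + c ∣ + ∣ b + d ∣ ≤_) (shuffle (∣ a ∣) (∣ b ∣) (∣ c ∣) (∣ d ∣))
    (+-mono-≤ (∣p+q∣≤∣p∣+∣q∣ a c) (∣p+q∣≤∣p∣+∣q∣ b d))
    where
    shuffle : ∀ a b c d → (a + c) + (b + d) ≡ (a + b) + (c + d)
    shuffle = solve-∀ ℚ-ring

  N₁-⊖ : ∀ u v → N₁ (u ⊖ v) ≤ N₁ u + N₁ v
  N₁-⊖ u v = N₁-⊕ u (⊝ v) ≤≡ cong (N₁ u +_) (N₁-⊝ v)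

  N₁-⊗ : ∀ u v → N₁ (u ⊗ v) ≤ N₁ u * N₁ v
  N₁-⊗ (a , b) (c , d) = subst (∣ a * c - b * d ∣ + ∣ a * d + b * c ∣ ≤_) (shuffle (∣ a ∣) (∣ b ∣) (∣ c ∣) (∣ d ∣))
    (+-mono-≤ (∣p-q∣≤∣p∣+∣q∣ (a * c) (b * d) ≤≡ cong₂ _+_ (∣p*q∣≡∣p∣*∣q∣ a c) (∣p*q∣≡∣p∣*∣q∣ b d))
              (∣p+q∣≤∣p∣+∣q∣ (a * d) (b * c) ≤≡ cong₂ _+_ (∣p*q∣≡∣p∣*∣q∣ a d) (∣p*q∣≡∣p∣*∣q∣ b c)))
    where
    shuffle : ∀ a b c d → (a * c + b * d) + (a * d + b * c) ≡ (a + b) * (c + d)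
    shuffle = solve-∀ ℚ-ring

  normSq≤N₁² : ∀ u → normSq u ≤ N₁ u * N₁ u
  normSq≤N₁² (a , b) = ≤-from-slack (∣ a ∣ * ∣ b ∣ + ∣ a ∣ * ∣ b ∣)
    (0≤a+b (0≤a*b (0≤∣p∣ a) (0≤∣p∣ b)) (0≤a*b (0≤∣p∣ a) (0≤∣p∣ b)))
    (trans (cong (_+ (∣ a ∣ * ∣ b ∣ + ∣ a ∣ * ∣ b ∣)) (cong₂ _+_ (sym (∣p∣*∣p∣≡p*p a)) (sym (∣p∣*∣p∣≡p*p b))))
      (expand (∣ a ∣) (∣ b ∣)))
    where
    expand : ∀ a b → a * a + b * b + (a * b + a * b) ≡ (a + b) * (a + b)
    expand = solve-∀ ℚ-ring

  -- The difference of the two sides is (|a| - |b|)².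
  N₁²≤2normSq : ∀ u → N₁ u * N₁ u ≤ normSq u + normSq u
  N₁²≤2normSq (a , b) = ≤-from-slack ((∣ a ∣ - ∣ b ∣) * (∣ a ∣ - ∣ b ∣)) (0≤p*p (∣ a ∣ - ∣ b ∣))
    (trans (expand (∣ a ∣) (∣ b ∣)) (cong₂ _+_ sq sq))
    where
    expand : ∀ a b → (a + b) * (a + b) + (a - b) * (a - b) ≡ (a * a + b * b) + (a * a + b * b)
    expand = solve-∀ ℚ-ring
    sq : ∣ a ∣ * ∣ a ∣ + ∣ b ∣ * ∣ b ∣ ≡ a * a + b * b
    sq = cong₂ _+_ (∣p∣*∣p∣≡p*p a) (∣p∣*∣p∣≡p*p b)

N₁-0 : N₁ 0ᵢ ≡ 0ℚ
N₁-0 = N₁-real 0ℚ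

N₁-1 : N₁ 1ᵢ ≡ 1ℚ
N₁-1 = N₁-real 1ℚ

0≤normSq : ∀ u → 0ℚ ≤ normSq u
0≤normSq (a , b) = 0≤a+b (0≤p*p a) (0≤p*p b)

normSq-⊗ : ∀ u v → normSq (u ⊗ v) ≡ normSq u * normSq v
normSq-⊗ (a , b) (c , d) = brahmagupta a b c d
  where
  brahmagupta : ∀ a b c d → (a * c - b * d) * (a * c - b * d) + (a * d + b * c) * (a * d + b * c)
              ≡ (a * a + b * b) * (c * c + d * d)
  brahmagupta = solve-∀ ℚ-ring

normSq-⊕ : ∀ u z → normSq (u ⊕ z) ≡ normSq u + (proj₁ (conj u ⊗ z) + proj₁ (conj u ⊗ z)) + normSq z
normSq-⊕ (a , b) (c , d) = expand a b c d
  where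
  expand : ∀ a b c d → (a + c) * (a + c) + (b + d) * (b + d)
         ≡ (a * a + b * b) + ((a * c - (- b) * d) + (a * c - (- b) * d)) + (c * c + d * d)
  expand = solve-∀ ℚ-ring

N₁≤ : ∀ {u t} → 0ℚ ≤ t → normSq u + normSq u ≤ t * t → N₁ u ≤ t
N₁≤ {u} 0≤t h = p*p≤q*q⇒p≤q 0≤t (≤-trans (N₁²≤2normSq u) h)

-- A converse to submultiplicativity, needed for lower bounds. It passes through the multiplicative
-- `normSq`; each of the two factors loses √2, together 2.
N₁*N₁≤ : ∀ u v → N₁ u * N₁ v ≤ N₁ (u ⊗ v) + N₁ (u ⊗ v)
N₁*N₁≤ u v = p*p≤q*q⇒p≤q (0≤a+b (0≤N₁ (u ⊗ v)) (0≤N₁ (u ⊗ v))) (begin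
  x * y * (x * y)                       ≡⟨ e₁ x y ⟩
  x * x * (y * y)
    ≤⟨ *-mono (0≤a+b (0≤normSq u) (0≤normSq u)) (0≤p*p y) (N₁²≤2normSq u) (N₁²≤2normSq v) ⟩
  (m + m) * (n + n)                     ≡⟨ e₂ m n ⟩
  (m * n + m * n) + (m * n + m * n)     ≤⟨ +-mono-≤ (+-mono-≤ mn≤ mn≤) (+-mono-≤ mn≤ mn≤) ⟩
  (z * z + z * z) + (z * z + z * z)     ≡⟨ e₃ z ⟩
  (z + z) * (z + z)                     ∎)
  where
  open ≤-Reasoning
  x = N₁ u
  y = N₁ v
  z = N₁ (u ⊗ v)
  m = normSq u
  n = normSq v
  mn≤ : m * n ≤ z * z
  mn≤ = subst (_≤ z * z) (normSq-⊗ u v) (normSq≤N₁² (u ⊗ v))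
  e₁ : ∀ x y → x * y * (x * y) ≡ x * x * (y * y)
  e₁ = solve-∀ ℚ-ring
  e₂ : ∀ m n → (m + m) * (n + n) ≡ (m * n + m * n) + (m * n + m * n)
  e₂ = solve-∀ ℚ-ring
  e₃ : ∀ z → (z * z + z * z) + (z * z + z * z) ≡ (z + z) * (z + z)
  e₃ = solve-∀ ℚ-ring

opaque
  inverse : ∀ w → 0ℚ < normSq w → Σ ℚi λ z → w ⊗ z ≡ 1ᵢ
  inverse (a , b) 0<n with reciprocal 0<n
  ... | r , _ , nr≡1 = (a * r , - b * r) , cong₂ _,_ (trans (re a b r) nr≡1) (im a b r)
    where
    re : ∀ a b r → a * (a * r) - b * (- b * r) ≡ (a * a + b * b) * r
    re = solve-∀ ℚ-ring
    im : ∀ a b r → a * (- b * r) + b * (a * r) ≡ 0ℚ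
    im = solve-∀ ℚ-ring

infixr 8 _^_ _^ᵢ_

_^_ : ℚ → ℕ → ℚ
p ^ zero  = 1ℚ
p ^ suc n = p * p ^ n

_^ᵢ_ : ℚi → ℕ → ℚi
u ^ᵢ zero  = 1ᵢ
u ^ᵢ suc n = u ⊗ u ^ᵢ n

0<^ : ∀ {p} n → 0ℚ < p → 0ℚ < p ^ n
0<^ zero    0<p = 0<1
0<^ (suc n) 0<p = 0<a*b 0<p (0<^ n 0<p)

0≤^ : ∀ {p} n → 0ℚ ≤ p → 0ℚ ≤ p ^ n
0≤^ zero    0≤p = 0≤1
0≤^ (suc n) 0≤p = 0≤a*b 0≤p (0≤^ n 0≤p)

normSq-^ : ∀ u n → normSq (u ^ᵢ n) ≡ normSq u ^ n
normSq-^ u zero    = refl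
normSq-^ u (suc n) = trans (normSq-⊗ u (u ^ᵢ n)) (cong (normSq u *_) (normSq-^ u n))

N₁-^ : ∀ u n → N₁ (u ^ᵢ n) ≤ N₁ u ^ n
N₁-^ u zero    = ≤-reflexive N₁-1
N₁-^ u (suc n) = ≤-trans (N₁-⊗ u (u ^ᵢ n)) (*-monoˡ (0≤N₁ u) (N₁-^ u n))

-- Directions of descent

^ᵢ-⊗ : ∀ u v n → (u ⊗ v) ^ᵢ n ≡ u ^ᵢ n ⊗ v ^ᵢ n
^ᵢ-⊗ u v zero    = refl
^ᵢ-⊗ u v (suc n) = trans (cong (u ⊗ v ⊗_) (^ᵢ-⊗ u v n)) (interchange u v (u ^ᵢ n) (v ^ᵢ n))
  where
  interchange : ∀ a b c d → a ⊗ b ⊗ (c ⊗ d) ≡ a ⊗ c ⊗ (b ⊗ d)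
  interchange = solve-∀ ℚi-ring

gaussian : ℤ → ℤ → ℚi
gaussian a b = a / 1 , b / 1

gaussian-⊗ : ∀ a b c d → gaussian a b ⊗ gaussian c d ≡ gaussian (a ℤ.* c ℤ.- b ℤ.* d) (a ℤ.* d ℤ.+ b ℤ.* c)
gaussian-⊗ a b c d = cong₂ _,_
  (sym (trans (/1-+ (a ℤ.* c) (ℤ.- (b ℤ.* d))) (cong₂ _+_ (/1-* a c)
    (trans (/1-neg (b ℤ.* d)) (cong -_ (/1-* b d))))))
  (sym (trans (/1-+ (a ℤ.* d) (b ℤ.* c)) (cong₂ _+_ (/1-* a d) (/1-* b c))))

-- 3 + 4i is idempotent modulo 5, so no power of it is real or purely imaginary.
record ≡3+4i-mod5 (a b : ℤ) : Set where
  constructor mod5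
  field
    s t : ℤ
    a≡  : a ≡ ℤ.+ 5 ℤ.* s ℤ.+ ℤ.+ 3
    b≡  : b ≡ ℤ.+ 5 ℤ.* t ℤ.- ℤ.+ 1

mod5-⊗ : ∀ {a b c d} → ≡3+4i-mod5 a b → ≡3+4i-mod5 c d →
         ≡3+4i-mod5 (a ℤ.* c ℤ.- b ℤ.* d) (a ℤ.* d ℤ.+ b ℤ.* c)
mod5-⊗ (mod5 s t refl refl) (mod5 s′ t′ refl refl) =
  mod5 (re-quotient s t s′ t′) (im-quotient s t s′ t′) (re s t s′ t′) (im s t s′ t′)
  where
  re-quotient im-quotient : ℤ → ℤ → ℤ → ℤ → ℤ
  re-quotient s t s′ t′ = ℤ.+ 5 ℤ.* (s ℤ.* s′) ℤ.+ ℤ.+ 3 ℤ.* s ℤ.+ ℤ.+ 3 ℤ.* s′ ℤ.- ℤ.+ 5 ℤ.*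
      (t ℤ.* t′) ℤ.+ t ℤ.+ t′ ℤ.+ ℤ.+ 1
  im-quotient s t s′ t′ = ℤ.+ 5 ℤ.* (s ℤ.* t′) ℤ.- s ℤ.+ ℤ.+ 3 ℤ.* t′ ℤ.+ ℤ.+ 5 ℤ.*
      (t ℤ.* s′) ℤ.+ ℤ.+ 3 ℤ.* t ℤ.- s′ ℤ.- ℤ.+ 1
  re : ∀ s t s′ t′ → (ℤ.+ 5 ℤ.* s ℤ.+ ℤ.+ 3) ℤ.* (ℤ.+ 5 ℤ.* s′ ℤ.+ ℤ.+ 3) ℤ.- (ℤ.+ 5 ℤ.* t ℤ.- ℤ.+ 1) ℤ.*
      (ℤ.+ 5 ℤ.* t′ ℤ.- ℤ.+ 1)
     ≡ ℤ.+ 5 ℤ.* (ℤ.+ 5 ℤ.* (s ℤ.* s′) ℤ.+ ℤ.+ 3 ℤ.* s ℤ.+ ℤ.+ 3 ℤ.* s′ ℤ.- ℤ.+ 5 ℤ.*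
       (t ℤ.* t′) ℤ.+ t ℤ.+ t′ ℤ.+ ℤ.+ 1) ℤ.+ ℤ.+ 3
  re = solveℤ-∀
  im : ∀ s t s′ t′ → (ℤ.+ 5 ℤ.* s ℤ.+ ℤ.+ 3) ℤ.* (ℤ.+ 5 ℤ.* t′ ℤ.- ℤ.+ 1) ℤ.+ (ℤ.+ 5 ℤ.* t ℤ.- ℤ.+ 1) ℤ.*
      (ℤ.+ 5 ℤ.* s′ ℤ.+ ℤ.+ 3)
     ≡ ℤ.+ 5 ℤ.* (ℤ.+ 5 ℤ.* (s ℤ.* t′) ℤ.- s ℤ.+ ℤ.+ 3 ℤ.* t′ ℤ.+ ℤ.+ 5 ℤ.*
       (t ℤ.* s′) ℤ.+ ℤ.+ 3 ℤ.* t ℤ.- s′ ℤ.- ℤ.+ 1) ℤ.- ℤ.+ 1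
  im = solveℤ-∀

5*i≢ : ∀ {j} → ¬ (5 ∣ ℤ.∣ j ∣) → ∀ i → ℤ.+ 5 ℤ.* i ≢ j
5*i≢ 5∤j i refl = 5∤j (divides ℤ.∣ i ∣ (trans (ℤP.abs-* (ℤ.+ 5) i) (ℕP.*-comm 5 ℤ.∣ i ∣)))

mod5⇒a≢0 : ∀ {b} → ¬ ≡3+4i-mod5 (ℤ.+ 0) b
mod5⇒a≢0 (mod5 s _ 0≡ _) = 5*i≢ {ℤ.- ℤ.+ 3} (from-no (5 ∣? 3)) s
  (trans (shift (ℤ.+ 5 ℤ.* s)) (cong (ℤ._- ℤ.+ 3) (sym 0≡)))
  where
  shift : ∀ x → x ≡ x ℤ.+ ℤ.+ 3 ℤ.- ℤ.+ 3
  shift = solveℤ-∀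

mod5⇒b≢0 : ∀ {a} → ¬ ≡3+4i-mod5 a (ℤ.+ 0)
mod5⇒b≢0 (mod5 _ t _ 0≡) = 5*i≢ {ℤ.+ 1} (from-no (5 ∣? 1)) t
  (trans (shift (ℤ.+ 5 ℤ.* t)) (cong (ℤ._+ ℤ.+ 1) (sym 0≡)))
  where
  shift : ∀ x → x ≡ x ℤ.- ℤ.+ 1 ℤ.+ ℤ.+ 1
  shift = solveℤ-∀

mod5-^ : ∀ n → Σ ℤ λ a → Σ ℤ λ b → gaussian (ℤ.+ 3) (ℤ.+ 4) ^ᵢ suc n ≡ gaussian a b × ≡3+4i-mod5 a b
mod5-^ zero    = _ , _ , refl , mod5 (ℤ.+ 0) (ℤ.+ 1) refl refl
mod5-^ (suc n) with mod5-^ n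
... | a , b , eq , m = _ , _
  , trans (cong (gaussian (ℤ.+ 3) (ℤ.+ 4) ⊗_) eq) (gaussian-⊗ (ℤ.+ 3) (ℤ.+ 4) a b)
  , mod5-⊗ (mod5 (ℤ.+ 0) (ℤ.+ 1) refl refl) m

-- The real axis is excluded as well, because 1, such a point and its conjugate are to span a
-- triangle around 0.
LeftHalfPlane : ℚi → Set
LeftHalfPlane (a , b) = a < 0ℚ × b ≢ 0ℚ

i*i≡∣i∣*∣i∣ : ∀ i → i ℤ.* i ≡ ℤ.+ (ℤ.∣ i ∣ ℕ.* ℤ.∣ i ∣)
i*i≡∣i∣*∣i∣ (ℤ.+ n)     = sym (ℤP.pos-* n n)
i*i≡∣i∣*∣i∣ ℤ.-[1+ n ]  = refl

-- The residues modulo 5 rule out a = 0 and b = 0, so the weak inequality that squaring delivers is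
-- enough.
nonpos⇒left : ∀ {u a b} → u ≡ gaussian a b → ≡3+4i-mod5 a b → a ℤ.≤ ℤ.+ 0 → LeftHalfPlane u
nonpos⇒left {a = a} {b} refl m a≤0 = ≤∧≢⇒< (/1-mono-≤ a≤0)
    (λ a/1≡0 → mod5⇒a≢0 (subst (λ a → ≡3+4i-mod5 a b) (/1-zero a a/1≡0) m))
  , λ b/1≡0 → mod5⇒b≢0 (subst (≡3+4i-mod5 a) (/1-zero b b/1≡0) m)
  where
  /1-zero : ∀ i → i / 1 ≡ 0ℚ → i ≡ ℤ.+ 0
  /1-zero i eq = ℤP.≤-antisym (/1-cancel-≤ {i} {ℤ.+ 0} (≤-reflexive eq))
      (/1-cancel-≤ {ℤ.+ 0} {i} (≤-reflexive (sym eq)))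
  ≤∧≢⇒< : ∀ {p q} → p ≤ q → p ≢ q → p < q
  ≤∧≢⇒< p≤q p≢q = ≰⇒> λ q≤p → p≢q (≤-antisym p≤q q≤p)

-- Squaring doubles the argument, so the cotangent a/b at least halves each time.
turn : ∀ s k ω {a b} → ω ^ᵢ k ≡ gaussian a b → ≡3+4i-mod5 a b → a ℤ.≤ ℤ.+ (2 ℕ.^ s ℕ.* ℤ.∣ b ∣) →
       Σ ℚi λ ω′ → LeftHalfPlane (ω′ ^ᵢ k)
turn s k ω {ℤ.-[1+ n ]} eq m _ = ω , nonpos⇒left eq m ℤ.-≤+
turn s k ω {a@(ℤ.+ n)} {b} eq m a≤ = go s a≤
  where
  a′ b′ : ℤ
  a′ = a ℤ.* a ℤ.- b ℤ.* b
  b′ = a ℤ.* b ℤ.+ b ℤ.* a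
  m′ : ≡3+4i-mod5 a′ b′
  m′ = mod5-⊗ m m
  eq′ : (ω ⊗ ω) ^ᵢ k ≡ gaussian a′ b′
  eq′ = trans (^ᵢ-⊗ ω ω k) (trans (cong₂ _⊗_ eq eq) (gaussian-⊗ a b a b))
  ∣b′∣ : ℤ.∣ b′ ∣ ≡ 2 ℕ.* (n ℕ.* ℤ.∣ b ∣)
  ∣b′∣ = trans (cong ℤ.∣_∣ (double a b)) (trans (ℤP.abs-* (ℤ.+ 2) (a ℤ.* b)) (cong (2 ℕ.*_) (ℤP.abs-* a b)))
    where
    double : ∀ a b → a ℤ.* b ℤ.+ b ℤ.* a ≡ ℤ.+ 2 ℤ.* (a ℤ.* b)
    double = solveℤ-∀
  go : ∀ s → a ℤ.≤ ℤ.+ (2 ℕ.^ s ℕ.* ℤ.∣ b ∣) → Σ ℚi λ ω′ → LeftHalfPlane (ω′ ^ᵢ k)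
  -- Here a ≤ |b|, so one more squaring makes the real part a² - b² nonpositive.
  go zero a≤ = ω ⊗ ω , nonpos⇒left eq′ m′ a′≤0
    where
    n≤∣b∣ : n ℕ.≤ ℤ.∣ b ∣
    n≤∣b∣ = subst (n ℕ.≤_) (ℕP.*-identityˡ _) (ℤP.drop‿+≤+ a≤)
    a′≤0 : a′ ℤ.≤ ℤ.+ 0
    a′≤0 = ℤP.i≤j⇒i-j≤0 (subst₂ ℤ._≤_ (sym (i*i≡∣i∣*∣i∣ a)) (sym (i*i≡∣i∣*∣i∣ b)) (ℤ.+≤+ (ℕP.*-mono-≤ n≤∣b∣ n≤∣b∣)))
  -- From a ≤ 2 · 2ˢ |b| follows a² - b² ≤ a² ≤ 2ˢ · |2 a b|, the same bound with a smaller
  -- exponent.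
  go (suc s) a≤ = turn s k (ω ⊗ ω) eq′ m′ (ℤP.≤-trans a′≤ (ℤ.+≤+ n*n≤))
    where
    a′≤ : a′ ℤ.≤ ℤ.+ (n ℕ.* n)
    a′≤ = subst₂ (λ x y → x ℤ.- y ℤ.≤ ℤ.+ (n ℕ.* n)) (sym (i*i≡∣i∣*∣i∣ a)) (sym (i*i≡∣i∣*∣i∣ b))
      (ℤP.i-j≤i (ℤ.+ (n ℕ.* n)) (ℤ.+ (ℤ.∣ b ∣ ℕ.* ℤ.∣ b ∣)))
    n*n≤ : n ℕ.* n ℕ.≤ 2 ℕ.^ s ℕ.* ℤ.∣ b′ ∣
    n*n≤ = subst (n ℕ.* n ℕ.≤_) (trans (rearrange n (2 ℕ.^ s) ℤ.∣ b ∣) (cong (2 ℕ.^ s ℕ.*_) (sym ∣b′∣)))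
      (ℕP.*-monoʳ-≤ n (ℤP.drop‿+≤+ a≤))
      where
      rearrange : ∀ n p m → n ℕ.* (2 ℕ.* p ℕ.* m) ≡ p ℕ.* (2 ℕ.* (n ℕ.* m))
      rearrange = solveℕ-∀

opaque
  -- Since (ω²)ᵏ = (ωᵏ)², squaring ω rotates its power without any extraction of roots. The
  -- imaginary part b is a nonzero integer, hence |a| ≤ 2^|a| |b|, which bounds the number of
  -- squarings.
  left-power : ∀ n → Σ ℚi λ ω → LeftHalfPlane (ω ^ᵢ suc n)
  left-power n with mod5-^ n
  ... | a , b , eq , m = turn ℤ.∣ a ∣ (suc n) (gaussian (ℤ.+ 3) (ℤ.+ 4)) eq m
      (ℤP.≤-trans (i≤∣i∣ a) (ℤ.+≤+ (∣a∣≤ b m)))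
    where
    i≤∣i∣ : ∀ i → i ℤ.≤ ℤ.+ ℤ.∣ i ∣
    i≤∣i∣ (ℤ.+ _)    = ℤP.≤-refl
    i≤∣i∣ ℤ.-[1+ _ ] = ℤ.-≤+
    n<2^n : ∀ n → n ℕ.< 2 ℕ.^ n
    n<2^n zero    = ℕ.s≤s ℕ.z≤n
    n<2^n (suc n) = ℕP.≤-trans (ℕP.+-mono-≤ (ℕP.≤-trans (ℕ.s≤s ℕ.z≤n) (n<2^n n)) (n<2^n n))
      (ℕP.≤-reflexive (cong (2 ℕ.^ n ℕ.+_) (sym (ℕP.+-identityʳ (2 ℕ.^ n)))))
    ∣a∣≤ : ∀ b → ≡3+4i-mod5 a b → ℤ.∣ a ∣ ℕ.≤ 2 ℕ.^ ℤ.∣ a ∣ ℕ.* ℤ.∣ b ∣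
    ∣a∣≤ b m with ℤ.∣ b ∣ in eq
    ... | zero  = ⊥-elim (mod5⇒b≢0 (subst (≡3+4i-mod5 a) (ℤP.∣i∣≡0⇒i≡0 eq) m))
    ... | suc k = ℕP.≤-trans (ℕP.<⇒≤ (n<2^n ℤ.∣ a ∣)) (ℕP.m≤m*n _ (suc k))

conj-^ : ∀ u n → conj u ^ᵢ n ≡ conj (u ^ᵢ n)
conj-^ u zero    = refl
conj-^ u (suc n) = trans (cong (conj u ⊗_) (conj-^ u n)) (conj-⊗ u (u ^ᵢ n))
  where
  conj-⊗ : ∀ u v → conj u ⊗ conj v ≡ conj (u ⊗ v)
  conj-⊗ (a , b) (c , d) = cong₂ _,_ (re a b c d) (im a b c d)
    where
    re : ∀ a b c d → a * c - (- b) * (- d) ≡ a * c - b * d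
    re = solve-∀ ℚ-ring
    im : ∀ a b c d → a * (- d) + (- b) * c ≡ - (a * d + b * c)
    im = solve-∀ ℚ-ring

1^ᵢ : ∀ n → 1ᵢ ^ᵢ n ≡ 1ᵢ
1^ᵢ zero    = refl
1^ᵢ (suc n) = cong (1ᵢ ⊗_) (1^ᵢ n)

-- 0 lies in the interior of the triangle with vertices 1 and x ± q i.
opaque
  triangle : ∀ x q → x < 0ℚ → q ≢ 0ℚ → Σ ℚ λ c → 0ℚ < c ×
    (∀ a b → let t = - (c * (∣ a ∣ + ∣ b ∣)) in (a ≤ t) ⊎ (a * x - b * q ≤ t) ⊎ (a * x - b * (- q) ≤ t))
  triangle x q x<0 q≢0 = c , 0<c , pick c core′
    where
    p Q M : ℚ
    p = - x
    Q = ∣ q ∣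
    -- Assume that the vertex 1 fails. For a ≥ 0, the inequality c ≤ p settles the term a x and c M
    -- ≤ |q| the term in |b|. For a ≤ 0, the failure and c ≤ ½ give -a ≤ 2 c |b|; then p + p pays
    -- for the positive term a x, and 3 for c (|a| + |b|).
    M = p + p + (1ℚ + 1ℚ + 1ℚ)
    0<p : 0ℚ < p
    0<p = neg-antimono-< x<0
    0≤2p : 0ℚ ≤ p + p
    0≤2p = 0≤a+b (<⇒≤ 0<p) (<⇒≤ 0<p)
    0<Q : 0ℚ < Q
    0<Q = ≰⇒> λ Q≤0 → q≢0 (∣p∣≡0⇒p≡0 q (≤-antisym Q≤0 (0≤∣p∣ q)))
    0≤M : 0ℚ ≤ M
    0≤M = 0≤a+b 0≤2p (from-yes (0ℚ ≤? 1ℚ + 1ℚ + 1ℚ))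
    shrunk : Σ ℚ λ r → 0ℚ < r × r * M ≤ Q
    shrunk = shrink M 0≤M 0<Q
    r c : ℚ
    r = proj₁ shrunk
    c = ½ ⊓ (p ⊓ r)
    0<c : 0ℚ < c
    0<c = 0<⊓ 0<½ (0<⊓ 0<p (proj₁ (proj₂ shrunk)))

    core : ∀ c a B → 0ℚ < c → c ≤ ½ → c ≤ p → c * M ≤ Q → 0ℚ ≤ B →
           ¬ (a ≤ - (c * (∣ a ∣ + B))) → a * x - Q * B ≤ - (c * (∣ a ∣ + B))
    core c a B 0<c c≤½ c≤p cM≤Q 0≤B a≰ with ≤-total 0ℚ a
    ... | inj₁ 0≤a = ≤-from-slack ((- x - c) * a + (Q - c * M) * B + c * B * (p + p + (1ℚ + 1ℚ)))
        (0≤a+b (0≤a+b (0≤a*b (0≤b-a c≤p) 0≤a) (0≤a*b (0≤b-a cM≤Q) 0≤B))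
          (0≤a*b (0≤a*b (<⇒≤ 0<c) 0≤B) (0≤a+b 0≤2p (from-yes (0ℚ ≤? 1ℚ + 1ℚ)))))
        (trans (e x c a Q B) (cong (λ A → - (c * (A + B))) (sym (0≤p⇒∣p∣≡p 0≤a))))
      where
      e : ∀ x c a Q B → a * x - Q * B + ((- x - c) * a + (Q - c * (- x + - x + (1ℚ + 1ℚ + 1ℚ))) * B
                        + c * B * (- x + - x + (1ℚ + 1ℚ))) ≡ - (c * (a + B))
      e = solve-∀ ℚ-ring
    ... | inj₂ a≤0 = ≤-from-slack
        ((Q - c * M) * B + (p + 1ℚ) * ((1ℚ + 1ℚ) * (c * (A + B) - A) + (1ℚ + 1ℚ) * A * (½ - c)) + (½ + (½ - c)) * A)
        (0≤a+b (0≤a+b (0≤a*b (0≤b-a cM≤Q) 0≤B)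
          (0≤a*b (0≤a+b (<⇒≤ 0<p) 0≤1) (0≤a+b (0≤a*b (from-yes (0ℚ ≤? 1ℚ + 1ℚ)) (0≤b-a A≤))
            (0≤a*b (0≤a*b (from-yes (0ℚ ≤? 1ℚ + 1ℚ)) 0≤A) (0≤b-a c≤½)))))
          (0≤a*b (0≤a+b (<⇒≤ 0<½) (0≤b-a c≤½)) 0≤A))
        (trans (e x c a Q B) (cong (λ A → - (c * (A + B))) (sym A≡)))
      where
      A : ℚ
      A = - a
      0≤A : 0ℚ ≤ A
      0≤A = neg-antimono-≤ a≤0
      A≡ : ∣ a ∣ ≡ A
      A≡ = trans (sym (∣-p∣≡∣p∣ a)) (0≤p⇒∣p∣≡p 0≤A)
      neg² : ∀ a → - (- a) ≡ a
      neg² = solve-∀ ℚ-ring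
      A≤ : A ≤ c * (A + B)
      A≤ = subst (λ x → A ≤ c * (x + B)) A≡ (neg-antimono-≤ (<⇒≤ (≰⇒> a≰)) ≤≡ neg² (c * (∣ a ∣ + B)))
      e : ∀ x c a Q B → a * x - Q * B + ((Q - c * (- x + - x + (1ℚ + 1ℚ + 1ℚ))) * B
          + (- x + 1ℚ) * ((1ℚ + 1ℚ) * (c * (- a + B) - (- a)) + (1ℚ + 1ℚ) * (- a) * (½ - c)) + (½ + (½ - c)) * (- a))
          ≡ - (c * (- a + B))
      e = solve-∀ ℚ-ring

    core′ : ∀ a b → ¬ (a ≤ - (c * (∣ a ∣ + ∣ b ∣))) → a * x - Q * ∣ b ∣ ≤ - (c * (∣ a ∣ + ∣ b ∣))
    core′ a b = core c a (∣ b ∣) 0<c (p⊓q≤p ½ (p ⊓ r)) (≤-trans (p⊓q≤q ½ (p ⊓ r)) (p⊓q≤p p r))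
      (≤-trans (*-monoʳ 0≤M (≤-trans (p⊓q≤q ½ (p ⊓ r)) (p⊓q≤q p r))) (proj₂ (proj₂ shrunk))) (0≤∣p∣ b)

    pick : ∀ c → (∀ a b → ¬ (a ≤ - (c * (∣ a ∣ + ∣ b ∣))) → a * x - Q * ∣ b ∣ ≤ - (c * (∣ a ∣ + ∣ b ∣))) →
           ∀ a b → let t = - (c * (∣ a ∣ + ∣ b ∣)) in (a ≤ t) ⊎ (a * x - b * q ≤ t) ⊎ (a * x - b * (- q) ≤ t)
    pick c core a b with a ≤? - (c * (∣ a ∣ + ∣ b ∣))
    ... | yes a≤ = inj₁ a≤
    ... | no a≰ with ∣p∣≡p∨∣p∣≡-p (b * q)
    ...   | inj₁ eq = inj₂ (inj₁ (cong (λ y → a * x - y)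
        (trans (sym eq) (trans (∣p*q∣≡∣p∣*∣q∣ b q) (*-comm (∣ b ∣) Q))) ≡≤ core a b a≰))
    ...   | inj₂ eq = inj₂ (inj₂ (cong (λ y → a * x - y)
        (trans (sym (neg-distribʳ-* b q)) (trans (sym eq) (trans (∣p*q∣≡∣p∣*∣q∣ b q) (*-comm (∣ b ∣) Q))))
          ≡≤ core a b a≰))

opaque
  -- Three candidates, 1, ω and the conjugate of ω, serve every u, so W and c depend on n alone.
  -- This is where uniformity of the descent begins.
  direction : ∀ n → Σ ℚ λ W → Σ ℚ λ c → 1ℚ ≤ W × 0ℚ < c ×
              (∀ u → Σ ℚi λ ω → N₁ ω ≤ W × proj₁ (u ⊗ ω ^ᵢ suc n) ≤ - (c * N₁ u))
  direction n with left-power n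
  ... | ω , x<0 , q≢0 with triangle (proj₁ (ω ^ᵢ suc n)) (proj₂ (ω ^ᵢ suc n)) x<0 q≢0
  ... | c , 0<c , pick = 1ℚ + N₁ ω , c , ≤-+ʳ (0≤N₁ ω) , 0<c , λ (a , b) → choose a b (pick a b)
    where
    choose : ∀ a b → let t = - (c * (∣ a ∣ + ∣ b ∣)); (x , q) = ω ^ᵢ suc n in
             (a ≤ t) ⊎ (a * x - b * q ≤ t) ⊎ (a * x - b * (- q) ≤ t) →
             Σ ℚi λ ω′ → N₁ ω′ ≤ 1ℚ + N₁ ω × proj₁ ((a , b) ⊗ ω′ ^ᵢ suc n) ≤ - (c * N₁ (a , b))
    choose a b (inj₁ h) = 1ᵢ , (N₁-1 ≡≤ ≤-+ʳ (0≤N₁ ω))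
      , (trans (cong (λ w → proj₁ ((a , b) ⊗ w)) (1^ᵢ (suc n))) (e a b) ≡≤ h ≤≡ cong (λ N → - (c * N))
        (sym (N₁-def a b)))
      where
      e : ∀ a b → a * 1ℚ - b * 0ℚ ≡ a
      e = solve-∀ ℚ-ring
    choose a b (inj₂ (inj₁ h)) = ω , ≤-+ˡ 0≤1 , (h ≤≡ cong (λ N → - (c * N)) (sym (N₁-def a b)))
    choose a b (inj₂ (inj₂ h)) = conj ω , (N₁-conj ω ≡≤ ≤-+ˡ 0≤1)
      , (cong (λ w → proj₁ ((a , b) ⊗ w)) (conj-^ ω (suc n)) ≡≤ h ≤≡ cong (λ N → - (c * N)) (sym (N₁-def a b)))

-- Approximate fundamental theorem of algebra

eval : List ℚi → ℚi → ℚi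
eval []       z = 0ᵢ
eval (a ∷ as) z = a ⊕ z ⊗ eval as z

L₁ : List ℚi → ℚ
L₁ []       = 0ℚ
L₁ (a ∷ as) = N₁ a + L₁ as

0≤L₁ : ∀ as → 0ℚ ≤ L₁ as
0≤L₁ []       = ≤-refl
0≤L₁ (a ∷ as) = 0≤a+b (0≤N₁ a) (0≤L₁ as)

L₁-++ : ∀ as bs → L₁ (as ++ bs) ≡ L₁ as + L₁ bs
L₁-++ []       bs = sym (+-identityˡ (L₁ bs))
L₁-++ (a ∷ as) bs = trans (cong (N₁ a +_) (L₁-++ as bs)) (sym (+-assoc (N₁ a) (L₁ as) (L₁ bs)))

eval-++ : ∀ as bs z → eval (as ++ bs) z ≡ eval as z ⊕ z ^ᵢ length as ⊗ eval bs z
eval-++ []       bs z = e (eval bs z)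
  where
  e : ∀ b → b ≡ 0ᵢ ⊕ 1ᵢ ⊗ b
  e = solve-∀ ℚi-ring
eval-++ (a ∷ as) bs z = trans (cong (λ v → a ⊕ z ⊗ v) (eval-++ as bs z))
    (e a z (eval as z) (z ^ᵢ length as) (eval bs z))
  where
  e : ∀ a z x p b → a ⊕ z ⊗ (x ⊕ p ⊗ b) ≡ a ⊕ z ⊗ x ⊕ z ⊗ p ⊗ b
  e = solve-∀ ℚi-ring

N₁-eval : ∀ as {z} → N₁ z ≤ 1ℚ → N₁ (eval as z) ≤ L₁ as
N₁-eval []       z≤1 = ≤-reflexive N₁-0
N₁-eval (a ∷ as) {z} z≤1 = ≤-trans (N₁-⊕ a (z ⊗ eval as z)) (+-monoʳ-≤ (N₁ a)
  (≤-trans (N₁-⊗ z (eval as z)) (*-mono 0≤1 (0≤N₁ (eval as z)) z≤1 (N₁-eval as z≤1) ≤≡ *-identityˡ (L₁ as))))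

^-* : ∀ p q n → (p * q) ^ n ≡ p ^ n * q ^ n
^-* p q zero    = refl
^-* p q (suc n) = trans (cong (p * q *_) (^-* p q n)) (e p q (p ^ n) (q ^ n))
  where
  e : ∀ a b c d → a * b * (c * d) ≡ a * c * (b * d)
  e = solve-∀ ℚ-ring

^-mono : ∀ {p q} n → 0ℚ ≤ p → p ≤ q → p ^ n ≤ q ^ n
^-mono zero    0≤p p≤q = ≤-refl
^-mono (suc n) 0≤p p≤q = *-mono (≤-trans 0≤p p≤q) (0≤^ n 0≤p) p≤q (^-mono n 0≤p p≤q)

1^ : ∀ n → 1ℚ ^ n ≡ 1ℚ
1^ zero    = refl
1^ (suc n) = trans (*-identityˡ (1ℚ ^ n)) (1^ n)

^≤1 : ∀ {p} n → 0ℚ ≤ p → p ≤ 1ℚ → p ^ n ≤ 1ℚ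
^≤1 n 0≤p p≤1 = ^-mono n 0≤p p≤1 ≤≡ 1^ n

real-^ : ∀ r n → real r ^ᵢ n ≡ real (r ^ n)
real-^ r zero    = refl
real-^ r (suc n) = trans (cong (real r ⊗_) (real-^ r n)) (cong₂ _,_ (re r (r ^ n)) (im r (r ^ n)))
  where
  re : ∀ a b → a * b - 0ℚ * 0ℚ ≡ a * b
  re = solve-∀ ℚ-ring
  im : ∀ a b → a * 0ℚ + 0ℚ * b ≡ 0ℚ
  im = solve-∀ ℚ-ring

-- Argand's descent with uniform gain

¼ ⅛ : ℚ
¼ = ½ * ½
⅛ = ½ * ¼

-- The main term Y lowers |u|² by D N₁ u; the cross term with X gives back at most half of this and
-- the square of X + Y a quarter. The last quarter is the gain.
dominant-decrease : ∀ {u X Y D} → 0ℚ ≤ D →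
  proj₁ (conj u ⊗ Y) + proj₁ (conj u ⊗ Y) ≤ - (D * N₁ u) →
  N₁ X ≤ ¼ * D → N₁ (X ⊕ Y) * N₁ (X ⊕ Y) ≤ ¼ * (D * N₁ u) →
  normSq (u ⊕ (X ⊕ Y)) + ¼ * (D * N₁ u) ≤ normSq u
dominant-decrease {u} {X} {Y} {D} 0≤D Y≤ X≤ Z≤ = begin
  normSq (u ⊕ (X ⊕ Y)) + ¼ * (D * b)
    ≡⟨ cong (_+ ¼ * (D * b)) (trans (normSq-⊕ u (X ⊕ Y))
      (cong (λ t → normSq u + (t + t) + normSq (X ⊕ Y)) (cong proj₁ (dist (conj u) X Y)))) ⟩
  normSq u + ((x + y) + (x + y)) + normSq (X ⊕ Y) + ¼ * (D * b) ≡⟨ e₁ (normSq u) x y (normSq (X ⊕ Y)) (¼ * (D * b)) ⟩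
  normSq u + (y + y) + (x + x) + normSq (X ⊕ Y) + ¼ * (D * b) ≤⟨ +-monoˡ-≤ (¼ * (D * b))
      (+-mono-≤ (+-mono-≤ (+-monoʳ-≤ (normSq u) Y≤) (+-mono-≤ x≤ x≤)) (≤-trans (normSq≤N₁² (X ⊕ Y)) Z≤)) ⟩
  normSq u + - (D * b) + (b * (¼ * D) + b * (¼ * D)) + ¼ * (D * b) + ¼ * (D * b) ≡⟨ e₂ (normSq u) D b ⟩
  normSq u ∎
  where
  open ≤-Reasoning
  b x y : ℚ
  b = N₁ u
  x = proj₁ (conj u ⊗ X)
  y = proj₁ (conj u ⊗ Y)
  dist : ∀ c X Y → c ⊗ (X ⊕ Y) ≡ c ⊗ X ⊕ c ⊗ Y
  dist = solve-∀ ℚi-ring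
  x≤ : x ≤ b * (¼ * D)
  x≤ = ≤-trans (re≤N₁ (conj u ⊗ X)) (≤-trans (N₁-⊗ (conj u) X) (cong (_* N₁ X) (N₁-conj u) ≡≤ *-monoˡ (0≤N₁ u) X≤))
  e₁ : ∀ n x y m k → n + ((x + y) + (x + y)) + m + k ≡ n + (y + y) + (x + x) + m + k
  e₁ = solve-∀ ℚ-ring
  e₂ : ∀ n D b → n + - (D * b) + (b * (¼ * D) + b * (¼ * D)) + ¼ * (D * b) + ¼ * (D * b) ≡ n
  e₂ = solve-∀ ℚ-ring

-- The case in which a hᵏ⁺¹ dominates, for h = r ω with ω a good direction for conj u ⊗ a. The lower
-- terms are small by `low≤`, the higher ones because of the additional factor r. The conditions on
-- r mention only the bounds A, β, x, W and c, never the polynomial itself.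
module Step (k : ℕ) {W c A β x r : ℚ} (1≤W : 1ℚ ≤ W) (0<c : 0ℚ < c) (0<r : 0ℚ < r) (0≤A : 0ℚ ≤ A) (0≤β : 0ℚ ≤ β)
    (0≤x : 0ℚ ≤ x)
  (dir : ∀ u → Σ ℚi λ ω → N₁ ω ≤ W × proj₁ (u ⊗ ω ^ᵢ suc k) ≤ - (c * N₁ u))
  (rW≤1 : r * W ≤ 1ℚ)
  (r-high : r * (W ^ suc (suc k) * A) ≤ ⅛ * (c * x))
  (r-square : r * (A * ((c + W ^ suc k) * (c + W ^ suc k))) ≤ ¼ * (c * β))
  (u : ℚi) (low : List ℚi) (a : ℚi) (high : List ℚi) (length≡k : length low ≡ k)
  (low≤ : L₁ low ≤ ⅛ * (c * r ^ suc k * x)) (x≤a : x ≤ N₁ a) (a≤A : N₁ a ≤ A) (high≤A : L₁ high ≤ A) (β≤u : β ≤ N₁ u)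
  where

  private
    open ≤-Reasoning
    K : ℕ
    K = suc k
    ρ b y D : ℚ
    ρ = r ^ K
    b = N₁ u
    y = N₁ a
    D = c * ρ * y
    ω h X Y H : ℚi
    ω = proj₁ (dir (conj u ⊗ a))
    h = real r ⊗ ω
    H = eval high h
    X = h ⊗ eval low h ⊕ h ^ᵢ K ⊗ (h ⊗ H)
    Y = a ⊗ h ^ᵢ K

    0≤r : 0ℚ ≤ r
    0≤r = <⇒≤ 0<r
    0≤c : 0ℚ ≤ c
    0≤c = <⇒≤ 0<c
    0≤W : 0ℚ ≤ W
    0≤W = ≤-trans 0≤1 1≤W
    0≤ρ : 0ℚ ≤ ρ
    0≤ρ = 0≤^ K 0≤r
    0≤y : 0ℚ ≤ y
    0≤y = 0≤N₁ a
    0≤b : 0ℚ ≤ b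
    0≤b = 0≤N₁ u
    0≤cρ : 0ℚ ≤ c * ρ
    0≤cρ = 0≤a*b 0≤c 0≤ρ
    0≤D : 0ℚ ≤ D
    0≤D = 0≤a*b 0≤cρ 0≤y
    0≤¼ : 0ℚ ≤ ¼
    0≤¼ = from-yes (0ℚ ≤? ¼)
    0≤⅛ : 0ℚ ≤ ⅛
    0≤⅛ = from-yes (0ℚ ≤? ⅛)

    r≤1 : r ≤ 1ℚ
    r≤1 = ≤-trans (sym (*-identityʳ r) ≡≤ *-monoˡ 0≤r 1≤W) rW≤1

    h≤ : N₁ h ≤ r * W
    h≤ = ≤-trans (N₁-⊗ (real r) ω) (cong (_* N₁ ω) (trans (N₁-real r) (0≤p⇒∣p∣≡p 0≤r)) ≡≤ *-monoˡ 0≤r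
        (proj₁ (proj₂ (dir (conj u ⊗ a)))))

    h≤1 : N₁ h ≤ 1ℚ
    h≤1 = ≤-trans h≤ rW≤1

    h^≤ : N₁ (h ^ᵢ K) ≤ ρ * W ^ K
    h^≤ = ≤-trans (N₁-^ h K) (^-mono K (0≤N₁ h) h≤ ≤≡ ^-* r W K)

    Y≤ : proj₁ (conj u ⊗ Y) + proj₁ (conj u ⊗ Y) ≤ - (D * b)
    Y≤ = begin
      proj₁ (conj u ⊗ Y) + proj₁ (conj u ⊗ Y)   ≤⟨ +-mono-≤ half half ⟩
      ρ * - (c * n) + ρ * - (c * n)             ≡⟨ e₁ ρ c n ⟩
      -- Doubling the real part has produced two copies of n, which is exactly what `N₁*N₁≤` costs.
      - (c * ρ * (n + n))
        ≤⟨ neg-antimono-≤ (*-monoˡ 0≤cρ (cong (_* y) (sym (N₁-conj u)) ≡≤ N₁*N₁≤ (conj u) a)) ⟩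
      - (c * ρ * (b * y))                       ≡⟨ e₂ c ρ b y ⟩
      - (D * b)                                 ∎
      where
      n : ℚ
      n = N₁ (conj u ⊗ a)
      real-⊗ : ∀ r v → proj₁ (real r ⊗ v) ≡ r * proj₁ v
      real-⊗ r (p , q) = e r p q
        where
        e : ∀ r p q → r * p - 0ℚ * q ≡ r * p
        e = solve-∀ ℚ-ring
      rearrange : ∀ u a r w → u ⊗ (a ⊗ (r ⊗ w)) ≡ r ⊗ (u ⊗ a ⊗ w)
      rearrange = solve-∀ ℚi-ring
      half : proj₁ (conj u ⊗ Y) ≤ ρ * - (c * n)
      half = trans (cong proj₁ (trans (cong (λ v → conj u ⊗ (a ⊗ v))
          (trans (^ᵢ-⊗ (real r) ω K) (cong (_⊗ ω ^ᵢ K) (real-^ r K))))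
                     (rearrange (conj u) a (real ρ) (ω ^ᵢ K)))) (real-⊗ ρ (conj u ⊗ a ⊗ ω ^ᵢ K))
             ≡≤ *-monoˡ 0≤ρ (proj₂ (proj₂ (dir (conj u ⊗ a))))
      e₁ : ∀ ρ c n → ρ * - (c * n) + ρ * - (c * n) ≡ - (c * ρ * (n + n))
      e₁ = solve-∀ ℚ-ring
      e₂ : ∀ c ρ b y → - (c * ρ * (b * y)) ≡ - (c * ρ * y * b)
      e₂ = solve-∀ ℚ-ring

    X≤ : N₁ X ≤ ¼ * D
    X≤ = begin
      N₁ X                                                  ≤⟨ N₁-⊕ (h ⊗ eval low h) (h ^ᵢ K ⊗ (h ⊗ H)) ⟩
      N₁ (h ⊗ eval low h) + N₁ (h ^ᵢ K ⊗ (h ⊗ H))           ≤⟨ +-mono-≤ low-part high-part ⟩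
      ⅛ * (c * ρ * y) + ⅛ * (c * ρ * y)                     ≡⟨ e (c * ρ * y) ⟩
      ¼ * D                                                 ∎
      where
      e : ∀ d → ⅛ * d + ⅛ * d ≡ ¼ * d
      e = solve-∀ ℚ-ring
      x≤y : ⅛ * (c * ρ * x) ≤ ⅛ * (c * ρ * y)
      x≤y = *-monoˡ 0≤⅛ (*-monoˡ 0≤cρ x≤a)
      low-part : N₁ (h ⊗ eval low h) ≤ ⅛ * (c * ρ * y)
      low-part = begin
        N₁ (h ⊗ eval low h)      ≤⟨ N₁-⊗ h (eval low h) ⟩
        N₁ h * N₁ (eval low h)   ≤⟨ *-mono 0≤1 (0≤N₁ (eval low h)) h≤1 (N₁-eval low h≤1) ⟩
        1ℚ * L₁ low              ≡⟨ *-identityˡ (L₁ low) ⟩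
        L₁ low                   ≤⟨ low≤ ⟩
        ⅛ * (c * ρ * x)          ≤⟨ x≤y ⟩
        ⅛ * (c * ρ * y)          ∎
      high-part : N₁ (h ^ᵢ K ⊗ (h ⊗ H)) ≤ ⅛ * (c * ρ * y)
      high-part = begin
        N₁ (h ^ᵢ K ⊗ (h ⊗ H))            ≤⟨ N₁-⊗ (h ^ᵢ K) (h ⊗ H) ⟩
        N₁ (h ^ᵢ K) * N₁ (h ⊗ H)         ≤⟨ *-mono (0≤a*b 0≤ρ (0≤^ K 0≤W)) (0≤N₁ (h ⊗ H)) h^≤
                                            (≤-trans (N₁-⊗ h H) (*-mono (0≤a*b 0≤r 0≤W) (0≤N₁ H) h≤
                                              (≤-trans (N₁-eval high h≤1) high≤A))) ⟩
        ρ * W ^ K * (r * W * A)          ≡⟨ e₁ ρ (W ^ K) r W A ⟩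
        ρ * (r * (W * W ^ K * A))        ≤⟨ *-monoˡ 0≤ρ r-high ⟩
        ρ * (⅛ * (c * x))                ≡⟨ e₂ ρ c x ⟩
        ⅛ * (c * ρ * x)                  ≤⟨ x≤y ⟩
        ⅛ * (c * ρ * y)                  ∎
        where
        e₁ : ∀ ρ V r W A → ρ * V * (r * W * A) ≡ ρ * (r * (W * V * A))
        e₁ = solve-∀ ℚ-ring
        e₂ : ∀ ρ c x → ρ * (⅛ * (c * x)) ≡ ⅛ * (c * ρ * x)
        e₂ = solve-∀ ℚ-ring

    Z≤ : N₁ (X ⊕ Y) * N₁ (X ⊕ Y) ≤ ¼ * (D * b)
    Z≤ = begin
      N₁ (X ⊕ Y) * N₁ (X ⊕ Y)        ≤⟨ *-mono 0≤T (0≤N₁ (X ⊕ Y)) Z≤T Z≤T ⟩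
      y * (ρ * V) * (y * (ρ * V))    ≡⟨ e₁ y ρ V ⟩
      y * ρ * (y * (ρ * (V * V)))
        ≤⟨ *-monoˡ (0≤a*b 0≤y 0≤ρ) (*-mono 0≤A (0≤a*b 0≤ρ (0≤p*p V)) a≤A (*-monoʳ (0≤p*p V) ρ≤r)) ⟩
      y * ρ * (A * (r * (V * V)))    ≡⟨ cong (y * ρ *_) (e₂ A r (V * V)) ⟩
      y * ρ * (r * (A * (V * V)))    ≤⟨ *-monoˡ (0≤a*b 0≤y 0≤ρ) (≤-trans r-square (*-monoˡ 0≤¼ (*-monoˡ 0≤c β≤u))) ⟩
      y * ρ * (¼ * (c * b))          ≡⟨ e₃ y ρ c b ⟩
      ¼ * (D * b)                    ∎
      where
      V : ℚ
      V = c + W ^ K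
      0≤V : 0ℚ ≤ V
      0≤V = 0≤a+b 0≤c (0≤^ K 0≤W)
      0≤T : 0ℚ ≤ y * (ρ * V)
      0≤T = 0≤a*b 0≤y (0≤a*b 0≤ρ 0≤V)
      -- The square of a quantity of order ρ has a factor ρ to spare; bounded by r, it lets
      -- `r-square` absorb all constants.
      ρ≤r : ρ ≤ r
      ρ≤r = *-monoˡ 0≤r (^≤1 k 0≤r r≤1) ≤≡ *-identityʳ r
      Z≤T : N₁ (X ⊕ Y) ≤ y * (ρ * V)
      Z≤T = begin
        N₁ (X ⊕ Y)                       ≤⟨ N₁-⊕ X Y ⟩
        N₁ X + N₁ Y
          ≤⟨ +-mono-≤ (≤-trans X≤ (*-monoʳ 0≤D (from-yes (¼ ≤? 1ℚ)))) (≤-trans (N₁-⊗ a (h ^ᵢ K)) (*-monoˡ 0≤y h^≤)) ⟩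
        1ℚ * D + y * (ρ * W ^ K)         ≡⟨ e c ρ y (W ^ K) ⟩
        y * (ρ * V)                      ∎
        where
        e : ∀ c ρ y w → 1ℚ * (c * ρ * y) + y * (ρ * w) ≡ y * (ρ * (c + w))
        e = solve-∀ ℚ-ring
      e₁ : ∀ y ρ V → y * (ρ * V) * (y * (ρ * V)) ≡ y * ρ * (y * (ρ * (V * V)))
      e₁ = solve-∀ ℚ-ring
      e₂ : ∀ A r V → A * (r * V) ≡ r * (A * V)
      e₂ = solve-∀ ℚ-ring
      e₃ : ∀ y ρ c b → y * ρ * (¼ * (c * b)) ≡ ¼ * (c * ρ * y * b)
      e₃ = solve-∀ ℚ-ring

  step : Σ ℚi λ h → normSq (u ⊕ h ⊗ eval (low ++ a ∷ high) h) + ¼ * (c * r ^ suc k * x * β) ≤ normSq u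
  step = h , (begin
    normSq (u ⊕ h ⊗ eval (low ++ a ∷ high) h) + ¼ * (c * ρ * x * β)
      ≡⟨ cong (λ v → normSq (u ⊕ v) + ¼ * (c * ρ * x * β)) decompose ⟩
    normSq (u ⊕ (X ⊕ Y)) + ¼ * (c * ρ * x * β)
      ≤⟨ +-monoʳ-≤ (normSq (u ⊕ (X ⊕ Y))) (*-monoˡ 0≤¼ (*-mono 0≤D 0≤β (*-monoˡ 0≤cρ x≤a) β≤u)) ⟩
    normSq (u ⊕ (X ⊕ Y)) + ¼ * (D * b)                                ≤⟨ dominant-decrease 0≤D Y≤ X≤ Z≤ ⟩
    normSq u                                                          ∎)
    where
    decompose : h ⊗ eval (low ++ a ∷ high) h ≡ X ⊕ Y
    decompose = trans (cong (h ⊗_) (trans (eval-++ low (a ∷ high) h)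
        (cong (λ n → eval low h ⊕ h ^ᵢ n ⊗ (a ⊕ h ⊗ H)) length≡k)))
      (e h (eval low h) (h ^ᵢ k) a H)
      where
      e : ∀ h l p a H → h ⊗ (l ⊕ p ⊗ (a ⊕ h ⊗ H)) ≡ h ⊗ l ⊕ h ⊗ p ⊗ (h ⊗ H) ⊕ a ⊗ (h ⊗ p)
      e = solve-∀ ℚi-ring

opaque
  shrink₃ : ∀ {M₁ M₂ M₃ m₁ m₂ m₃} → 0ℚ ≤ M₁ → 0ℚ ≤ M₂ → 0ℚ ≤ M₃ → 0ℚ < m₁ → 0ℚ < m₂ → 0ℚ < m₃ →
    Σ ℚ λ r → 0ℚ < r × r * M₁ ≤ m₁ × r * M₂ ≤ m₂ × r * M₃ ≤ m₃
  shrink₃ {M₁} {M₂} {M₃} 0≤M₁ 0≤M₂ 0≤M₃ 0<m₁ 0<m₂ 0<m₃ =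
    let (r₁ , 0<r₁ , h₁) = shrink M₁ 0≤M₁ 0<m₁
        (r₂ , 0<r₂ , h₂) = shrink M₂ 0≤M₂ 0<m₂
        (r₃ , 0<r₃ , h₃) = shrink M₃ 0≤M₃ 0<m₃
    in r₁ ⊓ (r₂ ⊓ r₃) , 0<⊓ 0<r₁ (0<⊓ 0<r₂ 0<r₃)
     , ≤-trans (*-monoʳ 0≤M₁ (p⊓q≤p r₁ (r₂ ⊓ r₃))) h₁
     , ≤-trans (*-monoʳ 0≤M₂ (≤-trans (p⊓q≤q r₁ (r₂ ⊓ r₃)) (p⊓q≤p r₂ r₃))) h₂
     , ≤-trans (*-monoʳ 0≤M₃ (≤-trans (p⊓q≤q r₁ (r₂ ⊓ r₃)) (p⊓q≤q r₂ r₃))) h₃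

-- Here u is the constant term and `low ++ high` lists the coefficients of h, h², .... The threshold
-- x ensures that the first k of these are not all small, and β that u is not yet small.
Descent : ℚ → ℚ → ℕ → ℚ → ℚ → Set
Descent A β k x κ = ∀ u low high → length low ≡ k → x ≤ L₁ low → L₁ low + L₁ high ≤ A → β ≤ N₁ u →
  Σ ℚi λ h → normSq (u ⊕ h ⊗ eval (low ++ high) h) + κ ≤ normSq u

-- Argand's descent with a gain κ that is uniform in the polynomial.  If the lower coefficients
-- of low are negligible its last one dominates; otherwise it is moved over to high.
opaque
  descent : ∀ {A β} → 0ℚ ≤ A → 0ℚ < β → ∀ k {x} → 0ℚ < x → Σ ℚ λ κ → 0ℚ < κ × Descent A β k x κ
  -- An empty `low` cannot reach the positive threshold, so any gain will do.
  descent {A} {β} 0≤A 0<β zero {x} 0<x = 1ℚ , 0<1 , none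
    where
    none : Descent A β zero x 1ℚ
    none u [] high _ x≤0 _ _ = ⊥-elim (<-irrefl refl (<-≤-trans 0<x x≤0))
  descent {A} {β} 0≤A 0<β (suc k) {x} 0<x = κ₁ ⊓ κ₂ , 0<⊓ 0<κ₁ 0<κ₂ , λ u low → split u low (initLast low)
    where
    W c x₂ : ℚ
    W = proj₁ (direction k)
    c = proj₁ (proj₂ (direction k))
    x₂ = ½ * x
    1≤W : 1ℚ ≤ W
    1≤W = proj₁ (proj₂ (proj₂ (direction k)))
    0≤W : 0ℚ ≤ W
    0≤W = ≤-trans 0≤1 1≤W
    0<c : 0ℚ < c
    0<c = proj₁ (proj₂ (proj₂ (proj₂ (direction k))))
    0<x₂ : 0ℚ < x₂
    0<x₂ = 0<a*b 0<½ 0<x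
    0<⅛ : 0ℚ < ⅛
    0<⅛ = from-yes (0ℚ <? ⅛)
    0<¼ : 0ℚ < ¼
    0<¼ = from-yes (0ℚ <? ¼)
    choice : Σ ℚ λ r → 0ℚ < r × r * W ≤ 1ℚ × r * (W ^ suc (suc k) * A) ≤ ⅛ * (c * x₂)
             × r * (A * ((c + W ^ suc k) * (c + W ^ suc k))) ≤ ¼ * (c * β)
    choice = shrink₃ 0≤W (0≤a*b (0≤^ (suc (suc k)) 0≤W) 0≤A) (0≤a*b 0≤A (0≤p*p (c + W ^ suc k)))
      0<1 (0<a*b 0<⅛ (0<a*b 0<c 0<x₂)) (0<a*b 0<¼ (0<a*b 0<c 0<β))
    r y κ₂ : ℚ
    r = proj₁ choice
    -- If `low` without its last coefficient a has norm at most y, it is negligible in `Step`; if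
    -- the norm is also at most x₂ = x / 2, then a keeps at least x / 2. When the smaller of y and
    -- x₂ is exceeded, that minimum is a valid threshold for the recursion.
    y = ⅛ * (c * r ^ suc k * x₂)
    κ₂ = ¼ * (c * r ^ suc k * x₂ * β)
    0<r : 0ℚ < r
    0<r = proj₁ (proj₂ choice)
    0<cρx : 0ℚ < c * r ^ suc k * x₂
    0<cρx = 0<a*b (0<a*b 0<c (0<^ (suc k) 0<r)) 0<x₂
    0<y : 0ℚ < y
    0<y = 0<a*b 0<⅛ 0<cρx
    0<κ₂ : 0ℚ < κ₂
    0<κ₂ = 0<a*b 0<¼ (0<a*b 0<cρx 0<β)
    rec : Σ ℚ λ κ → 0ℚ < κ × Descent A β k (y ⊓ x₂) κ
    rec = descent 0≤A 0<β k (0<⊓ 0<y 0<x₂)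
    κ₁ : ℚ
    κ₁ = proj₁ rec
    0<κ₁ : 0ℚ < κ₁
    0<κ₁ = proj₁ (proj₂ rec)

    split : ∀ u low → InitLast low → ∀ high → length low ≡ suc k → x ≤ L₁ low → L₁ low + L₁ high ≤ A → β ≤ N₁ u →
      Σ ℚi λ h → normSq (u ⊕ h ⊗ eval (low ++ high) h) + κ₁ ⊓ κ₂ ≤ normSq u
    split u .[] [] high () _ _ _
    split u .(low ∷ʳ a) (low ∷ʳ′ a) high len x≤ ≤A β≤u = decide (y ⊓ x₂ ≤? L₁ low)
      where
      len′ : length low ≡ k
      len′ = ℕP.suc-injective (trans (sym (trans (length-++ low) (ℕP.+-comm (length low) 1))) len)
      L₁-low : L₁ (low ∷ʳ a) ≡ L₁ low + N₁ a
      L₁-low = trans (L₁-++ low (a ∷ [])) (cong (L₁ low +_) (+-identityʳ (N₁ a)))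
      total≤A : L₁ low + (N₁ a + L₁ high) ≤ A
      total≤A = trans (sym (+-assoc (L₁ low) (N₁ a) (L₁ high))) (cong (_+ L₁ high) (sym L₁-low)) ≡≤ ≤A
      tail≤A : N₁ a + L₁ high ≤ A
      tail≤A = ≤-trans (≤-+ˡ (0≤L₁ low)) total≤A
      weaken : ∀ {κ} → κ₁ ⊓ κ₂ ≤ κ → (Σ ℚi λ h → normSq (u ⊕ h ⊗ eval (low ++ a ∷ high) h) + κ ≤ normSq u) →
        Σ ℚi λ h → normSq (u ⊕ h ⊗ eval ((low ∷ʳ a) ++ high) h) + κ₁ ⊓ κ₂ ≤ normSq u
      weaken κ≤ (h , dec) = h , ≤-trans (+-mono-≤ (≤-reflexive
          (cong (λ l → normSq (u ⊕ h ⊗ eval l h)) (∷ʳ-++ low a high))) κ≤) dec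
      decide : Dec (y ⊓ x₂ ≤ L₁ low) → Σ ℚi λ h → normSq (u ⊕ h ⊗ eval ((low ∷ʳ a) ++ high) h) + κ₁ ⊓ κ₂ ≤ normSq u
      decide (yes big) = weaken (p⊓q≤p κ₁ κ₂) (proj₂ (proj₂ rec) u low (a ∷ high) len′ big total≤A β≤u)
      decide (no small) = weaken (p⊓q≤q κ₁ κ₂)
        (Step.step k 1≤W 0<c 0<r 0≤A (<⇒≤ 0<β) (<⇒≤ 0<x₂) (proj₂ (proj₂ (proj₂ (proj₂ (direction k)))))
          (proj₁ (proj₂ (proj₂ choice))) (proj₁ (proj₂ (proj₂ (proj₂ choice)))) (proj₂ (proj₂ (proj₂ (proj₂ choice))))
          u low a high len′ (≤-trans low≤ (p⊓q≤p y x₂)) x₂≤a (≤-trans (≤-+ʳ (0≤L₁ high)) tail≤A)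
              (≤-trans (≤-+ˡ (0≤N₁ a)) tail≤A) β≤u)
        where
        low≤ : L₁ low ≤ y ⊓ x₂
        low≤ = <⇒≤ (≰⇒> small)
        x₂≤a : x₂ ≤ N₁ a
        x₂≤a = begin
          ½ * x                      ≡⟨ e₁ x ⟩
          x - x₂                     ≤⟨ +-mono-≤ (x≤ ≤≡ L₁-low) (neg-antimono-≤ (≤-trans low≤ (p⊓q≤q y x₂))) ⟩
          L₁ low + N₁ a - L₁ low     ≡⟨ e₂ (L₁ low) (N₁ a) ⟩
          N₁ a                       ∎
          where
          open ≤-Reasoning
          e₁ : ∀ x → ½ * x ≡ x - ½ * x
          e₁ = solve-∀ ℚ-ring
          e₂ : ∀ l a → l + a - l ≡ a
          e₂ = solve-∀ ℚ-ring

-- The list c₀ , … , cₙ₋₁ stands for the monic polynomial c₀ + … + cₙ₋₁ wⁿ⁻¹ + wⁿ.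
meval : List ℚi → ℚi → ℚi
meval []       w = 1ᵢ
meval (c ∷ cs) w = c ⊕ w ⊗ meval cs w

meval-eval : ∀ cs w → meval cs w ≡ eval (cs ∷ʳ 1ᵢ) w
meval-eval []       w = e w
  where
  e : ∀ w → 1ᵢ ≡ 1ᵢ ⊕ w ⊗ 0ᵢ
  e = solve-∀ ℚi-ring
meval-eval (c ∷ cs) w = cong (λ v → c ⊕ w ⊗ v) (meval-eval cs w)

-- Taylor shifts and growth of monic polynomials

taylor-linear : ℚi → ℚi → List ℚi → List ℚi
taylor-linear w c []       = c ⊕ w ∷ []
taylor-linear w c (t ∷ ts) = c ⊕ w ⊗ t ∷ taylor-linear w t ts

meval-taylor-linear : ∀ w c ts h → meval (taylor-linear w c ts) h ≡ c ⊕ (w ⊕ h) ⊗ meval ts h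
meval-taylor-linear w c [] h = e c w h
  where
  e : ∀ c w h → c ⊕ w ⊕ h ⊗ 1ᵢ ≡ c ⊕ (w ⊕ h) ⊗ 1ᵢ
  e = solve-∀ ℚi-ring
meval-taylor-linear w c (t ∷ ts) h = trans (cong (λ v → c ⊕ w ⊗ t ⊕ h ⊗ v) (meval-taylor-linear w t ts h))
    (e c w t h (meval ts h))
  where
  e : ∀ c w t h m → c ⊕ w ⊗ t ⊕ h ⊗ (t ⊕ (w ⊕ h) ⊗ m) ≡ c ⊕ (w ⊕ h) ⊗ (t ⊕ h ⊗ m)
  e = solve-∀ ℚi-ring

-- Horner's scheme in the variable w + h, with `taylor-linear` as a single step. The implicit
-- leading coefficient remains 1 throughout.
taylor : ℚi → List ℚi → List ℚi
taylor w []       = []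
taylor w (c ∷ cs) = taylor-linear w c (taylor w cs)

meval-taylor : ∀ w cs h → meval (taylor w cs) h ≡ meval cs (w ⊕ h)
meval-taylor w []       h = refl
meval-taylor w (c ∷ cs) h = trans (meval-taylor-linear w c (taylor w cs) h)
    (cong (λ v → c ⊕ (w ⊕ h) ⊗ v) (meval-taylor w cs h))

length-taylor-linear : ∀ w c ts → length (taylor-linear w c ts) ≡ suc (length ts)
length-taylor-linear w c []       = refl
length-taylor-linear w c (t ∷ ts) = cong suc (length-taylor-linear w t ts)

length-taylor : ∀ w cs → length (taylor w cs) ≡ length cs
length-taylor w []       = refl
length-taylor w (c ∷ cs) = trans (length-taylor-linear w c (taylor w cs)) (cong suc (length-taylor w cs))

-- The summands 1 account for the implicit leading coefficients; multiplication by w + h enlarges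
-- the ℓ¹ norm by a factor of at most 1 + C.
L₁-taylor-linear : ∀ {w C} → N₁ w ≤ C → ∀ c ts → L₁ (taylor-linear w c ts) + 1ℚ ≤ N₁ c + (1ℚ + C) * (L₁ ts + 1ℚ)
L₁-taylor-linear {w} {C} w≤C c [] = begin
  N₁ (c ⊕ w) + 0ℚ + 1ℚ             ≤⟨ +-monoˡ-≤ 1ℚ (+-monoˡ-≤ 0ℚ (≤-trans (N₁-⊕ c w) (+-monoʳ-≤ (N₁ c) w≤C))) ⟩
  N₁ c + C + 0ℚ + 1ℚ               ≡⟨ e (N₁ c) C ⟩
  N₁ c + (1ℚ + C) * (0ℚ + 1ℚ)      ∎
  where
  open ≤-Reasoning
  e : ∀ c C → c + C + 0ℚ + 1ℚ ≡ c + (1ℚ + C) * (0ℚ + 1ℚ)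
  e = solve-∀ ℚ-ring
L₁-taylor-linear {w} {C} w≤C c (t ∷ ts) = begin
  N₁ (c ⊕ w ⊗ t) + L₁ (taylor-linear w t ts) + 1ℚ                      ≡⟨ +-assoc (N₁ (c ⊕ w ⊗ t)) _ 1ℚ ⟩
  N₁ (c ⊕ w ⊗ t) + (L₁ (taylor-linear w t ts) + 1ℚ)
    ≤⟨ +-mono-≤ (≤-trans (N₁-⊕ c (w ⊗ t)) (+-monoʳ-≤ (N₁ c) (≤-trans (N₁-⊗ w t) (*-monoʳ (0≤N₁ t) w≤C))))
      (L₁-taylor-linear w≤C t ts) ⟩
  N₁ c + C * N₁ t + (N₁ t + (1ℚ + C) * (L₁ ts + 1ℚ))                   ≡⟨ e (N₁ c) C (N₁ t) (L₁ ts) ⟩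
  N₁ c + (1ℚ + C) * (N₁ t + L₁ ts + 1ℚ)                                ∎
  where
  open ≤-Reasoning
  e : ∀ c C t l → c + C * t + (t + (1ℚ + C) * (l + 1ℚ)) ≡ c + (1ℚ + C) * (t + l + 1ℚ)
  e = solve-∀ ℚ-ring

-- Uniformity over the disk of radius C, which the descent never leaves, allows a single gain for
-- all of its steps.
taylor-bound : ∀ {C} → 0ℚ ≤ C → ∀ cs → Σ ℚ λ A → 0ℚ ≤ A × (∀ w → N₁ w ≤ C → L₁ (taylor w cs) + 1ℚ ≤ A)
taylor-bound 0≤C [] = 1ℚ , 0≤1 , λ _ _ → ≤-reflexive (+-identityˡ 1ℚ)
taylor-bound {C} 0≤C (c ∷ cs) =
  let (A , 0≤A , bound) = taylor-bound 0≤C cs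
      0≤1+C = 0≤a+b 0≤1 0≤C
  in N₁ c + (1ℚ + C) * A , 0≤a+b (0≤N₁ c) (0≤a*b 0≤1+C 0≤A)
   , λ w w≤C → ≤-trans (L₁-taylor-linear w≤C c (taylor w cs)) (+-monoʳ-≤ (N₁ c) (*-monoˡ 0≤1+C (bound w w≤C)))

-- By induction the inner Horner value is at least 1 far out, so its product with w grows linearly.
-- Taking k twice in C pays for the factor 2 of `N₁*N₁≤`.
coercive : ∀ c cs K → Σ ℚ λ C → 0ℚ ≤ C × (∀ w → C ≤ N₁ w → K ≤ N₁ (meval (c ∷ cs) w))
coercive c cs K = C , 0≤C , bound
  where
  open ≤-Reasoning
  lower : ∀ cs → Σ ℚ λ C → 0ℚ ≤ C × (∀ w → C ≤ N₁ w → 1ℚ ≤ N₁ (meval cs w))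
  lower []        = 0ℚ , ≤-refl , λ _ _ → ≤-reflexive (sym N₁-1)
  lower (c ∷ cs)  = coercive c cs 1ℚ
  C₁ k C : ℚ
  C₁ = proj₁ (lower cs)
  k = ∣ K ∣ + N₁ c
  C = C₁ + (k + k)
  0≤k : 0ℚ ≤ k
  0≤k = 0≤a+b (0≤∣p∣ K) (0≤N₁ c)
  0≤C : 0ℚ ≤ C
  0≤C = 0≤a+b (proj₁ (proj₂ (lower cs))) (0≤a+b 0≤k 0≤k)
  bound : ∀ w → C ≤ N₁ w → K ≤ N₁ (meval (c ∷ cs) w)
  bound w C≤w = begin
    K                                                   ≤⟨ p≤∣p∣ K ⟩
    ∣ K ∣                                               ≡⟨ e₁ (∣ K ∣) (N₁ c) ⟩
    ½ * (k + k) - N₁ c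
      ≤⟨ +-monoˡ-≤ (- N₁ c) (*-monoˡ (<⇒≤ 0<½) (≤-trans (≤-trans (≤-+ˡ (proj₁ (proj₂ (lower cs)))) C≤w)
                                                             (sym (*-identityʳ (N₁ w)) ≡≤ *-monoˡ (0≤N₁ w) 1≤m))) ⟩
    ½ * (N₁ w * N₁ m) - N₁ c                            ≤⟨ +-monoˡ-≤ (- N₁ c) (*-monoˡ (<⇒≤ 0<½) (N₁*N₁≤ w m)) ⟩
    ½ * (N₁ (w ⊗ m) + N₁ (w ⊗ m)) - N₁ c                ≡⟨ cong (_- N₁ c) (e₂ (N₁ (w ⊗ m))) ⟩
    N₁ (w ⊗ m) - N₁ c
      ≤⟨ +-monoˡ-≤ (- N₁ c) (cong N₁ (e₃ c (w ⊗ m)) ≡≤ N₁-⊖ (c ⊕ w ⊗ m) c) ⟩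
    N₁ (c ⊕ w ⊗ m) + N₁ c - N₁ c                        ≡⟨ e₄ (N₁ (c ⊕ w ⊗ m)) (N₁ c) ⟩
    N₁ (c ⊕ w ⊗ m)                                      ∎
    where
    m : ℚi
    m = meval cs w
    1≤m : 1ℚ ≤ N₁ m
    1≤m = proj₂ (proj₂ (lower cs)) w (≤-trans (≤-+ʳ (0≤a+b 0≤k 0≤k)) C≤w)
    e₁ : ∀ K c → K ≡ ½ * (K + c + (K + c)) - c
    e₁ = solve-∀ ℚ-ring
    e₂ : ∀ x → ½ * (x + x) ≡ x
    e₂ = solve-∀ ℚ-ring
    e₃ : ∀ c x → x ≡ (c ⊕ x) ⊕ (⊝ c)
    e₃ = solve-∀ ℚi-ring
    e₄ : ∀ a b → a + b - b ≡ a
    e₄ = solve-∀ ℚ-ring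

opaque
  -- The points with |f|² ≤ M = |f(0)|² lie in a bounded disk, on which the Taylor coefficients are
  -- bounded. Hence every step that starts from a value above β gains the same κ, and any n with M ≤
  -- n κ bounds the number of steps; no minimum of |f| has to be attained.
  approximate-root : ∀ c cs {β} → 0ℚ < β → Σ ℚi λ w → N₁ (meval (c ∷ cs) w) ≤ β
  approximate-root c cs {β} 0<β = loop (proj₁ steps) 0ᵢ ≤-refl (proj₂ steps)
    where
    f : ℚi → ℚi
    f = meval (c ∷ cs)
    M K C A κ : ℚ
    M = normSq (f 0ᵢ)
    -- A value with N₁ ≥ K and |f|² ≤ M would give K ≤ K² ≤ 2 M < K; so the descent stays where N₁ w
    -- ≤ C.
    K = 1ℚ + (M + M)
    coer : Σ ℚ λ C → 0ℚ ≤ C × (∀ w → C ≤ N₁ w → K ≤ N₁ (f w))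
    coer = coercive c cs K
    C = proj₁ coer
    tayl : Σ ℚ λ A → 0ℚ ≤ A × (∀ w → N₁ w ≤ C → L₁ (taylor w (c ∷ cs)) + 1ℚ ≤ A)
    tayl = taylor-bound (proj₁ (proj₂ coer)) (c ∷ cs)
    A = proj₁ tayl
    desc : Σ ℚ λ κ → 0ℚ < κ × Descent A β (suc (length cs)) 1ℚ κ
    -- All nonconstant coefficients go into `low`, and the leading coefficient 1 alone meets the
    -- threshold 1.
    desc = descent (proj₁ (proj₂ tayl)) 0<β (suc (length cs)) 0<1
    κ = proj₁ desc
    0<κ : 0ℚ < κ
    0<κ = proj₁ (proj₂ desc)
    steps : Σ ℕ λ n → M ≤ fromℕ n * κ
    steps =
      let (r , 0<r , κr≡1) = reciprocal 0<κ
          (n , Mr≤n) = archimedean (M * r)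
      in n , (trans (sym (*-identityʳ M)) (trans (cong (M *_) (trans (sym κr≡1) (*-comm κ r))) (sym (*-assoc M r κ)))
          ≡≤ *-monoʳ (<⇒≤ 0<κ) Mr≤n)

    confined : ∀ w → normSq (f w) ≤ M → N₁ w ≤ C
    confined w fw≤M with N₁ w ≤? C
    ... | yes w≤C = w≤C
    ... | no w≰C = ⊥-elim (<-irrefl refl (<-≤-trans M+M<K (≤-trans K≤K² K²≤)))
      where
      0≤M+M : 0ℚ ≤ M + M
      0≤M+M = 0≤a+b (0≤normSq (f 0ᵢ)) (0≤normSq (f 0ᵢ))
      M+M<K : M + M < K
      M+M<K = sym (+-identityˡ (M + M)) ≡< +-monoˡ-< (M + M) 0<1
        where
        _≡<_ : ∀ {a b c : ℚ} → a ≡ b → b < c → a < c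
        refl ≡< b<c = b<c
      1≤K : 1ℚ ≤ K
      1≤K = ≤-+ʳ 0≤M+M
      0≤K : 0ℚ ≤ K
      0≤K = ≤-trans 0≤1 1≤K
      K≤fw : K ≤ N₁ (f w)
      K≤fw = proj₂ (proj₂ coer) w (<⇒≤ (≰⇒> w≰C))
      K≤K² : K ≤ K * K
      K≤K² = sym (*-identityʳ K) ≡≤ *-monoˡ 0≤K 1≤K
      K²≤ : K * K ≤ M + M
      K²≤ = ≤-trans (*-mono (0≤N₁ (f w)) 0≤K K≤fw K≤fw) (≤-trans (N₁²≤2normSq (f w)) (+-mono-≤ fw≤M fw≤M))

    step-from-0 : ∀ ts → length ts ≡ suc (length cs) → L₁ ts + 1ℚ ≤ A → β ≤ N₁ (meval ts 0ᵢ) →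
      Σ ℚi λ h → normSq (meval ts h) + κ ≤ normSq (meval ts 0ᵢ)
    step-from-0 (t ∷ ts) len ts≤A β≤ =
      let (h , dec) = proj₂ (proj₂ desc) t (ts ∷ʳ 1ᵢ) [] (trans (length-++ ts) (trans (ℕP.+-comm (length ts) 1) len))
                        (≤-+ˡ (0≤L₁ ts) ≤≡ sym L₁-low)
                        (≤-trans (≤-reflexive (trans (+-identityʳ _) L₁-low))
                          (≤-trans (+-monoˡ-≤ 1ℚ (≤-+ˡ (0≤N₁ t))) ts≤A))
                        (β≤ ≤≡ cong N₁ at-0)
      in h , (cong (λ v → normSq (t ⊕ h ⊗ v) + κ) (trans (meval-eval ts h)
          (cong (λ l → eval l h) (sym (++-identityʳ (ts ∷ʳ 1ᵢ))))) ≡≤ dec ≤≡ cong normSq (sym at-0))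
      where
      L₁-low : L₁ (ts ∷ʳ 1ᵢ) ≡ L₁ ts + 1ℚ
      L₁-low = trans (L₁-++ ts (1ᵢ ∷ [])) (cong (L₁ ts +_) (trans (+-identityʳ (N₁ 1ᵢ)) N₁-1))
      at-0 : meval (t ∷ ts) 0ᵢ ≡ t
      at-0 = e t (meval ts 0ᵢ)
        where
        e : ∀ t m → t ⊕ 0ᵢ ⊗ m ≡ t
        e = solve-∀ ℚi-ring

    loop : ∀ n w → normSq (f w) ≤ M → normSq (f w) ≤ fromℕ n * κ → Σ ℚi λ w → N₁ (f w) ≤ β
    loop-body : ∀ n w → normSq (f w) ≤ M → normSq (f w) ≤ fromℕ n * κ → Dec (N₁ (f w) ≤ β) → Σ ℚi λ w → N₁ (f w) ≤ β
    loop n w ≤M ≤nκ = loop-body n w ≤M ≤nκ (N₁ (f w) ≤? β)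
    loop-body n       w ≤M ≤nκ (yes done) = w , done
    loop-body zero    w ≤M ≤0 (no _) = w , N₁≤ (<⇒≤ 0<β) (≤-trans (+-mono-≤ ≤0′ ≤0′) (0≤p*p β))
      where
      ≤0′ : normSq (f w) ≤ 0ℚ
      ≤0′ = ≤0 ≤≡ trans (cong (_* κ) fromℕ-0) (*-zeroˡ κ)
    loop-body (suc n) w ≤M ≤nκ (no big) =
      let (h , dec) = step-from-0 (taylor w (c ∷ cs)) (length-taylor w (c ∷ cs)) (proj₂ (proj₂ tayl) w (confined w ≤M))
                        (<⇒≤ (≰⇒> big) ≤≡ cong N₁ (sym (at w 0ᵢ w (ℚi.+-identityʳ w))))
          dec′ : normSq (f (w ⊕ h)) + κ ≤ normSq (f w)
          dec′ = cong (λ v → normSq v + κ) (sym (at w h (w ⊕ h) refl)) ≡≤ dec ≤≡ cong normSq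
              (at w 0ᵢ w (ℚi.+-identityʳ w))
      in loop n (w ⊕ h) (≤-trans (≤-+ʳ (<⇒≤ 0<κ)) (≤-trans dec′ ≤M))
           (p+κ≤⇒ (≤-trans dec′ ≤nκ ≤≡ trans (cong (_* κ) (fromℕ-suc n)) (e₁ (fromℕ n) κ)))
      where
      at : ∀ w h v → w ⊕ h ≡ v → meval (taylor w (c ∷ cs)) h ≡ f v
      at w h v refl = meval-taylor w (c ∷ cs) h
      e₁ : ∀ n k → (1ℚ + n) * k ≡ n * k + k
      e₁ = solve-∀ ℚ-ring
      p+κ≤⇒ : ∀ {p q} → p + κ ≤ q + κ → p ≤ q
      p+κ≤⇒ {p} {q} h = e₂ p κ ≡≤ +-monoˡ-≤ (- κ) h ≤≡ sym (e₂ q κ)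
        where
        e₂ : ∀ p k → p ≡ p + k + - k
        e₂ = solve-∀ ℚ-ring

-- Power series and approximate inverses

Seq : Set
Seq = ℕ → ℚi

coef : List ℚi → Seq
coef []       _       = 0ᵢ
coef (a ∷ _)  zero    = a
coef (_ ∷ as) (suc k) = coef as k

_⊖ₛ_ : Seq → Seq → Seq
(f ⊖ₛ g) k = f k ⊖ g k

conv : Seq → Seq → Seq
conv f g zero    = f 0 ⊗ g 0
conv f g (suc k) = f 0 ⊗ g (suc k) ⊕ conv (f ∘ suc) g k

δ₀ : Seq
δ₀ = coef (1ᵢ ∷ [])

-- D w multiplies a power series by 1 - w x.
D : ℚi → Seq → Seq
D w f zero    = f 0
D w f (suc k) = f (suc k) ⊖ w ⊗ f k

DD : List ℚi → Seq → Seq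
DD []       f = f
DD (w ∷ ws) f = D w (DD ws f)

conv-cong : ∀ {f f′ g g′} → (∀ k → f k ≡ f′ k) → (∀ k → g k ≡ g′ k) → ∀ k → conv f g k ≡ conv f′ g′ k
conv-cong f≡ g≡ zero    = cong₂ _⊗_ (f≡ 0) (g≡ 0)
conv-cong f≡ g≡ (suc k) = cong₂ _⊕_ (cong₂ _⊗_ (f≡ 0) (g≡ (suc k))) (conv-cong (f≡ ∘ suc) g≡ k)

D-cong : ∀ {w f g} → (∀ k → f k ≡ g k) → ∀ k → D w f k ≡ D w g k
D-cong f≡g zero    = f≡g 0
D-cong {w} f≡g (suc k) = cong₂ (λ x y → x ⊖ w ⊗ y) (f≡g (suc k)) (f≡g k)

D-⊖ : ∀ w f g k → D w f k ⊖ D w g k ≡ D w (f ⊖ₛ g) k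
D-⊖ w f g zero    = refl
D-⊖ w f g (suc k) = e w (f (suc k)) (f k) (g (suc k)) (g k)
  where
  e : ∀ w a b c d → (a ⊕ (⊝ (w ⊗ b))) ⊕ (⊝ (c ⊕ (⊝ (w ⊗ d)))) ≡ (a ⊕ (⊝ c)) ⊕ (⊝ (w ⊗ (b ⊕ (⊝ d))))
  e = solve-∀ ℚi-ring

0-conv : ∀ g k → conv (λ _ → 0ᵢ) g k ≡ 0ᵢ
0-conv g zero    = ℚi.zeroˡ (g 0)
0-conv g (suc k) = trans (cong (0ᵢ ⊗ g (suc k) ⊕_) (0-conv g k)) (e (g (suc k)))
  where
  e : ∀ a → 0ᵢ ⊗ a ⊕ 0ᵢ ≡ 0ᵢ
  e = solve-∀ ℚi-ring

δ₀-conv : ∀ g k → conv δ₀ g k ≡ g k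
δ₀-conv g zero    = ℚi.*-identityˡ (g 0)
δ₀-conv g (suc k) = trans (cong (1ᵢ ⊗ g (suc k) ⊕_) (0-conv g k)) (e (g (suc k)))
  where
  e : ∀ a → 1ᵢ ⊗ a ⊕ 0ᵢ ≡ a
  e = solve-∀ ℚi-ring

conv-δ₀ : ∀ f k → conv f δ₀ k ≡ f k
conv-δ₀ f zero    = ℚi.*-identityʳ (f 0)
conv-δ₀ f (suc k) = trans (cong (f 0 ⊗ 0ᵢ ⊕_) (conv-δ₀ (f ∘ suc) k)) (e (f 0) (f (suc k)))
  where
  e : ∀ a b → a ⊗ 0ᵢ ⊕ b ≡ b
  e = solve-∀ ℚi-ring

conv-⊖ˡ : ∀ f f′ g k → conv (f ⊖ₛ f′) g k ≡ conv f g k ⊖ conv f′ g k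
conv-⊖ˡ f f′ g zero    = e (f 0) (f′ 0) (g 0)
  where
  e : ∀ a b c → (a ⊕ (⊝ b)) ⊗ c ≡ a ⊗ c ⊕ (⊝ (b ⊗ c))
  e = solve-∀ ℚi-ring
conv-⊖ˡ f f′ g (suc k) = trans (cong ((f 0 ⊖ f′ 0) ⊗ g (suc k) ⊕_) (conv-⊖ˡ (f ∘ suc) (f′ ∘ suc) g k))
  (e (f 0) (f′ 0) (g (suc k)) (conv (f ∘ suc) g k) (conv (f′ ∘ suc) g k))
  where
  e : ∀ a b c x y → (a ⊕ (⊝ b)) ⊗ c ⊕ (x ⊕ (⊝ y)) ≡ (a ⊗ c ⊕ x) ⊕ (⊝ (b ⊗ c ⊕ y))
  e = solve-∀ ℚi-ring

conv-⊖ʳ : ∀ f g g′ k → conv f (g ⊖ₛ g′) k ≡ conv f g k ⊖ conv f g′ k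
conv-⊖ʳ f g g′ zero    = e (f 0) (g 0) (g′ 0)
  where
  e : ∀ c a b → c ⊗ (a ⊕ (⊝ b)) ≡ c ⊗ a ⊕ (⊝ (c ⊗ b))
  e = solve-∀ ℚi-ring
conv-⊖ʳ f g g′ (suc k) = trans (cong (f 0 ⊗ (g (suc k) ⊖ g′ (suc k)) ⊕_) (conv-⊖ʳ (f ∘ suc) g g′ k))
  (e (f 0) (g (suc k)) (g′ (suc k)) (conv (f ∘ suc) g k) (conv (f ∘ suc) g′ k))
  where
  e : ∀ c a b x y → c ⊗ (a ⊕ (⊝ b)) ⊕ (x ⊕ (⊝ y)) ≡ (c ⊗ a ⊕ x) ⊕ (⊝ (c ⊗ b ⊕ y))
  e = solve-∀ ℚi-ring

conv-scaleˡ : ∀ c f g k → conv (λ j → c ⊗ f j) g k ≡ c ⊗ conv f g k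
conv-scaleˡ c f g zero    = ⊗-assoc c (f 0) (g 0)
conv-scaleˡ c f g (suc k) = trans (cong (c ⊗ f 0 ⊗ g (suc k) ⊕_) (conv-scaleˡ c (f ∘ suc) g k))
    (e c (f 0) (g (suc k)) (conv (f ∘ suc) g k))
  where
  e : ∀ c a b x → c ⊗ a ⊗ b ⊕ c ⊗ x ≡ c ⊗ (a ⊗ b ⊕ x)
  e = solve-∀ ℚi-ring

D-conv : ∀ w f g k → conv (D w f) g k ≡ D w (conv f g) k
D-conv w f g zero    = refl
D-conv w f g (suc k) = trans
  (cong (f 0 ⊗ g (suc k) ⊕_) (trans (conv-⊖ˡ (f ∘ suc) (λ j → w ⊗ f j) g k)
    (cong (conv (f ∘ suc) g k ⊖_) (conv-scaleˡ w f g k))))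
  (e (f 0 ⊗ g (suc k)) (conv (f ∘ suc) g k) (w ⊗ conv f g k))
  where
  e : ∀ a x y → a ⊕ (x ⊕ (⊝ y)) ≡ (a ⊕ x) ⊕ (⊝ y)
  e = solve-∀ ℚi-ring

conv-D : ∀ w f g k → conv f (D w g) k ≡ D w (conv f g) k
conv-D w f g zero          = refl
conv-D w f g (suc zero)    = e w (f 0) (g 1) (g 0) (f 1)
  where
  e : ∀ w a b c d → a ⊗ (b ⊕ (⊝ (w ⊗ c))) ⊕ d ⊗ c ≡ (a ⊗ b ⊕ d ⊗ c) ⊕ (⊝ (w ⊗ (a ⊗ c)))
  e = solve-∀ ℚi-ring
conv-D w f g (suc (suc k)) = trans (cong (f 0 ⊗ (g (suc (suc k)) ⊖ w ⊗ g (suc k)) ⊕_) (conv-D w (f ∘ suc) g (suc k)))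
  (e w (f 0) (g (suc (suc k))) (g (suc k)) (conv (f ∘ suc) g (suc k)) (conv (f ∘ suc) g k))
  where
  e : ∀ w a b c x y → a ⊗ (b ⊕ (⊝ (w ⊗ c))) ⊕ (x ⊕ (⊝ (w ⊗ y))) ≡ (a ⊗ b ⊕ x) ⊕ (⊝ (w ⊗ (a ⊗ c ⊕ y)))
  e = solve-∀ ℚi-ring

-- Links the operator to the product polynomial `DD ws δ₀`, so that an approximation of P/P(0) by
-- that polynomial can be multiplied by Q.
DD-δ₀-conv : ∀ ws g k → conv (DD ws δ₀) g k ≡ DD ws g k
DD-δ₀-conv []       g k = δ₀-conv g k
DD-δ₀-conv (w ∷ ws) g k = trans (D-conv w (DD ws δ₀) g k) (D-cong (DD-δ₀-conv ws g) k)

-- Finite products and their norms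

addᵢ : List ℚi → List ℚi → List ℚi
addᵢ []       bs       = bs
addᵢ (a ∷ as) []       = a ∷ as
addᵢ (a ∷ as) (b ∷ bs) = a ⊕ b ∷ addᵢ as bs

mulᵢ : List ℚi → List ℚi → List ℚi
mulᵢ []       bs = []
mulᵢ (a ∷ as) bs = addᵢ (map (a ⊗_) bs) (0ᵢ ∷ mulᵢ as bs)

coef-addᵢ : ∀ as bs k → coef (addᵢ as bs) k ≡ coef as k ⊕ coef bs k
coef-addᵢ []       bs       k       = sym (ℚi.+-identityˡ (coef bs k))
coef-addᵢ (a ∷ as) []       k       = sym (ℚi.+-identityʳ (coef (a ∷ as) k))
coef-addᵢ (a ∷ as) (b ∷ bs) zero    = refl
coef-addᵢ (a ∷ as) (b ∷ bs) (suc k) = coef-addᵢ as bs k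

coef-scale : ∀ c bs k → coef (map (c ⊗_) bs) k ≡ c ⊗ coef bs k
coef-scale c []       k       = sym (ℚi.zeroʳ c)
coef-scale c (b ∷ bs) zero    = refl
coef-scale c (b ∷ bs) (suc k) = coef-scale c bs k

coef-mulᵢ : ∀ as bs k → coef (mulᵢ as bs) k ≡ conv (coef as) (coef bs) k
coef-mulᵢ []       bs k       = sym (0-conv (coef bs) k)
coef-mulᵢ (a ∷ as) bs zero    = trans (coef-addᵢ (map (a ⊗_) bs) (0ᵢ ∷ mulᵢ as bs) 0)
    (trans (cong (_⊕ 0ᵢ) (coef-scale a bs 0)) (ℚi.+-identityʳ (a ⊗ coef bs 0)))
coef-mulᵢ (a ∷ as) bs (suc k) = trans (coef-addᵢ (map (a ⊗_) bs) (0ᵢ ∷ mulᵢ as bs) (suc k))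
    (cong₂ _⊕_ (coef-scale a bs (suc k)) (coef-mulᵢ as bs k))

L₁-addᵢ : ∀ as bs → L₁ (addᵢ as bs) ≤ L₁ as + L₁ bs
L₁-addᵢ []       bs       = ≤-reflexive (sym (+-identityˡ (L₁ bs)))
L₁-addᵢ (a ∷ as) []       = ≤-reflexive (sym (+-identityʳ (L₁ (a ∷ as))))
L₁-addᵢ (a ∷ as) (b ∷ bs) = +-mono-≤ (N₁-⊕ a b) (L₁-addᵢ as bs) ≤≡ e (N₁ a) (N₁ b) (L₁ as) (L₁ bs)
  where
  e : ∀ a b c d → a + b + (c + d) ≡ a + c + (b + d)
  e = solve-∀ ℚ-ring

L₁-scale : ∀ c bs → L₁ (map (c ⊗_) bs) ≤ N₁ c * L₁ bs
L₁-scale c []       = ≤-reflexive (sym (*-zeroʳ (N₁ c)))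
L₁-scale c (b ∷ bs) = +-mono-≤ (N₁-⊗ c b) (L₁-scale c bs) ≤≡ sym (*-distribˡ-+ (N₁ c) (N₁ b) (L₁ bs))

L₁-mulᵢ : ∀ as bs → L₁ (mulᵢ as bs) ≤ L₁ as * L₁ bs
L₁-mulᵢ []       bs = ≤-reflexive (sym (*-zeroˡ (L₁ bs)))
L₁-mulᵢ (a ∷ as) bs = begin
  L₁ (addᵢ (map (a ⊗_) bs) (0ᵢ ∷ mulᵢ as bs))        ≤⟨ L₁-addᵢ (map (a ⊗_) bs) (0ᵢ ∷ mulᵢ as bs) ⟩
  L₁ (map (a ⊗_) bs) + (N₁ 0ᵢ + L₁ (mulᵢ as bs))
    ≤⟨ +-mono-≤ (L₁-scale a bs) (+-mono-≤ (≤-reflexive N₁-0) (L₁-mulᵢ as bs)) ⟩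
  N₁ a * L₁ bs + (0ℚ + L₁ as * L₁ bs)                ≡⟨ e (N₁ a) (L₁ bs) (L₁ as) ⟩
  (N₁ a + L₁ as) * L₁ bs                             ∎
  where
  open ≤-Reasoning
  e : ∀ a b c → a * b + (0ℚ + c * b) ≡ (a + c) * b
  e = solve-∀ ℚ-ring

-- Young's inequality: the sup norm of a product is at most the ℓ¹ norm of one factor times the sup
-- norm of the other.
N₁-conv-listˡ : ∀ as {g s} → 0ℚ ≤ s → (∀ k → N₁ (g k) ≤ s) → ∀ k → N₁ (conv (coef as) g k) ≤ L₁ as * s
N₁-conv-listˡ []       {g} {s} 0≤s g≤ k = ≤-reflexive (trans (cong N₁ (0-conv g k)) (trans N₁-0 (sym (*-zeroˡ s))))
N₁-conv-listˡ (a ∷ as) {g} {s} 0≤s g≤ zero    = ≤-trans (≤-trans (N₁-⊗ a (g 0)) (*-monoˡ (0≤N₁ a) (g≤ 0)))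
    (*-monoʳ 0≤s (≤-+ʳ {N₁ a} (0≤L₁ as)))
N₁-conv-listˡ (a ∷ as) {g} {s} 0≤s g≤ (suc k) = ≤-trans (N₁-⊕ (a ⊗ g (suc k)) _)
  (+-mono-≤ (≤-trans (N₁-⊗ a (g (suc k))) (*-monoˡ (0≤N₁ a) (g≤ (suc k)))) (N₁-conv-listˡ as 0≤s g≤ k) ≤≡ sym
    (*-distribʳ-+ s (N₁ a) (L₁ as)))

-- The recursion of `conv` consumes its first argument and lowers the index. With the list on the
-- right, an induction therefore needs the ℓ¹ norm truncated at the index.
partial-L₁ : List ℚi → ℕ → ℚ
partial-L₁ []       _       = 0ℚ
partial-L₁ (a ∷ as) zero    = N₁ a
partial-L₁ (a ∷ as) (suc k) = N₁ a + partial-L₁ as k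

partial-L₁-zero : ∀ as → partial-L₁ as 0 ≡ N₁ (coef as 0)
partial-L₁-zero []      = sym N₁-0
partial-L₁-zero (_ ∷ _) = refl

partial-L₁-suc : ∀ as k → partial-L₁ as (suc k) ≡ N₁ (coef as (suc k)) + partial-L₁ as k
partial-L₁-suc []       k       = sym (trans (cong (_+ 0ℚ) N₁-0) (+-identityʳ 0ℚ))
partial-L₁-suc (a ∷ as) zero    = trans (cong (N₁ a +_) (partial-L₁-zero as)) (+-comm (N₁ a) (N₁ (coef as 0)))
partial-L₁-suc (a ∷ as) (suc k) = trans (cong (N₁ a +_) (partial-L₁-suc as k))
    (e (N₁ a) (N₁ (coef as (suc k))) (partial-L₁ as k))
  where
  e : ∀ a b c → a + (b + c) ≡ b + (a + c)
  e = solve-∀ ℚ-ring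

partial-L₁≤L₁ : ∀ as k → partial-L₁ as k ≤ L₁ as
partial-L₁≤L₁ []       k       = ≤-refl
partial-L₁≤L₁ (a ∷ as) zero    = ≤-+ʳ (0≤L₁ as)
partial-L₁≤L₁ (a ∷ as) (suc k) = +-monoʳ-≤ (N₁ a) (partial-L₁≤L₁ as k)

N₁-conv-listʳ : ∀ bs {f s} → 0ℚ ≤ s → (∀ k → N₁ (f k) ≤ s) → ∀ k → N₁ (conv f (coef bs) k) ≤ s * L₁ bs
N₁-conv-listʳ bs {s = s} 0≤s f≤ k = ≤-trans (partial f≤ k) (*-monoˡ 0≤s (partial-L₁≤L₁ bs k))
  where
  partial : ∀ {f} → (∀ k → N₁ (f k) ≤ s) → ∀ k → N₁ (conv f (coef bs) k) ≤ s * partial-L₁ bs k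
  partial {f} f≤ zero    = ≤-trans (N₁-⊗ (f 0) (coef bs 0)) (*-monoʳ (0≤N₁ (coef bs 0)) (f≤ 0)) ≤≡ cong (s *_)
      (sym (partial-L₁-zero bs))
  partial {f} f≤ (suc k) = ≤-trans (N₁-⊕ (f 0 ⊗ coef bs (suc k)) (conv (f ∘ suc) (coef bs) k))
    (+-mono-≤ (≤-trans (N₁-⊗ (f 0) (coef bs (suc k))) (*-monoʳ (0≤N₁ (coef bs (suc k))) (f≤ 0)))
      (partial (f≤ ∘ suc) k)
      ≤≡ trans (sym (*-distribˡ-+ s (N₁ (coef bs (suc k))) (partial-L₁ bs k)))
        (cong (s *_) (sym (partial-L₁-suc bs k))))

N₁-D : ∀ w f {s} → (∀ k → N₁ (f k) ≤ s) → ∀ k → N₁ (D w f k) ≤ s * (1ℚ + N₁ w)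
N₁-D w f {s} f≤ zero    = ≤-trans (f≤ 0) (sym (*-identityʳ s) ≡≤ *-monoˡ (≤-trans (0≤N₁ (f 0)) (f≤ 0))
    (≤-+ʳ (0≤N₁ w)))
N₁-D w f {s} f≤ (suc k) = begin
  N₁ (f (suc k) ⊖ w ⊗ f k)          ≤⟨ N₁-⊖ (f (suc k)) (w ⊗ f k) ⟩
  N₁ (f (suc k)) + N₁ (w ⊗ f k)     ≤⟨ +-mono-≤ (f≤ (suc k)) (≤-trans (N₁-⊗ w (f k)) (*-monoˡ (0≤N₁ w) (f≤ k))) ⟩
  s + N₁ w * s                      ≡⟨ e s (N₁ w) ⟩
  s * (1ℚ + N₁ w)                   ∎
  where
  open ≤-Reasoning
  e : ∀ s w → s + w * s ≡ s * (1ℚ + w)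
  e = solve-∀ ℚ-ring

-- Approximate division by factors 1 - w x

2ℚ : ℚ
2ℚ = 1ℚ + 1ℚ

0≤2 : 0ℚ ≤ 2ℚ
0≤2 = from-yes (0ℚ ≤? 2ℚ)

-- For η ≤ 1 the term in η² is absorbed by the one in η, so B doubles and grows by 1 in each step.
bernoulli-upper : ∀ m → Σ ℚ λ B → 0ℚ ≤ B × (∀ {η} → 0ℚ ≤ η → η ≤ 1ℚ → (1ℚ + η) ^ m ≤ 1ℚ + B * η)
bernoulli-upper zero    = 0ℚ , ≤-refl , λ {η} _ _ → ≤-reflexive
    (sym (trans (cong (1ℚ +_) (*-zeroˡ η)) (+-identityʳ 1ℚ)))
bernoulli-upper (suc m) =
  let (B , 0≤B , bound) = bernoulli-upper m
  in 1ℚ + (B + B) , 0≤a+b 0≤1 (0≤a+b 0≤B 0≤B) , λ {η} 0≤η η≤1 → begin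
    (1ℚ + η) * (1ℚ + η) ^ m              ≤⟨ *-monoˡ (0≤a+b 0≤1 0≤η) (bound 0≤η η≤1) ⟩
    (1ℚ + η) * (1ℚ + B * η)              ≡⟨ e₁ η B ⟩
    1ℚ + η + B * η + B * η * η           ≤⟨ +-monoʳ-≤ (1ℚ + η + B * η) (*-monoˡ (0≤a*b 0≤B 0≤η) η≤1) ⟩
    1ℚ + η + B * η + B * η * 1ℚ          ≡⟨ e₂ η B ⟩
    1ℚ + (1ℚ + (B + B)) * η              ∎
  where
  open ≤-Reasoning
  e₁ : ∀ η B → (1ℚ + η) * (1ℚ + B * η) ≡ 1ℚ + η + B * η + B * η * η
  e₁ = solve-∀ ℚ-ring
  e₂ : ∀ η B → 1ℚ + η + B * η + B * η * 1ℚ ≡ 1ℚ + (1ℚ + (B + B)) * η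
  e₂ = solve-∀ ℚ-ring

^-monoʳ : ∀ {p i m} → 1ℚ ≤ p → i ℕ.≤ m → p ^ i ≤ p ^ m
^-monoʳ {p} {m = m} 1≤p ℕ.z≤n = sym (1^ m) ≡≤ ^-mono m 0≤1 1≤p
^-monoʳ 1≤p (ℕ.s≤s i≤m) = *-monoˡ (≤-trans 0≤1 1≤p) (^-monoʳ 1≤p i≤m)

opaque
  -- The margin η is what later separates the two cases: a w that violates the bound has 1/w
  -- strictly inside the unit disk, while one that meets it still has harmless powers up to m.
  near-unit-powers : ∀ m → Σ ℚ λ η → 0ℚ < η × (∀ {w i} → normSq w ≤ 1ℚ + η → i ℕ.≤ m → N₁ (w ^ᵢ i) ≤ 2ℚ)
  near-unit-powers m =
    let (B , 0≤B , bound) = bernoulli-upper m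
        (r , 0<r , rB≤1) = shrink B 0≤B 0<1
        η = r ⊓ 1ℚ
        0<η = 0<⊓ 0<r 0<1
        total : (1ℚ + η) ^ m ≤ 2ℚ
        total = ≤-trans (bound (<⇒≤ 0<η) (p⊓q≤q r 1ℚ)) (+-monoʳ-≤ 1ℚ
            (≤-trans (*-comm B η ≡≤ *-monoʳ 0≤B (p⊓q≤p r 1ℚ)) rB≤1))
    in η , 0<η , λ {w} {i} w≤ i≤m →
      let w^i≤ : normSq (w ^ᵢ i) ≤ 2ℚ
          w^i≤ = ≤-trans (normSq-^ w i ≡≤ ^-mono i (0≤normSq w) w≤) (≤-trans (^-monoʳ (≤-+ʳ (<⇒≤ 0<η)) i≤m) total)
      in N₁≤ 0≤2 (+-mono-≤ w^i≤ w^i≤)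

coef-applyUpTo : ∀ (f : Seq) m → (∀ k → m ℕ.≤ k → f k ≡ 0ᵢ) → ∀ k → coef (applyUpTo f m) k ≡ f k
coef-applyUpTo f zero    tail k       = sym (tail k ℕ.z≤n)
coef-applyUpTo f (suc m) tail zero    = refl
coef-applyUpTo f (suc m) tail (suc k) = coef-applyUpTo (f ∘ suc) m (λ j m≤j → tail (suc j) (ℕ.s≤s m≤j)) k

L₁-applyUpTo : ∀ (f : Seq) m {s} → (∀ k → k ℕ.< m → N₁ (f k) ≤ s) → L₁ (applyUpTo f m) ≤ fromℕ m * s
L₁-applyUpTo f zero    {s} f≤ = ≤-reflexive (sym (trans (cong (_* s) fromℕ-0) (*-zeroˡ s)))
L₁-applyUpTo f (suc m) {s} f≤ = +-mono-≤ (f≤ 0 (ℕ.s≤s ℕ.z≤n))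
    (L₁-applyUpTo (f ∘ suc) m (λ k k<m → f≤ (suc k) (ℕ.s≤s k<m)))
  ≤≡ sym (trans (cong (_* s) (fromℕ-suc m)) (e (fromℕ m) s))
  where
  e : ∀ n s → (1ℚ + n) * s ≡ s + n * s
  e = solve-∀ ℚ-ring

-- If |w| is at most about 1, then 1 - (1 - w x) Q is the average of 1, w x, …, (w x)ᵐ when Q
-- is the average of the partial geometric sums 1 + w x + … + (w x)ⁱ⁻¹ for i ≤ m.
module AveragedGeometric (m : ℕ) (w : ℚi) (powers : ∀ {i} → i ℕ.≤ suc m → N₁ (w ^ᵢ i) ≤ 2ℚ) where

  μ : ℚ
  μ = 1/suc m

  -- Of the m + 1 partial sums, m - k contain (w x)ᵏ; truncated subtraction handles k ≥ m.
  weight : ℕ → ℚ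
  weight k = fromℕ (m ∸ k) * μ

  term : Seq
  term k = real (weight k) ⊗ w ^ᵢ k

  kernel : List ℚi
  kernel = applyUpTo term (suc m)

  0≤μ : 0ℚ ≤ μ
  0≤μ = <⇒≤ (0<1/suc m)

  private
    N₁-real-⊗ : ∀ {r s v} → 0ℚ ≤ r → r ≤ s → N₁ v ≤ 2ℚ → N₁ (real r ⊗ v) ≤ s * 2ℚ
    N₁-real-⊗ {r} {s} {v} 0≤r r≤s v≤2 = ≤-trans (N₁-⊗ (real r) v)
      (cong (_* N₁ v) (trans (N₁-real r) (0≤p⇒∣p∣≡p 0≤r)) ≡≤ *-mono (≤-trans 0≤r r≤s) (0≤N₁ v) r≤s v≤2)

    zero-weight : ∀ {k} → m ∸ k ≡ 0 → weight k ≡ 0ℚ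
    zero-weight eq = trans (cong (λ n → fromℕ n * μ) eq) (trans (cong (_* μ) fromℕ-0) (*-zeroˡ μ))

    0≤weight : ∀ k → 0ℚ ≤ weight k
    0≤weight k = 0≤a*b (0≤fromℕ (m ∸ k)) 0≤μ

    weight≤1 : ∀ k → weight k ≤ 1ℚ
    weight≤1 k = *-monoʳ 0≤μ (fromℕ-mono (ℕP.≤-trans (ℕP.m∸n≤m m k) (ℕP.n≤1+n m))) ≤≡ suc*1/suc m

  coef-kernel : ∀ k → coef kernel k ≡ term k
  coef-kernel = coef-applyUpTo term (suc m) λ k m<k →
    trans (cong (λ c → real c ⊗ w ^ᵢ k) (zero-weight {k} (ℕP.m≤n⇒m∸n≡0 (ℕP.<⇒≤ m<k)))) (ℚi.zeroˡ (w ^ᵢ k))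

  L₁-kernel : L₁ kernel ≤ fromℕ (suc m) * 2ℚ
  L₁-kernel = L₁-applyUpTo term (suc m) λ k k<m → N₁-real-⊗ {weight k} {1ℚ} (0≤weight k) (weight≤1 k)
      (powers (ℕP.<⇒≤ k<m)) ≤≡ *-identityˡ 2ℚ

  -- The weights fall from 1 - μ in steps of μ until they vanish, so each coefficient of the error
  -- is 0 or μ times a power of w.
  kernel-inverts : ∀ k → N₁ (δ₀ k ⊖ D w (coef kernel) k) ≤ μ * 2ℚ
  kernel-inverts zero = cong N₁ (trans (cong (1ᵢ ⊖_) (coef-kernel 0)) first) ≡≤ N₁-real-⊗ 0≤μ ≤-refl (powers ℕ.z≤n)
    where
    1-weight : 1ℚ - weight 0 ≡ μ
    1-weight = trans (cong (_- weight 0) (trans (sym (suc*1/suc m)) (cong (_* μ) (fromℕ-suc m))))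
        ([1+n]p-np≡p (fromℕ m) μ)
    first : 1ᵢ ⊖ term 0 ≡ real μ ⊗ 1ᵢ
    first = trans (e₄ (real (weight 0))) (cong (λ c → real c ⊗ 1ᵢ) 1-weight)
      where
      e₄ : ∀ u → 1ᵢ ⊕ (⊝ (u ⊗ 1ᵢ)) ≡ (1ᵢ ⊕ (⊝ u)) ⊗ 1ᵢ
      e₄ = solve-∀ ℚi-ring
  kernel-inverts (suc k) = cong N₁ rewritten ≡≤ bound (m ∸ k) refl
    where
    e₁ : ∀ a b w v → 0ᵢ ⊕ (⊝ ((a ⊗ (w ⊗ v)) ⊕ (⊝ (w ⊗ (b ⊗ v))))) ≡ (b ⊕ (⊝ a)) ⊗ (w ⊗ v)
    e₁ = solve-∀ ℚi-ring
    rewritten : 0ᵢ ⊖ D w (coef kernel) (suc k) ≡ real (weight k - weight (suc k)) ⊗ w ^ᵢ suc k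
    rewritten = trans (cong₂ (λ x y → 0ᵢ ⊖ (x ⊖ w ⊗ y)) (coef-kernel (suc k)) (coef-kernel k))
      (e₁ (real (weight (suc k))) (real (weight k)) w (w ^ᵢ k))
    m∸suc : ∀ m k → m ∸ suc k ≡ ℕ.pred (m ∸ k)
    m∸suc m k = sym (ℕP.pred[m∸n]≡m∸[1+n] m k)
    bound : ∀ d → m ∸ k ≡ d → N₁ (real (weight k - weight (suc k)) ⊗ w ^ᵢ suc k) ≤ μ * 2ℚ
    bound zero eq = cong N₁ (trans (cong (λ c → real c ⊗ w ^ᵢ suc k)
        (cong₂ _-_ (zero-weight {k} eq) (zero-weight {suc k} (trans (m∸suc m k) (cong ℕ.pred eq)))))
          (ℚi.zeroˡ (w ^ᵢ suc k)))
      ≡≤ N₁-0 ≡≤ 0≤a*b 0≤μ 0≤2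
    bound (suc d) eq = cong (λ c → N₁ (real c ⊗ w ^ᵢ suc k)) weight-step
      ≡≤ N₁-real-⊗ 0≤μ ≤-refl (powers (ℕP.≤-trans k<m (ℕP.n≤1+n m)))
      where
      k<m : k ℕ.< m
      k<m = ℕP.m∸n≢0⇒n<m λ m∸k≡0 → case-0 (trans (sym eq) m∸k≡0)
        where
        case-0 : suc d ≡ 0 → ⊥
        case-0 ()
      weight-step : weight k - weight (suc k) ≡ μ
      weight-step = trans (cong₂ (λ i j → fromℕ i * μ - fromℕ j * μ) eq (trans (m∸suc m k) (cong ℕ.pred eq)))
        (trans (cong (λ x → x * μ - fromℕ d * μ) (fromℕ-suc d)) ([1+n]p-np≡p (fromℕ d) μ))

-- Division of A by n factors 1 - w x up to ε in sup norm, where a and L bound the ℓ¹ norms of A and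
-- of Q, and η is the admissible excess of |w|² over 1.
ApproximatelyInvertible : ℕ → ℚ → ℚ → ℚ → ℚ → Set
ApproximatelyInvertible n a ε L η = ∀ ws → length ws ≡ n → All (λ w → normSq w ≤ 1ℚ + η) ws → ∀ A → L₁ A ≤ a →
  Σ (List ℚi) λ Q → L₁ Q ≤ L × (∀ k → N₁ (coef A k ⊖ DD ws (coef Q) k) ≤ ε)

-- The bounds L and η depend on the w's only through their number; this leaves room for
-- perturbing the product of the factors 1 - w x afterwards.
opaque
  approximately-invertible : ∀ n {a ε} → 0ℚ ≤ a → 0ℚ < ε →
    Σ ℚ λ L → Σ ℚ λ η → 0ℚ ≤ L × 0ℚ < η × ApproximatelyInvertible n a ε L η
  approximately-invertible zero {a} {ε} 0≤a 0<ε = a , 1ℚ , 0≤a , 0<1 , trivial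
    where
    trivial : ApproximatelyInvertible zero a ε a 1ℚ
    trivial [] _ _ A A≤a = A , A≤a , λ k → cong N₁ (ℚi.-‿inverseʳ (coef A k)) ≡≤ N₁-0 ≡≤ <⇒≤ 0<ε
  approximately-invertible (suc n) {a} {ε} 0≤a 0<ε = L , η , 0≤L , 0<⊓ 0<η₁ 0<η₂ , invert
    where
    open ≤-Reasoning
    0<½ε : 0ℚ < ½ * ε
    0<½ε = 0<a*b 0<½ 0<ε
    0<⅛ε : 0ℚ < ⅛ * ε
    0<⅛ε = 0<a*b (from-yes (0ℚ <? ⅛)) 0<ε
    target : Σ ℚ λ r → 0ℚ < r × r * (2ℚ * a) ≤ ½ * ε
    target = shrink (2ℚ * a) (0≤a*b 0≤2 0≤a) 0<½ε
    size : ∃ λ m → 1/suc m ≤ proj₁ target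
    size = 1/suc-small (proj₁ (proj₂ target))
    m : ℕ
    m = proj₁ size
    near : Σ ℚ λ η → 0ℚ < η × (∀ {w i} → normSq w ≤ 1ℚ + η → i ℕ.≤ suc m → N₁ (w ^ᵢ i) ≤ 2ℚ)
    near = near-unit-powers (suc m)
    η₁ a′ : ℚ
    η₁ = proj₁ near
    -- The ℓ¹ norm of A times the kernel is bounded in terms of m alone, so the recursive call for
    -- the other factors can be made before w is known.
    a′ = a * (fromℕ (suc m) * 2ℚ)
    0<η₁ : 0ℚ < η₁
    0<η₁ = proj₁ (proj₂ near)
    0≤a′ : 0ℚ ≤ a′
    0≤a′ = 0≤a*b 0≤a (0≤a*b (0≤fromℕ (suc m)) 0≤2)
    rec : Σ ℚ λ L → Σ ℚ λ η → 0ℚ ≤ L × 0ℚ < η × ApproximatelyInvertible n a′ (⅛ * ε) L η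
    -- Multiplying back by 1 - w x enlarges the sup norm at most threefold, as N₁ w ≤ 2, and 3/8 is
    -- below 1/2.
    rec = approximately-invertible n 0≤a′ 0<⅛ε
    L η₂ η : ℚ
    L = proj₁ rec
    η₂ = proj₁ (proj₂ rec)
    η = η₁ ⊓ η₂
    0≤L : 0ℚ ≤ L
    0≤L = proj₁ (proj₂ (proj₂ rec))
    0<η₂ : 0ℚ < η₂
    0<η₂ = proj₁ (proj₂ (proj₂ (proj₂ rec)))

    invert : ApproximatelyInvertible (suc n) a ε L η
    invert (w ∷ ws) len (w≤ ∷ ws≤) A A≤a =
      let (Q , Q≤L , close) = proj₂ (proj₂ (proj₂ (proj₂ rec))) ws (ℕP.suc-injective len)
                                (All.map (λ v≤ → ≤-trans v≤ (+-monoʳ-≤ 1ℚ (p⊓q≤q η₁ η₂))) ws≤) Q₁ Q₁≤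
      in Q , Q≤L , λ k → begin
        N₁ (coef A k ⊖ D w (DD ws (coef Q)) k)
          ≡⟨ cong N₁ (telescope (coef A k) (D w (coef Q₁) k) (D w (DD ws (coef Q)) k)) ⟩
        N₁ ((coef A k ⊖ D w (coef Q₁) k) ⊕ (D w (coef Q₁) k ⊖ D w (DD ws (coef Q)) k))
          ≤⟨ N₁-⊕ (coef A k ⊖ D w (coef Q₁) k) (D w (coef Q₁) k ⊖ D w (DD ws (coef Q)) k) ⟩
        N₁ (coef A k ⊖ D w (coef Q₁) k) + N₁ (D w (coef Q₁) k ⊖ D w (DD ws (coef Q)) k)
          ≤⟨ +-mono-≤ (first k) (cong N₁ (D-⊖ w (coef Q₁) (DD ws (coef Q)) k) ≡≤ D-bound
            (coef Q₁ ⊖ₛ DD ws (coef Q)) close k) ⟩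
        ½ * ε + ½ * ε
          ≡⟨ halves ε ⟩
        ε ∎
      where
      powers : ∀ {i} → i ℕ.≤ suc m → N₁ (w ^ᵢ i) ≤ 2ℚ
      powers = proj₂ (proj₂ near) (≤-trans w≤ (+-monoʳ-≤ 1ℚ (p⊓q≤p η₁ η₂)))
      open AveragedGeometric m w powers
      Q₁ : List ℚi
      Q₁ = mulᵢ A kernel
      Q₁≤ : L₁ Q₁ ≤ a′
      Q₁≤ = ≤-trans (L₁-mulᵢ A kernel) (*-mono 0≤a (0≤L₁ kernel) A≤a L₁-kernel)
      w≤2 : N₁ w ≤ 2ℚ
      w≤2 = cong N₁ (sym (ℚi.*-identityʳ w)) ≡≤ powers {1} (ℕ.s≤s ℕ.z≤n)
      first : ∀ k → N₁ (coef A k ⊖ D w (coef Q₁) k) ≤ ½ * ε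
      first k = begin
        N₁ (coef A k ⊖ D w (coef Q₁) k)
          ≡⟨ cong N₁ (cong₂ _⊖_ (sym (conv-δ₀ (coef A) k))
            (trans (D-cong (coef-mulᵢ A kernel) k) (sym (conv-D w (coef A) (coef kernel) k)))) ⟩
        N₁ (conv (coef A) δ₀ k ⊖ conv (coef A) (D w (coef kernel)) k)
          ≡⟨ cong N₁ (sym (conv-⊖ʳ (coef A) δ₀ (D w (coef kernel)) k)) ⟩
        N₁ (conv (coef A) (δ₀ ⊖ₛ D w (coef kernel)) k)
          ≤⟨ N₁-conv-listˡ A (0≤a*b 0≤μ 0≤2) kernel-inverts k ⟩
        L₁ A * (μ * 2ℚ)
          ≤⟨ *-mono 0≤a (0≤a*b 0≤μ 0≤2) A≤a (*-monoʳ 0≤2 (proj₂ size)) ⟩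
        a * (proj₁ target * 2ℚ)
          ≡⟨ e₃ a (proj₁ target) ⟩
        proj₁ target * (2ℚ * a)
          ≤⟨ proj₂ (proj₂ target) ⟩
        ½ * ε ∎
        where
        e₃ : ∀ a r → a * (r * 2ℚ) ≡ r * (2ℚ * a)
        e₃ = solve-∀ ℚ-ring
      D-bound : ∀ f → (∀ k → N₁ (f k) ≤ ⅛ * ε) → ∀ k → N₁ (D w f k) ≤ ½ * ε
      D-bound f f≤ k = begin
        N₁ (D w f k)               ≤⟨ N₁-D w f f≤ k ⟩
        ⅛ * ε * (1ℚ + N₁ w)        ≤⟨ *-monoˡ (<⇒≤ 0<⅛ε) (+-monoʳ-≤ 1ℚ w≤2) ⟩
        ⅛ * ε * (1ℚ + 2ℚ)          ≤⟨ ≤-from-slack (⅛ * ε) (<⇒≤ 0<⅛ε) (e₄ ε) ⟩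
        ½ * ε                      ∎
        where
        e₄ : ∀ ε → ⅛ * ε * (1ℚ + 2ℚ) + ⅛ * ε ≡ ½ * ε
        e₄ = solve-∀ ℚ-ring

-- Division of g + b₁ x + … + bₙ xⁿ by 1 - w x, stopped before degree n.
quotient : ℚi → ℚi → List ℚi → List ℚi
quotient w g []            = []
quotient w g (b ∷ [])      = []
quotient w g (b ∷ b′ ∷ bs) = b ⊕ w ⊗ g ∷ quotient w (b ⊕ w ⊗ g) (b′ ∷ bs)

remainder : ℚi → ℚi → List ℚi → ℚi
remainder w = foldl (λ g b → b ⊕ w ⊗ g)

length-quotient : ∀ w g b bs → length (quotient w g (b ∷ bs)) ≡ length bs
length-quotient w g b []        = refl
length-quotient w g b (b′ ∷ bs) = cong suc (length-quotient w (b ⊕ w ⊗ g) b′ bs)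

u⊖[0⊖v]≡u⊕v : ∀ u v → u ⊖ (0ᵢ ⊖ v) ≡ u ⊕ v
u⊖[0⊖v]≡u⊕v = e
  where
  e : ∀ u v → u ⊕ (⊝ (0ᵢ ⊕ (⊝ v))) ≡ u ⊕ v
  e = solve-∀ ℚi-ring

u⊖[u⊕v⊖v]≡0 : ∀ u v → u ⊖ (u ⊕ v ⊖ v) ≡ 0ᵢ
u⊖[u⊕v⊖v]≡0 = e
  where
  e : ∀ u v → u ⊕ (⊝ ((u ⊕ v) ⊕ (⊝ v))) ≡ 0ᵢ
  e = solve-∀ ℚi-ring

-- Horner division is exact except in the top coefficient, whose defect is the remainder.
N₁-division : ∀ w g b bs k →
  N₁ (coef (g ∷ b ∷ bs) k ⊖ D w (coef (g ∷ quotient w g (b ∷ bs))) k) ≤ N₁ (remainder w g (b ∷ bs))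
N₁-division w g b bs zero = trans (cong N₁ (ℚi.-‿inverseʳ g)) N₁-0 ≡≤ 0≤N₁ (remainder w g (b ∷ bs))
N₁-division w g b [] (suc zero) = ≤-reflexive (cong N₁ (u⊖[0⊖v]≡u⊕v b (w ⊗ g)))
N₁-division w g b [] (suc (suc k)) = trans (cong N₁ (trans (u⊖[0⊖v]≡u⊕v 0ᵢ (w ⊗ 0ᵢ))
    (cong (0ᵢ ⊕_) (ℚi.zeroʳ w)))) N₁-0 ≡≤ 0≤N₁ (remainder w g (b ∷ []))
N₁-division w g b (b′ ∷ bs) (suc zero) = trans (cong N₁ (u⊖[u⊕v⊖v]≡0 b (w ⊗ g))) N₁-0 ≡≤ 0≤N₁
    (remainder w g (b ∷ b′ ∷ bs))
N₁-division w g b (b′ ∷ bs) (suc (suc k)) = N₁-division w (b ⊕ w ⊗ g) b′ bs (suc k)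

-- The remainder is wⁿ + b₁ wⁿ⁻¹ + ... + bₙ, the reversed polynomial at w, which is monic because
-- the divided polynomial has constant term 1. An approximate root of it thus yields an approximate
-- divisor 1 - w x.
meval-reverse : ∀ w bs → meval (reverse bs) w ≡ remainder w 1ᵢ bs
meval-reverse w bs = trans (meval-foldr (reverse bs)) (reverse-foldr (λ c v → c ⊕ w ⊗ v) 1ᵢ bs)
  where
  meval-foldr : ∀ cs → meval cs w ≡ foldr (λ c v → c ⊕ w ⊗ v) 1ᵢ cs
  meval-foldr []       = refl
  meval-foldr (c ∷ cs) = cong (λ v → c ⊕ w ⊗ v) (meval-foldr cs)

approximate-reciprocal-root : ∀ b bs {β} → 0ℚ < β → Σ ℚi λ w → N₁ (remainder w 1ᵢ (b ∷ bs)) ≤ β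
approximate-reciprocal-root b bs {β} 0<β =
  let (w , h) = go (reverse (b ∷ bs)) (length-reverse (b ∷ bs))
  in w , (cong N₁ (sym (meval-reverse w (b ∷ bs))) ≡≤ h)
  where
  go : ∀ cs {n} → length cs ≡ suc n → Σ ℚi λ w → N₁ (meval cs w) ≤ β
  go (c ∷ cs) _ = approximate-root c cs 0<β

opaque
  -- The accuracy δ′ for the quotient is fixed only after w is known, since multiplying back by 1 -
  -- w x magnifies the error by up to 1 + N₁ w.
  approximate-factorisation : ∀ n bs → length bs ≡ n → ∀ {δ} → 0ℚ < δ →
    Σ (List ℚi) λ ws → length ws ≡ n × (∀ k → N₁ (coef (1ᵢ ∷ bs) k ⊖ DD ws δ₀ k) ≤ δ)
  approximate-factorisation zero [] _ 0<δ = [] , refl , λ k → trans (cong N₁ (ℚi.-‿inverseʳ (δ₀ k))) N₁-0 ≡≤ <⇒≤ 0<δ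
  approximate-factorisation (suc n) (b ∷ bs) len {δ} 0<δ =
    let (w , rem≤) = approximate-reciprocal-root b bs 0<½δ
        q = quotient w 1ᵢ (b ∷ bs)
        (δ′ , 0<δ′ , δ′≤) = shrink (1ℚ + N₁ w) (0≤a+b 0≤1 (0≤N₁ w)) 0<½δ
        (ws , len′ , close) = approximate-factorisation n q
          (trans (length-quotient w 1ᵢ b bs) (ℕP.suc-injective len)) 0<δ′
    in w ∷ ws , cong suc len′ , λ k → begin
      N₁ (coef (1ᵢ ∷ b ∷ bs) k ⊖ D w (DD ws δ₀) k)
        ≡⟨ cong N₁ (telescope (coef (1ᵢ ∷ b ∷ bs) k) (D w (coef (1ᵢ ∷ q)) k) (D w (DD ws δ₀) k)) ⟩
      N₁ ((coef (1ᵢ ∷ b ∷ bs) k ⊖ D w (coef (1ᵢ ∷ q)) k) ⊕ (D w (coef (1ᵢ ∷ q)) k ⊖ D w (DD ws δ₀) k))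
        ≤⟨ N₁-⊕ (coef (1ᵢ ∷ b ∷ bs) k ⊖ D w (coef (1ᵢ ∷ q)) k) (D w (coef (1ᵢ ∷ q)) k ⊖ D w (DD ws δ₀) k) ⟩
      N₁ (coef (1ᵢ ∷ b ∷ bs) k ⊖ D w (coef (1ᵢ ∷ q)) k) + N₁ (D w (coef (1ᵢ ∷ q)) k ⊖ D w (DD ws δ₀) k)
        ≤⟨ +-mono-≤ (≤-trans (N₁-division w 1ᵢ b bs k) rem≤)
             (cong N₁ (D-⊖ w (coef (1ᵢ ∷ q)) (DD ws δ₀) k) ≡≤ ≤-trans
               (N₁-D w (coef (1ᵢ ∷ q) ⊖ₛ DD ws δ₀) close k) δ′≤) ⟩
      ½ * δ + ½ * δ
        ≡⟨ halves δ ⟩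
      δ ∎
    where
    open ≤-Reasoning
    0<½δ : 0ℚ < ½ * δ
    0<½δ = 0<a*b 0<½ 0<δ

-- Refinement of approximate roots

evalₛ : Seq → ℕ → ℚi → ℚi
evalₛ f zero    z = 0ᵢ
evalₛ f (suc n) z = f 0 ⊕ z ⊗ evalₛ (f ∘ suc) n z

evalₛ-coef : ∀ as z → eval as z ≡ evalₛ (coef as) (length as) z
evalₛ-coef []       z = refl
evalₛ-coef (a ∷ as) z = cong (λ v → a ⊕ z ⊗ v) (evalₛ-coef as z)

evalₛ-⊖ : ∀ f g n z → evalₛ (f ⊖ₛ g) n z ≡ evalₛ f n z ⊖ evalₛ g n z
evalₛ-⊖ f g zero    z = refl
evalₛ-⊖ f g (suc n) z = trans (cong (λ v → (f 0 ⊖ g 0) ⊕ z ⊗ v) (evalₛ-⊖ (f ∘ suc) (g ∘ suc) n z))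
  (e (f 0) (g 0) z (evalₛ (f ∘ suc) n z) (evalₛ (g ∘ suc) n z))
  where
  e : ∀ a b z x y → (a ⊕ (⊝ b)) ⊕ z ⊗ (x ⊕ (⊝ y)) ≡ (a ⊕ z ⊗ x) ⊕ (⊝ (b ⊕ z ⊗ y))
  e = solve-∀ ℚi-ring

evalₛ-scale : ∀ c f n z → evalₛ (λ k → c ⊗ f k) n z ≡ c ⊗ evalₛ f n z
evalₛ-scale c f zero    z = sym (ℚi.zeroʳ c)
evalₛ-scale c f (suc n) z = trans (cong (λ v → c ⊗ f 0 ⊕ z ⊗ v) (evalₛ-scale c (f ∘ suc) n z))
    (horner-scale c (f 0) z (evalₛ (f ∘ suc) n z))

evalₛ-drop : ∀ f n z → f n ≡ 0ᵢ → evalₛ f (suc n) z ≡ evalₛ f n z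
evalₛ-drop f zero    z fn≡0 = trans (cong (_⊕ z ⊗ 0ᵢ) fn≡0) (0⊕z⊗0≡0 z)
evalₛ-drop f (suc n) z fn≡0 = cong (λ v → f 0 ⊕ z ⊗ v) (evalₛ-drop (f ∘ suc) n z fn≡0)

-- Horner evaluation brings in f truncated after n and after n + 1 terms; the condition f n ≡ 0ᵢ
-- makes the two agree.
evalₛ-D : ∀ w f n z → f n ≡ 0ᵢ → evalₛ (D w f) (suc n) z ≡ (1ᵢ ⊖ w ⊗ z) ⊗ evalₛ f n z
evalₛ-D w f n z fn≡0 = trans
  (cong (λ v → f 0 ⊕ z ⊗ v) (trans (evalₛ-⊖ (f ∘ suc) (λ k → w ⊗ f k) n z)
    (cong (evalₛ (f ∘ suc) n z ⊖_) (evalₛ-scale w f n z))))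
  (trans (e₁ (f 0) z (evalₛ (f ∘ suc) n z) w (evalₛ f n z))
    (trans (cong (_⊖ w ⊗ z ⊗ evalₛ f n z) (evalₛ-drop f n z fn≡0)) (e₂ (w ⊗ z) (evalₛ f n z))))
  where
  e₁ : ∀ a z x w y → a ⊕ z ⊗ (x ⊕ (⊝ (w ⊗ y))) ≡ (a ⊕ z ⊗ x) ⊕ (⊝ (w ⊗ z ⊗ y))
  e₁ = solve-∀ ℚi-ring
  e₂ : ∀ v y → y ⊕ (⊝ (v ⊗ y)) ≡ (1ᵢ ⊕ (⊝ v)) ⊗ y
  e₂ = solve-∀ ℚi-ring

product : List ℚi → ℚi → ℚi
product []       z = 1ᵢ
product (w ∷ ws) z = (1ᵢ ⊖ w ⊗ z) ⊗ product ws z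

DD-support : ∀ ws k → length ws ℕ.< k → DD ws δ₀ k ≡ 0ᵢ
DD-support []       (suc k) _             = refl
DD-support (w ∷ ws) (suc k) (ℕ.s≤s ws<k) =
  trans (cong₂ (λ x y → x ⊖ w ⊗ y) (DD-support ws (suc k) (ℕP.m≤n⇒m≤1+n ws<k)) (DD-support ws k ws<k))
      (cong (0ᵢ ⊖_) (ℚi.zeroʳ w))

evalₛ-DD : ∀ ws z → evalₛ (DD ws δ₀) (suc (length ws)) z ≡ product ws z
evalₛ-DD []       z = e z
  where
  e : ∀ z → 1ᵢ ⊕ z ⊗ 0ᵢ ≡ 1ᵢ
  e = solve-∀ ℚi-ring
evalₛ-DD (w ∷ ws) z = trans (evalₛ-D w (DD ws δ₀) (suc (length ws)) z
    (DD-support ws (suc (length ws)) (ℕP.n<1+n (length ws))))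
  (cong ((1ᵢ ⊖ w ⊗ z) ⊗_) (evalₛ-DD ws z))

-- Points with N₁ ≤ 2 are refined to points with N₁ ≤ 4, so evaluation errors are controlled on the
-- larger region.
4ℚ : ℚ
4ℚ = 2ℚ + 2ℚ

0≤4 : 0ℚ ≤ 4ℚ
0≤4 = from-yes (0ℚ ≤? 4ℚ)

geometric : ℕ → ℚ
geometric zero    = 0ℚ
geometric (suc n) = 1ℚ + 4ℚ * geometric n

0≤geometric : ∀ n → 0ℚ ≤ geometric n
0≤geometric zero    = ≤-refl
0≤geometric (suc n) = 0≤a+b 0≤1 (0≤a*b 0≤4 (0≤geometric n))

N₁-evalₛ : ∀ {f δ z} → (∀ k → N₁ (f k) ≤ δ) → N₁ z ≤ 4ℚ → ∀ n → N₁ (evalₛ f n z) ≤ δ * geometric n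
N₁-evalₛ {δ = δ} f≤ z≤ zero = ≤-reflexive (trans N₁-0 (sym (*-zeroʳ δ)))
N₁-evalₛ {f} {δ} {z} f≤ z≤ (suc n) = begin
  N₁ (f 0 ⊕ z ⊗ evalₛ (f ∘ suc) n z)        ≤⟨ N₁-⊕ (f 0) (z ⊗ evalₛ (f ∘ suc) n z) ⟩
  N₁ (f 0) + N₁ (z ⊗ evalₛ (f ∘ suc) n z)
    ≤⟨ +-mono-≤ (f≤ 0) (≤-trans (N₁-⊗ z (evalₛ (f ∘ suc) n z))
      (*-mono 0≤4 (0≤N₁ (evalₛ (f ∘ suc) n z)) z≤ (N₁-evalₛ (f≤ ∘ suc) z≤ n))) ⟩
  δ + 4ℚ * (δ * geometric n)                ≡⟨ e δ (geometric n) ⟩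
  δ * (1ℚ + 4ℚ * geometric n)               ∎
  where
  open ≤-Reasoning
  e : ∀ d g → d + 4ℚ * (d * g) ≡ d * (1ℚ + 4ℚ * g)
  e = solve-∀ ℚ-ring

N₁-eval-product : ∀ bs ws {δ z} → length ws ≡ length bs → (∀ k → N₁ (coef (1ᵢ ∷ bs) k ⊖ DD ws δ₀ k) ≤ δ) → N₁ z ≤ 4ℚ →
  N₁ (eval (1ᵢ ∷ bs) z ⊖ product ws z) ≤ δ * geometric (suc (length bs))
N₁-eval-product bs ws {δ} {z} len close z≤ =
  cong N₁ (trans (cong₂ _⊖_ (evalₛ-coef (1ᵢ ∷ bs) z) (sym
      (trans (cong (λ n → evalₛ (DD ws δ₀) (suc n) z) (sym len)) (evalₛ-DD ws z))))
    (sym (evalₛ-⊖ (coef (1ᵢ ∷ bs)) (DD ws δ₀) (suc (length bs)) z)))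
  ≡≤ N₁-evalₛ close z≤ (suc (length bs))

-- If all |1 - w z|² exceeded σ, their product, which is the |·|² of the whole, could not be below
-- σⁿ.
small-factor : ∀ {σ} → 0ℚ < σ → ∀ ws z → normSq (product ws z) < σ ^ length ws → Σ ℚi λ w → w ∈ ws × normSq
    (1ᵢ ⊖ w ⊗ z) ≤ σ
small-factor 0<σ [] z h = ⊥-elim (<-irrefl refl h)
small-factor {σ} 0<σ (w ∷ ws) z h = decide (normSq (1ᵢ ⊖ w ⊗ z) ≤? σ)
  where
  decide : Dec (normSq (1ᵢ ⊖ w ⊗ z) ≤ σ) → Σ ℚi λ w′ → w′ ∈ w ∷ ws × normSq (1ᵢ ⊖ w′ ⊗ z) ≤ σ
  decide (yes small) = w , here refl , small
  decide (no big) =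
    let (w′ , w′∈ws , small) = small-factor 0<σ ws z (*-cancelˡ-<-nonNeg σ {{nonNegative (<⇒≤ 0<σ)}}
          (≤-<-trans (*-monoʳ (0≤normSq (product ws z)) (<⇒≤ (≰⇒> big)) ≤≡ sym
            (normSq-⊗ (1ᵢ ⊖ w ⊗ z) (product ws z))) h))
    in w′ , there w′∈ws , small

product-root : ∀ {w ws z} → w ∈ ws → w ⊗ z ≡ 1ᵢ → product ws z ≡ 0ᵢ
product-root {z = z} (here {xs = ws} refl) wz≡1 = trans (cong (λ v → (1ᵢ ⊖ v) ⊗ product ws z) wz≡1)
    (ℚi.zeroˡ (product ws z))
product-root {z = z} (there {x = x} w∈ws) wz≡1 = trans (cong ((1ᵢ ⊖ x ⊗ z) ⊗_) (product-root {z = z} w∈ws wz≡1))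
    (ℚi.zeroʳ (1ᵢ ⊖ x ⊗ z))

-- As w z is within ½ of 1, w is invertible. For z′ = 1/w the identity z′ - z = z′ (1 - w z) first
-- gives N₁ z′ ≤ N₁ z′ / 2 + 2, hence the bound 4, and then the distance.
nearby-inverse : ∀ {w z t} → t ≤ ½ → N₁ z ≤ 2ℚ → N₁ (1ᵢ ⊖ w ⊗ z) ≤ t →
  Σ ℚi λ z′ → w ⊗ z′ ≡ 1ᵢ × N₁ z′ ≤ 4ℚ × N₁ (z′ ⊖ z) ≤ 4ℚ * t
nearby-inverse {w} {z} {t} t≤½ z≤2 small = z′ , wz′≡1 , z′≤4 , close
  where
  open ≤-Reasoning
  d : ℚi
  d = 1ᵢ ⊖ w ⊗ z
  0<wz : 0ℚ < N₁ (w ⊗ z)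
  0<wz = <-≤-trans 0<½ (begin
    ½                                    ≡⟨⟩
    1ℚ - ½                               ≤⟨ +-monoʳ-≤ 1ℚ (neg-antimono-≤ (≤-trans small t≤½)) ⟩
    1ℚ - N₁ d                            ≡⟨ cong (_- N₁ d) (sym N₁-1) ⟩
    N₁ 1ᵢ - N₁ d                         ≤⟨ +-monoˡ-≤ (- N₁ d) (cong N₁ (e₁ (w ⊗ z)) ≡≤ N₁-⊕ d (w ⊗ z)) ⟩
    N₁ d + N₁ (w ⊗ z) - N₁ d             ≡⟨ e₂ (N₁ d) (N₁ (w ⊗ z)) ⟩
    N₁ (w ⊗ z)                           ∎)
    where
    e₁ : ∀ v → 1ᵢ ≡ (1ᵢ ⊕ (⊝ v)) ⊕ v
    e₁ = solve-∀ ℚi-ring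
    e₂ : ∀ a b → a + b - a ≡ b
    e₂ = solve-∀ ℚ-ring
  0<w : 0ℚ < normSq w
  0<w = ≰⇒> λ w≤0 → <-irrefl refl (<-≤-trans 0<wz (≤-trans (N₁-⊗ w z)
    (*-monoʳ (0≤N₁ z) (N₁≤ {w} {0ℚ} (≤-refl {0ℚ}) (+-mono-≤ {normSq w} {0ℚ} {normSq w} {0ℚ} w≤0 w≤0)) ≤≡ *-zeroˡ
      (N₁ z))))
  z′ : ℚi
  z′ = proj₁ (inverse w 0<w)
  wz′≡1 : w ⊗ z′ ≡ 1ᵢ
  wz′≡1 = proj₂ (inverse w 0<w)
  z′-z : z′ ⊖ z ≡ z′ ⊗ d
  z′-z = trans (cong (z′ ⊖_) (trans (e₁ z) (trans (cong (_⊗ z) (sym wz′≡1)) (e₂ w z′ z)))) (e₃ z′ (w ⊗ z))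
    where
    e₁ : ∀ z → z ≡ 1ᵢ ⊗ z
    e₁ = solve-∀ ℚi-ring
    e₂ : ∀ w z′ z → w ⊗ z′ ⊗ z ≡ z′ ⊗ (w ⊗ z)
    e₂ = solve-∀ ℚi-ring
    e₃ : ∀ a b → a ⊕ (⊝ (a ⊗ b)) ≡ a ⊗ (1ᵢ ⊕ (⊝ b))
    e₃ = solve-∀ ℚi-ring
  z′-z≤ : N₁ (z′ ⊖ z) ≤ N₁ z′ * t
  z′-z≤ = cong N₁ z′-z ≡≤ ≤-trans (N₁-⊗ z′ d) (*-monoˡ (0≤N₁ z′) small)
  z′≤4 : N₁ z′ ≤ 4ℚ
  z′≤4 = begin
    N₁ z′                                     ≡⟨ e₁ (N₁ z′) ⟩
    2ℚ * (N₁ z′ - N₁ z′ * ½)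
      ≤⟨ *-monoˡ 0≤2 (+-monoˡ-≤ (- (N₁ z′ * ½)) (cong N₁ (e₂ z′ z) ≡≤ N₁-⊕ (z′ ⊖ z) z)) ⟩
    2ℚ * (N₁ (z′ ⊖ z) + N₁ z - N₁ z′ * ½)
      ≤⟨ *-monoˡ 0≤2 (+-monoˡ-≤ (- (N₁ z′ * ½)) (+-mono-≤ (≤-trans z′-z≤ (*-monoˡ (0≤N₁ z′) t≤½)) z≤2)) ⟩
    2ℚ * (N₁ z′ * ½ + 2ℚ - N₁ z′ * ½)         ≡⟨ e₃ (N₁ z′) ⟩
    4ℚ                                        ∎
    where
    e₁ : ∀ x → x ≡ 2ℚ * (x - x * ½)
    e₁ = solve-∀ ℚ-ring
    e₂ : ∀ a b → a ≡ (a ⊕ (⊝ b)) ⊕ b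
    e₂ = solve-∀ ℚi-ring
    e₃ : ∀ x → 2ℚ * (x * ½ + 2ℚ - x * ½) ≡ 4ℚ
    e₃ = solve-∀ ℚ-ring
  close : N₁ (z′ ⊖ z) ≤ 4ℚ * t
  close = ≤-trans z′-z≤ (*-monoʳ (≤-trans (0≤N₁ d) small) z′≤4)

-- The quality δ is fixed before δ′: arbitrarily good approximate roots exist within τ of z. This
-- prescribes the steps of a Cauchy sequence in advance.
Refinable : List ℚi → ℚ → ℚ → Set
Refinable bs τ δ = ∀ {z} → N₁ z ≤ 2ℚ → N₁ (eval (1ᵢ ∷ bs) z) ≤ δ → ∀ {δ′} → 0ℚ < δ′ →
  Σ ℚi λ z′ → N₁ (z′ ⊖ z) ≤ τ × N₁ (eval (1ᵢ ∷ bs) z′) ≤ δ′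

opaque
  -- For each δ′ a fresh factorisation is made. Its product is small at z, hence so is some factor 1
  -- - w z, and 1/w is near z. The product vanishes at 1/w, so the polynomial is as small there as
  -- the factorisation is accurate. The distance depends on σ only, not on δ′.
  refinable : ∀ bs {τ} → 0ℚ < τ → Σ ℚ λ δ → 0ℚ < δ × Refinable bs τ δ
  refinable bs {τ} 0<τ = ½ * s , 0<½s , refine
    where
    open ≤-Reasoning
    n : ℕ
    n = length bs
    t σ s : ℚ
    t = ½ ⊓ (¼ * τ)
    σ = ½ * (t * t)
    -- With s < 1 one has s² ≤ s < σⁿ; the factor ½ makes the inequality strict.
    s = ½ * (1ℚ ⊓ σ ^ n)
    0<t : 0ℚ < t
    0<t = 0<⊓ 0<½ (0<a*b (from-yes (0ℚ <? ¼)) 0<τ)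
    0<σ : 0ℚ < σ
    0<σ = 0<a*b 0<½ (0<a*b 0<t 0<t)
    0<σ^n : 0ℚ < σ ^ n
    0<σ^n = 0<^ n 0<σ
    0<min : 0ℚ < 1ℚ ⊓ σ ^ n
    0<min = 0<⊓ 0<1 0<σ^n
    0<s : 0ℚ < s
    0<s = 0<a*b 0<½ 0<min
    0<½s : 0ℚ < ½ * s
    0<½s = 0<a*b 0<½ 0<s
    s*s<σ^n : s * s < σ ^ n
    s*s<σ^n = <-≤-trans (≤-<-trans (*-monoˡ (<⇒≤ 0<s) s≤1 ≤≡ *-identityʳ s) s<min) (p⊓q≤q 1ℚ (σ ^ n))
      where
      s<min : s < 1ℚ ⊓ σ ^ n
      s<min = <-≤-trans (*-monoˡ-<-pos (1ℚ ⊓ σ ^ n) {{positive 0<min}} (from-yes (½ <? 1ℚ)))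
          (≤-reflexive (*-identityˡ (1ℚ ⊓ σ ^ n)))
      s≤1 : s ≤ 1ℚ
      s≤1 = ≤-trans (<⇒≤ s<min) (p⊓q≤p 1ℚ (σ ^ n))
    refine : Refinable bs τ (½ * s)
    refine {z} z≤2 pz≤ {δ′} 0<δ′ = z′
      , ≤-trans (proj₂ (proj₂ (proj₂ inv))) (*-monoˡ 0≤4 (p⊓q≤q ½ (¼ * τ)) ≤≡ e₃ τ)
      , (cong N₁ (trans (u≡u⊖0 (p z′)) (cong (p z′ ⊖_) (sym (product-root w∈ws (proj₁ (proj₂ inv))))))
          ≡≤ ≤-trans (N₁-eval-product bs ws len close (proj₁ (proj₂ (proj₂ inv)))) (≤-trans δ₁≤ (p⊓q≤q (½ * s) δ′)))
      where
      p : ℚi → ℚi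
      p = eval (1ᵢ ∷ bs)
      tolerance : Σ ℚ λ δ₁ → 0ℚ < δ₁ × δ₁ * geometric (suc n) ≤ ½ * s ⊓ δ′
      tolerance = shrink (geometric (suc n)) (0≤geometric (suc n)) (0<⊓ 0<½s 0<δ′)
      δ₁ : ℚ
      δ₁ = proj₁ tolerance
      δ₁≤ : δ₁ * geometric (suc n) ≤ ½ * s ⊓ δ′
      δ₁≤ = proj₂ (proj₂ tolerance)
      factors : Σ (List ℚi) λ ws → length ws ≡ n × (∀ k → N₁ (coef (1ᵢ ∷ bs) k ⊖ DD ws δ₀ k) ≤ δ₁)
      factors = approximate-factorisation n bs refl (proj₁ (proj₂ tolerance))
      ws : List ℚi
      ws = proj₁ factors
      len : length ws ≡ n
      len = proj₁ (proj₂ factors)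
      close : ∀ k → N₁ (coef (1ᵢ ∷ bs) k ⊖ DD ws δ₀ k) ≤ δ₁
      close = proj₂ (proj₂ factors)
      e₁ : ∀ a b → a ≡ b ⊕ (⊝ (b ⊕ (⊝ a)))
      e₁ = solve-∀ ℚi-ring
      e₃ : ∀ τ → 4ℚ * (¼ * τ) ≡ τ
      e₃ = solve-∀ ℚ-ring
      product≤ : N₁ (product ws z) ≤ s
      product≤ = begin
        N₁ (product ws z)                      ≡⟨ cong N₁ (e₁ (product ws z) (p z)) ⟩
        N₁ (p z ⊖ (p z ⊖ product ws z))        ≤⟨ N₁-⊖ (p z) (p z ⊖ product ws z) ⟩
        N₁ (p z) + N₁ (p z ⊖ product ws z)
          ≤⟨ +-mono-≤ pz≤ (≤-trans (N₁-eval-product bs ws len close (≤-trans z≤2 (from-yes (2ℚ ≤? 4ℚ))))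
            (≤-trans δ₁≤ (p⊓q≤p (½ * s) δ′))) ⟩
        ½ * s + ½ * s                          ≡⟨ halves s ⟩
        s                                      ∎
      product²< : normSq (product ws z) < σ ^ length ws
      product²< = ≤-<-trans (≤-trans (normSq≤N₁² (product ws z))
          (*-mono (<⇒≤ 0<s) (0≤N₁ (product ws z)) product≤ product≤))
                    (subst (λ m → s * s < σ ^ m) (sym len) s*s<σ^n)
      factor : Σ ℚi λ w → w ∈ ws × normSq (1ᵢ ⊖ w ⊗ z) ≤ σ
      factor = small-factor 0<σ ws z product²<
      w : ℚi
      w = proj₁ factor
      w∈ws : w ∈ ws
      w∈ws = proj₁ (proj₂ factor)
      small : normSq (1ᵢ ⊖ w ⊗ z) ≤ σ
      small = proj₂ (proj₂ factor)
      inv : Σ ℚi λ z′ → w ⊗ z′ ≡ 1ᵢ × N₁ z′ ≤ 4ℚ × N₁ (z′ ⊖ z) ≤ 4ℚ * t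
      inv = nearby-inverse {w} {z} (p⊓q≤p ½ (¼ * τ)) z≤2 (N₁≤ (<⇒≤ 0<t) (+-mono-≤ small small ≤≡ halves (t * t)))
      z′ : ℚi
      z′ = proj₁ inv

-- A Cauchy sequence converging to a root

p≤n*p : ∀ {p} n → 0ℚ ≤ p → p ≤ fromℕ (suc n) * p
p≤n*p {p} n 0≤p = sym (*-identityˡ p) ≡≤ *-monoʳ 0≤p (≤-+ʳ {1ℚ} {fromℕ n} (0≤fromℕ n) ≤≡ sym (fromℕ-suc n))

1/suc≤1 : ∀ k → 1/suc k ≤ 1ℚ
1/suc≤1 k = p≤n*p k (<⇒≤ (0<1/suc k)) ≤≡ suc*1/suc k

n*p≤1⇒p≤1/suc : ∀ {p} n → fromℕ (suc n) * p ≤ 1ℚ → p ≤ 1/suc n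
n*p≤1⇒p≤1/suc {p} n h = begin
  p                               ≡⟨ *-identityˡ p ⟨
  1ℚ * p                          ≡⟨ cong (_* p) (suc*1/suc n) ⟨
  fromℕ (suc n) * 1/suc n * p     ≡⟨ e (fromℕ (suc n)) (1/suc n) p ⟩
  1/suc n * (fromℕ (suc n) * p)   ≤⟨ *-monoˡ (<⇒≤ (0<1/suc n)) h ⟩
  1/suc n * 1ℚ                    ≡⟨ *-identityʳ (1/suc n) ⟩
  1/suc n                         ∎
  where
  open ≤-Reasoning
  e : ∀ a b c → a * b * c ≡ b * (a * c)
  e = solve-∀ ℚ-ring

1/suc-antitone : ∀ {m n} → m ℕ.≤ n → 1/suc n ≤ 1/suc m
1/suc-antitone {m} {n} m≤n = n*p≤1⇒p≤1/suc m (≤-trans (*-monoʳ (<⇒≤ (0<1/suc n)) (fromℕ-mono (ℕ.s≤s m≤n)))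
    (≤-reflexive (suc*1/suc n)))

½^≤1/suc : ∀ n → ½ ^ n ≤ 1/suc n
½^≤1/suc n = n*p≤1⇒p≤1/suc n (bound n)
  where
  open ≤-Reasoning
  e₁ : ∀ m p → (1ℚ + (1ℚ + m)) * (½ * p) ≡ ½ * p + ½ * ((1ℚ + m) * p)
  e₁ = solve-∀ ℚ-ring
  bound : ∀ n → fromℕ (suc n) * ½ ^ n ≤ 1ℚ
  bound zero    = ≤-reflexive (trans (*-identityʳ (fromℕ 1))
      (trans (fromℕ-suc 0) (trans (cong (1ℚ +_) fromℕ-0) (+-identityʳ 1ℚ))))
  bound (suc n) = begin
    fromℕ (suc (suc n)) * (½ * ½ ^ n)
      ≡⟨ cong (_* (½ * ½ ^ n)) (trans (fromℕ-suc (suc n)) (cong (1ℚ +_) (fromℕ-suc n))) ⟩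
    (1ℚ + (1ℚ + fromℕ n)) * (½ * ½ ^ n)           ≡⟨ e₁ (fromℕ n) (½ ^ n) ⟩
    ½ * ½ ^ n + ½ * ((1ℚ + fromℕ n) * ½ ^ n)      ≡⟨ cong (λ x → ½ * ½ ^ n + ½ * (x * ½ ^ n)) (sym (fromℕ-suc n)) ⟩
    ½ * ½ ^ n + ½ * (fromℕ (suc n) * ½ ^ n)
      ≤⟨ +-mono-≤ (*-monoˡ (<⇒≤ 0<½) (^≤1 n (<⇒≤ 0<½) (from-yes (½ ≤? 1ℚ)))) (*-monoˡ (<⇒≤ 0<½) (bound n)) ⟩
    ½ * 1ℚ + ½ * 1ℚ                               ≡⟨⟩
    1ℚ                                            ∎

-- All tolerances are fixed by bs and r₀ before a starting point exists, so the factorisation that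
-- supplies this point can be made accurate enough.
module RootSequence (bs : List ℚi) {r₀ : ℚ} (0≤r₀ : 0ℚ ≤ r₀) (r₀<1 : r₀ < 1ℚ) where

  open ≤-Reasoning

  p : ℚi → ℚi
  p = eval (1ᵢ ∷ bs)

  t r : ℚ
  t = ⅛ * (1ℚ - r₀)
  -- Moving z₀ by at most t raises |z₀|² by at most 2 · 2 t + t, as N₁ z₀ ≤ 2. This uses five
  -- eighths of the gap 1 - r₀.
  r = r₀ + (1ℚ + 4ℚ) * t

  0<t : 0ℚ < t
  0<t = 0<a*b (from-yes (0ℚ <? ⅛)) (0<b-a r₀<1)

  t≤½ : t ≤ ½
  t≤½ = ≤-trans (*-monoˡ (from-yes (0ℚ ≤? ⅛)) (+-monoʳ-≤ 1ℚ (neg-antimono-≤ 0≤r₀))) (from-yes (⅛ * (1ℚ - 0ℚ) ≤? ½))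

  r<1 : r < 1ℚ
  r<1 = ≰⇒> λ 1≤r → <-irrefl refl (<-≤-trans (0<a*b (from-yes (0ℚ <? ½ - ⅛)) (0<b-a r₀<1))
    (e₁ r₀ ≡≤ +-monoʳ-≤ 1ℚ (neg-antimono-≤ 1≤r)))
    where
    e₁ : ∀ r₀ → (½ - ⅛) * (1ℚ - r₀) ≡ 1ℚ - (r₀ + (1ℚ + 4ℚ) * (⅛ * (1ℚ - r₀)))
    e₁ = solve-∀ ℚ-ring

  h : ℕ → ℚ
  h k = ½ ^ k * t

  0<h : ∀ k → 0ℚ < h k
  0<h k = 0<a*b (0<^ k 0<½) 0<t

  refinement : ∀ k → Σ ℚ λ δ → 0ℚ < δ × Refinable bs (h (suc k)) δ
  refinement k = refinable bs (0<h (suc k))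

  -- The first bound permits the next refinement, the second makes the values tend to 0.
  tolerance : ℕ → ℚ
  tolerance k = proj₁ (refinement k) ⊓ 1/suc k

  0<tolerance : ∀ k → 0ℚ < tolerance k
  0<tolerance k = 0<⊓ (proj₁ (proj₂ (refinement k))) (0<1/suc k)

  module From (z₀ : ℚi) (z₀≤r₀ : normSq z₀ ≤ r₀) (pz₀≤ : N₁ (p z₀) ≤ tolerance 0) where

    -- The steps h 1, ..., h k add up to t - h k.
    State : ℕ → ℚi → Set
    State k z = N₁ (z ⊖ z₀) ≤ t - h k × N₁ (p z) ≤ tolerance k

    -- 3/2 is a rational bound for √2 that leaves room for a displacement of ½ below the bound 2 in
    -- `Refinable`.
    z₀≤3/2 : N₁ z₀ ≤ 1ℚ + ½
    z₀≤3/2 = N₁≤ (from-yes (0ℚ ≤? 1ℚ + ½)) (≤-trans (+-mono-≤ z₀≤1 z₀≤1) (from-yes (1ℚ + 1ℚ ≤? (1ℚ + ½) * (1ℚ + ½))))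
      where
      z₀≤1 : normSq z₀ ≤ 1ℚ
      z₀≤1 = ≤-trans z₀≤r₀ (<⇒≤ r₀<1)

    t-h≤t : ∀ k → t - h k ≤ t
    t-h≤t k = +-monoʳ-≤ t (neg-antimono-≤ (<⇒≤ (0<h k))) ≤≡ +-identityʳ t

    split : ∀ a b → a ≡ b ⊕ (a ⊖ b)
    split = e
      where
      e : ∀ a b → a ≡ b ⊕ (a ⊕ (⊝ b))
      e = solve-∀ ℚi-ring

    state≤2 : ∀ {k z} → State k z → N₁ z ≤ 2ℚ
    state≤2 {k} {z} (near , _) = ≤-trans (cong N₁ (split z z₀) ≡≤ N₁-⊕ z₀ (z ⊖ z₀))
      (≤-trans (+-mono-≤ z₀≤3/2 (≤-trans near (≤-trans (t-h≤t k) t≤½))) (from-yes (1ℚ + ½ + ½ ≤? 2ℚ)))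

    next : ∀ k {z} → State k z → Σ ℚi λ z′ → N₁ (z′ ⊖ z) ≤ h (suc k) × State (suc k) z′
    next k {z} state@(near , pz≤) = z′ , proj₁ (proj₂ refined) , near′ , proj₂ (proj₂ refined)
      where
      refined : Σ ℚi λ z′ → N₁ (z′ ⊖ z) ≤ h (suc k) × N₁ (p z′) ≤ tolerance (suc k)
      refined = proj₂ (proj₂ (refinement k)) (state≤2 {k} {z} state)
          (≤-trans pz≤ (p⊓q≤p (proj₁ (refinement k)) (1/suc k))) (0<tolerance (suc k))
      z′ : ℚi
      z′ = proj₁ refined
      near′ : N₁ (z′ ⊖ z₀) ≤ t - h (suc k)
      near′ = begin
        N₁ (z′ ⊖ z₀)                       ≡⟨ cong N₁ (telescope z′ z z₀) ⟩
        N₁ ((z′ ⊖ z) ⊕ (z ⊖ z₀))           ≤⟨ N₁-⊕ (z′ ⊖ z) (z ⊖ z₀) ⟩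
        N₁ (z′ ⊖ z) + N₁ (z ⊖ z₀)          ≤⟨ +-mono-≤ (proj₁ (proj₂ refined)) near ⟩
        ½ * ½ ^ k * t + (t - ½ ^ k * t)    ≡⟨ e (½ ^ k) t ⟩
        t - ½ * ½ ^ k * t                  ∎
        where
        e : ∀ x t → ½ * x * t + (t - x * t) ≡ t - ½ * x * t
        e = solve-∀ ℚ-ring

    states : ∀ k → Σ ℚi (State k)
    states zero    = z₀ , ≤-reflexive (trans (cong N₁ (ℚi.-‿inverseʳ z₀)) (trans N₁-0 (e₂ t))) , pz₀≤
      where
      e₂ : ∀ t → 0ℚ ≡ t - 1ℚ * t
      e₂ = solve-∀ ℚ-ring
    states (suc k) = proj₁ (next k {proj₁ (states k)} (proj₂ (states k))) , proj₂
        (proj₂ (next k {proj₁ (states k)} (proj₂ (states k))))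

    q : ℕ → ℚi
    q k = proj₁ (states k)

    q-step : ∀ k → N₁ (q (suc k) ⊖ q k) ≤ h (suc k)
    q-step k = proj₁ (proj₂ (next k {proj₁ (states k)} (proj₂ (states k))))

    q-dist : ∀ k j → N₁ (q (j ℕ.+ k) ⊖ q k) ≤ h k - h (j ℕ.+ k)
    q-dist k zero    = ≤-reflexive (trans (cong N₁ (ℚi.-‿inverseʳ (q k))) (trans N₁-0 (sym (+-inverseʳ (h k)))))
    q-dist k (suc j) = begin
      N₁ (q (suc i) ⊖ q k)                          ≡⟨ cong N₁ (telescope (q (suc i)) (q i) (q k)) ⟩
      N₁ ((q (suc i) ⊖ q i) ⊕ (q i ⊖ q k))          ≤⟨ N₁-⊕ (q (suc i) ⊖ q i) (q i ⊖ q k) ⟩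
      N₁ (q (suc i) ⊖ q i) + N₁ (q i ⊖ q k)         ≤⟨ +-mono-≤ (q-step i) (q-dist k j) ⟩
      ½ * ½ ^ i * t + (h k - ½ ^ i * t)             ≡⟨ e (½ ^ i) t (h k) ⟩
      h k - ½ * ½ ^ i * t                           ∎
      where
      i : ℕ
      i = j ℕ.+ k
      e : ∀ x t y → ½ * x * t + (y - x * t) ≡ y - ½ * x * t
      e = solve-∀ ℚ-ring

    q-near : ∀ {N m} → N ℕ.≤ m → N₁ (q m ⊖ q N) ≤ 1/suc N
    q-near {N} {m} N≤m = begin
      N₁ (q m ⊖ q N)                  ≡⟨ cong (λ i → N₁ (q i ⊖ q N)) (sym (ℕP.m∸n+n≡m N≤m)) ⟩
      N₁ (q (m ∸ N ℕ.+ N) ⊖ q N)      ≤⟨ q-dist N (m ∸ N) ⟩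
      h N - h (m ∸ N ℕ.+ N)           ≤⟨ +-monoʳ-≤ (h N) (neg-antimono-≤ (<⇒≤ (0<h (m ∸ N ℕ.+ N)))) ⟩
      h N - 0ℚ                        ≡⟨ +-identityʳ (h N) ⟩
      ½ ^ N * t
        ≤⟨ *-mono (<⇒≤ (0<1/suc N)) (<⇒≤ 0<t) (½^≤1/suc N) (≤-trans t≤½ (from-yes (½ ≤? 1ℚ))) ⟩
      1/suc N * 1ℚ                    ≡⟨ *-identityʳ (1/suc N) ⟩
      1/suc N                         ∎

    q-cauchy : IsCauchy q
    q-cauchy k = N , λ m n N≤m N≤n → bound (close m n N≤m N≤n)
      where
      small : ∃ λ N → 1/suc N ≤ ½ * 1/suc k
      small = 1/suc-small (0<a*b 0<½ (0<1/suc k))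
      N : ℕ
      N = proj₁ small
      close : ∀ m n → N ℕ.≤ m → N ℕ.≤ n → N₁ (q m ⊖ q n) ≤ 1/suc k
      close m n N≤m N≤n = begin
        N₁ (q m ⊖ q n)                          ≡⟨ cong N₁ (difference (q m) (q n) (q N)) ⟩
        N₁ ((q m ⊖ q N) ⊖ (q n ⊖ q N))          ≤⟨ N₁-⊖ (q m ⊖ q N) (q n ⊖ q N) ⟩
        N₁ (q m ⊖ q N) + N₁ (q n ⊖ q N)
          ≤⟨ +-mono-≤ (≤-trans (q-near N≤m) (proj₂ small)) (≤-trans (q-near N≤n) (proj₂ small)) ⟩
        ½ * 1/suc k + ½ * 1/suc k               ≡⟨ halves (1/suc k) ⟩
        1/suc k                                 ∎
      bound : ∀ {u} → N₁ u ≤ 1/suc k → normSq u ≤ ℤ.+ 1 / suc k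
      bound {u} u≤ = begin
        normSq u             ≤⟨ normSq≤N₁² u ⟩
        N₁ u * N₁ u          ≤⟨ *-mono (<⇒≤ (0<1/suc k)) (0≤N₁ u) u≤ (≤-trans u≤ (1/suc≤1 k)) ⟩
        1/suc k * 1ℚ         ≡⟨ *-identityʳ (1/suc k) ⟩
        1/suc k              ≡⟨ 1/suc-def k ⟩
        ℤ.+ 1 / suc k        ∎

    q-value : ∀ k → N₁ (p (q k)) ≤ 1/suc k
    q-value k = ≤-trans (proj₂ (proj₂ (states k))) (p⊓q≤q (proj₁ (refinement k)) (1/suc k))

    q-inside : ∀ k → normSq (q k) ≤ r
    q-inside k = begin
      normSq (q k)                         ≡⟨ trans (cong normSq (split (q k) z₀)) (normSq-⊕ z₀ d) ⟩
      normSq z₀ + (x + x) + normSq d       ≤⟨ +-mono-≤ (+-mono-≤ z₀≤r₀ (+-mono-≤ x≤ x≤)) d²≤ ⟩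
      r₀ + (2ℚ * t + 2ℚ * t) + 1ℚ * t      ≡⟨ e r₀ t ⟩
      r                                    ∎
      where
      d : ℚi
      d = q k ⊖ z₀
      x : ℚ
      x = proj₁ (conj z₀ ⊗ d)
      d≤t : N₁ d ≤ t
      d≤t = ≤-trans (proj₁ (proj₂ (states k))) (t-h≤t k)
      x≤ : x ≤ 2ℚ * t
      x≤ = ≤-trans (re≤N₁ (conj z₀ ⊗ d)) (≤-trans (N₁-⊗ (conj z₀) d)
        (cong (_* N₁ d) (N₁-conj z₀) ≡≤ *-mono 0≤2 (0≤N₁ d) (≤-trans z₀≤3/2 (from-yes (1ℚ + ½ ≤? 2ℚ))) d≤t))
      d²≤ : normSq d ≤ 1ℚ * t
      d²≤ = ≤-trans (normSq≤N₁² d) (*-mono 0≤1 (0≤N₁ d) (≤-trans d≤t (≤-trans t≤½ (from-yes (½ ≤? 1ℚ)))) d≤t)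
      e : ∀ r t → r + (2ℚ * t + 2ℚ * t) + 1ℚ * t ≡ r + (1ℚ + 4ℚ) * t
      e = solve-∀ ℚ-ring

-- Roots in the open disk obstruct coverings

fromℤᵢ-+ : ∀ i j → fromℤᵢ (i ℤ.+ j) ≡ fromℤᵢ i ⊕ fromℤᵢ j
fromℤᵢ-+ i j = cong₂ _,_ (/1-+ i j) refl

fromℤᵢ-* : ∀ i j → fromℤᵢ (i ℤ.* j) ≡ fromℤᵢ i ⊗ fromℤᵢ j
fromℤᵢ-* i j = cong₂ _,_ (trans (/1-* i j) (re (i / 1) (j / 1))) (im (i / 1) (j / 1))
  where
  re : ∀ a b → a * b ≡ a * b - 0ℚ * 0ℚ
  re = solve-∀ ℚ-ring
  im : ∀ a b → 0ℚ ≡ a * 0ℚ + 0ℚ * b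
  im = solve-∀ ℚ-ring

N₁-fromℤᵢ : ∀ i → N₁ (fromℤᵢ i) ≡ fromℕ ℤ.∣ i ∣
N₁-fromℤᵢ i = trans (N₁-real (i / 1)) (∣i∣/1 i)

evalᵢ-≈0 : ∀ A z → (∀ i → coeff A i ≡ ℤ.0ℤ) → evalᵢ A z ≡ 0ᵢ
evalᵢ-≈0 []       z A≈0 = refl
evalᵢ-≈0 (a ∷ as) z A≈0 = trans (cong₂ (λ x y → fromℤᵢ x ⊕ z ⊗ y) (A≈0 0) (evalᵢ-≈0 as z (A≈0 ∘ suc))) (0⊕z⊗0≡0 z)

evalᵢ-≈ : ∀ A B z → A ≈ₚ B → evalᵢ A z ≡ evalᵢ B z
evalᵢ-≈ []       B        z A≈B = sym (evalᵢ-≈0 B z (sym ∘ A≈B))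
evalᵢ-≈ (a ∷ as) []       z A≈B = evalᵢ-≈0 (a ∷ as) z A≈B
evalᵢ-≈ (a ∷ as) (b ∷ bs) z A≈B = cong₂ (λ x y → fromℤᵢ x ⊕ z ⊗ y) (A≈B 0) (evalᵢ-≈ as bs z (A≈B ∘ suc))

evalᵢ-+ₚ : ∀ A B z → evalᵢ (A +ₚ B) z ≡ evalᵢ A z ⊕ evalᵢ B z
evalᵢ-+ₚ []       B        z = sym (ℚi.+-identityˡ (evalᵢ B z))
evalᵢ-+ₚ (a ∷ as) []       z = sym (ℚi.+-identityʳ (evalᵢ (a ∷ as) z))
evalᵢ-+ₚ (a ∷ as) (b ∷ bs) z = trans (cong₂ (λ x y → x ⊕ z ⊗ y) (fromℤᵢ-+ a b) (evalᵢ-+ₚ as bs z))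
    (e (fromℤᵢ a) (fromℤᵢ b) z (evalᵢ as z) (evalᵢ bs z))
  where
  e : ∀ a b z x y → a ⊕ b ⊕ z ⊗ (x ⊕ y) ≡ (a ⊕ z ⊗ x) ⊕ (b ⊕ z ⊗ y)
  e = solve-∀ ℚi-ring

evalᵢ-scaleₚ : ∀ c B z → evalᵢ (scaleₚ c B) z ≡ fromℤᵢ c ⊗ evalᵢ B z
evalᵢ-scaleₚ c []       z = sym (ℚi.zeroʳ (fromℤᵢ c))
evalᵢ-scaleₚ c (b ∷ bs) z = trans (cong₂ (λ x y → x ⊕ z ⊗ y) (fromℤᵢ-* c b) (evalᵢ-scaleₚ c bs z))
    (horner-scale (fromℤᵢ c) (fromℤᵢ b) z (evalᵢ bs z))

evalᵢ-*ₚ : ∀ A B z → evalᵢ (A *ₚ B) z ≡ evalᵢ A z ⊗ evalᵢ B z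
evalᵢ-*ₚ []       B z = sym (ℚi.zeroˡ (evalᵢ B z))
evalᵢ-*ₚ (a ∷ as) B z = trans (evalᵢ-+ₚ (scaleₚ a B) (ℤ.0ℤ ∷ (as *ₚ B)) z)
  (trans (cong₂ (λ x y → x ⊕ (0ᵢ ⊕ z ⊗ y)) (evalᵢ-scaleₚ a B z) (evalᵢ-*ₚ as B z))
    (e (fromℤᵢ a) (evalᵢ B z) z (evalᵢ as z)))
  where
  e : ∀ a b z x → a ⊗ b ⊕ (0ᵢ ⊕ z ⊗ (x ⊗ b)) ≡ (a ⊕ z ⊗ x) ⊗ b
  e = solve-∀ ℚi-ring

-- |u| ≤ x for the true absolute value. `N₁` would be too coarse here: it can exceed 1 inside the
-- unit disk, whereas the Horner estimate needs a ratio below 1.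
record ∥_∥≤_ (u : ℚi) (x : ℚ) : Set where
  constructor bounded
  field
    0≤x   : 0ℚ ≤ x
    u²≤x² : normSq u ≤ x * x

normSq-conj : ∀ u → normSq (conj u) ≡ normSq u
normSq-conj (a , b) = e a b
  where
  e : ∀ a b → a * a + (- b) * (- b) ≡ a * a + b * b
  e = solve-∀ ℚ-ring

-- The cross term is controlled by Cauchy-Schwarz, in the form Re(w)² ≤ |w|² for w = conj u ⊗ v.
∥∥-⊕ : ∀ {u v x y} → ∥ u ∥≤ x → ∥ v ∥≤ y → ∥ u ⊕ v ∥≤ (x + y)
∥∥-⊕ {u} {v} {x} {y} (bounded 0≤x u≤) (bounded 0≤y v≤) = bounded (0≤a+b 0≤x 0≤y) (begin
  normSq (u ⊕ v)                              ≡⟨ normSq-⊕ u v ⟩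
  normSq u + (ρ + ρ) + normSq v               ≤⟨ +-mono-≤ (+-mono-≤ u≤ (+-mono-≤ ρ≤ ρ≤)) v≤ ⟩
  x * x + (x * y + x * y) + y * y             ≡⟨ e₁ x y ⟩
  (x + y) * (x + y)                           ∎)
  where
  open ≤-Reasoning
  ρ : ℚ
  ρ = proj₁ (conj u ⊗ v)
  re²≤normSq : ∀ w → proj₁ w * proj₁ w ≤ normSq w
  re²≤normSq (a , b) = ≤-+ʳ (0≤p*p b)
  e₁ : ∀ x y → x * x + (x * y + x * y) + y * y ≡ (x + y) * (x + y)
  e₁ = solve-∀ ℚ-ring
  ρ≤ : ρ ≤ x * y
  ρ≤ = p*p≤q*q⇒p≤q (0≤a*b 0≤x 0≤y) (begin
    ρ * ρ                      ≤⟨ re²≤normSq (conj u ⊗ v) ⟩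
    normSq (conj u ⊗ v)        ≡⟨ trans (normSq-⊗ (conj u) v) (cong (_* normSq v) (normSq-conj u)) ⟩
    normSq u * normSq v        ≤⟨ *-mono (0≤p*p x) (0≤normSq v) u≤ v≤ ⟩
    x * x * (y * y)            ≡⟨ p²q²≡[pq]² x y ⟩
    x * y * (x * y)            ∎)

∥∥-⊗ : ∀ {u v x y} → ∥ u ∥≤ x → ∥ v ∥≤ y → ∥ u ⊗ v ∥≤ (x * y)
∥∥-⊗ {u} {v} {x} {y} (bounded 0≤x u≤) (bounded 0≤y v≤) = bounded (0≤a*b 0≤x 0≤y)
  (normSq-⊗ u v ≡≤ *-mono (0≤p*p x) (0≤normSq v) u≤ v≤ ≤≡ p²q²≡[pq]² x y)

∥∥-N₁ : ∀ u → ∥ u ∥≤ N₁ u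
∥∥-N₁ u = bounded (0≤N₁ u) (normSq≤N₁² u)

∥∥-weaken : ∀ {u x y} → x ≤ y → ∥ u ∥≤ x → ∥ u ∥≤ y
∥∥-weaken x≤y (bounded 0≤x u≤) = bounded (≤-trans 0≤x x≤y) (≤-trans u≤ (*-mono (≤-trans 0≤x x≤y) 0≤x x≤y x≤y))

-- Horner's scheme keeps the value within the fixed point T = β + s T.
∥∥-evalᵢ : ∀ {β s T z} → 0ℚ ≤ T → β + s * T ≤ T → ∥ z ∥≤ s → ∀ A → All (λ a → ∥ fromℤᵢ a ∥≤ β) A → ∥ evalᵢ A z ∥≤ T
∥∥-evalᵢ {T = T} 0≤T fix z≤s []       []         = bounded 0≤T (0≤p*p T)
∥∥-evalᵢ 0≤T fix z≤s (a ∷ as) (a≤ ∷ as≤) = ∥∥-weaken fix (∥∥-⊕ a≤ (∥∥-⊗ z≤s (∥∥-evalᵢ 0≤T fix z≤s as as≤)))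

∥∥-evalᵢ-L₁ : ∀ {z} → ∥ z ∥≤ 1ℚ → ∀ A → ∥ evalᵢ A z ∥≤ L₁ (map fromℤᵢ A)
∥∥-evalᵢ-L₁ z≤1 []       = bounded ≤-refl ≤-refl
∥∥-evalᵢ-L₁ z≤1 (a ∷ as) = ∥∥-⊕ (∥∥-N₁ (fromℤᵢ a)) (∥∥-weaken (≤-reflexive (*-identityˡ _))
    (∥∥-⊗ z≤1 (∥∥-evalᵢ-L₁ z≤1 as)))

∈⇒N₁≤L₁ : ∀ {d 𝒩} → d ∈ 𝒩 → N₁ (fromℤᵢ d) ≤ L₁ (map fromℤᵢ 𝒩)
∈⇒N₁≤L₁ {𝒩 = d ∷ 𝒩} (here refl) = ≤-+ʳ (0≤L₁ (map fromℤᵢ 𝒩))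
∈⇒N₁≤L₁ {𝒩 = d ∷ 𝒩} (there d∈𝒩) = ≤-trans (∈⇒N₁≤L₁ d∈𝒩) (≤-+ˡ (0≤N₁ (fromℤᵢ d)))

-- The root is only a limit, so P Q need not vanish at any term z of the sequence. But Q is known
-- once c is, and far enough out |P(z) Q(z)| ≤ 1. Then c ≤ T + 1, while c was chosen to be at least
-- T + 2.
covers⇒no-root : ∀ {P 𝒩} → CoversZX 𝒩 P → ¬ HasRootInOpenDisk P
covers⇒no-root {P} {𝒩} covers (q , _ , tends , r , r<1 , N₀ , inside) = <-irrefl refl (<-≤-trans c-big c-small)
  where
  open ≤-Reasoning
  β s T : ℚ
  β = L₁ (map fromℤᵢ 𝒩)
  -- A rational substitute for √r: r ≤ s² by the inequality of means, and still s < 1.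
  s = ½ * (1ℚ + r)
  0≤r : 0ℚ ≤ r
  0≤r = ≤-trans (0≤normSq (q N₀)) (inside N₀ ℕP.≤-refl)
  0≤s : 0ℚ ≤ s
  0≤s = 0≤a*b (<⇒≤ 0<½) (0≤a+b 0≤1 0≤r)
  r≤s² : r ≤ s * s
  r≤s² = ≤-from-slack (½ * (1ℚ - r) * (½ * (1ℚ - r))) (0≤p*p (½ * (1ℚ - r))) (e r)
    where
    e : ∀ r → r + ½ * (1ℚ - r) * (½ * (1ℚ - r)) ≡ ½ * (1ℚ + r) * (½ * (1ℚ + r))
    e = solve-∀ ℚ-ring
  0<1-s : 0ℚ < 1ℚ - s
  0<1-s = <-≤-trans (0<a*b 0<½ (0<b-a r<1)) (≤-reflexive (e r))
    where
    e : ∀ r → ½ * (1ℚ - r) ≡ 1ℚ - ½ * (1ℚ + r)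
    e = solve-∀ ℚ-ring
  s≤1 : s ≤ 1ℚ
  s≤1 = ≤-from-slack (1ℚ - s) (<⇒≤ 0<1-s) (e s)
    where
    e : ∀ s → s + (1ℚ - s) ≡ 1ℚ
    e = solve-∀ ℚ-ring
  rec : Σ ℚ λ ρ → 0ℚ < ρ × (1ℚ - s) * ρ ≡ 1ℚ
  rec = reciprocal 0<1-s
  T = β * proj₁ rec
  0≤T : 0ℚ ≤ T
  0≤T = 0≤a*b (0≤L₁ (map fromℤᵢ 𝒩)) (<⇒≤ (proj₁ (proj₂ rec)))
  fix : β + s * T ≤ T
  fix = ≤-reflexive (trans (cong (_+ s * T) (trans (sym (*-identityʳ β)) (cong (β *_) (sym (proj₂ (proj₂ rec))))))
      (e β s (proj₁ rec)))
    where
    e : ∀ β s ρ → β * ((1ℚ - s) * ρ) + s * (β * ρ) ≡ β * ρ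
    e = solve-∀ ℚ-ring
  large : Σ ℕ λ c → T + 1ℚ + 1ℚ ≤ fromℕ c
  large = archimedean (T + 1ℚ + 1ℚ)
  c : ℕ
  c = proj₁ large
  cover : Σ Poly λ R → Σ Poly λ Q → InNX 𝒩 R × ((ℤ.+ c ∷ []) ≈ₚ (R +ₚ (P *ₚ Q)))
  cover = covers (ℤ.+ c ∷ [])
  R Q : Poly
  R = proj₁ cover
  Q = proj₁ (proj₂ cover)
  R∈𝒩 : All (_∈ 𝒩) R
  R∈𝒩 = proj₂ (proj₂ (proj₂ (proj₁ (proj₂ (proj₂ cover)))))
  M : ℚ
  M = L₁ (map fromℤᵢ Q)
  tiny : Σ ℚ λ σ → 0ℚ < σ × σ * (M * M) ≤ 1ℚ
  tiny = shrink (M * M) (0≤p*p M) 0<1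
  precision : ∃ λ k → 1/suc k ≤ proj₁ tiny
  precision = 1/suc-small (proj₁ (proj₂ tiny))
  N′ n : ℕ
  N′ = proj₁ (tends (proj₁ precision))
  n = N₀ ℕ.⊔ N′
  z : ℚi
  z = q n
  z≤s : ∥ z ∥≤ s
  z≤s = bounded 0≤s (≤-trans (inside n (ℕP.m≤m⊔n N₀ N′)) r≤s²)
  R≤T : ∥ evalᵢ R z ∥≤ T
  R≤T = ∥∥-evalᵢ 0≤T fix z≤s R (All.map (λ d∈𝒩 → ∥∥-weaken (∈⇒N₁≤L₁ d∈𝒩) (∥∥-N₁ _)) R∈𝒩)
  Q≤M : ∥ evalᵢ Q z ∥≤ M
  Q≤M = ∥∥-evalᵢ-L₁ (∥∥-weaken s≤1 z≤s) Q
  PQ≤1 : ∥ evalᵢ P z ⊗ evalᵢ Q z ∥≤ 1ℚ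
  PQ≤1 = bounded 0≤1 (begin
    normSq (evalᵢ P z ⊗ evalᵢ Q z)              ≡⟨ normSq-⊗ (evalᵢ P z) (evalᵢ Q z) ⟩
    normSq (evalᵢ P z) * normSq (evalᵢ Q z)     ≤⟨ *-mono (<⇒≤ (proj₁ (proj₂ tiny))) (0≤normSq (evalᵢ Q z))
                                                     (≤-trans (proj₂ (tends (proj₁ precision)) n (ℕP.m≤n⊔m N₀ N′)
                                                       ≤≡ sym (1/suc-def (proj₁ precision))) (proj₂ precision))
                                                         (∥_∥≤_.u²≤x² Q≤M) ⟩
    proj₁ tiny * (M * M)                        ≤⟨ proj₂ (proj₂ tiny) ⟩
    1ℚ * 1ℚ                                     ∎)
  c≡ : fromℤᵢ (ℤ.+ c) ≡ evalᵢ R z ⊕ evalᵢ P z ⊗ evalᵢ Q z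
  c≡ = trans (e (fromℤᵢ (ℤ.+ c)) z) (trans (evalᵢ-≈ (ℤ.+ c ∷ []) (R +ₚ (P *ₚ Q)) z (proj₂ (proj₂ (proj₂ cover))))
    (trans (evalᵢ-+ₚ R (P *ₚ Q) z) (cong (evalᵢ R z ⊕_) (evalᵢ-*ₚ P Q z))))
    where
    e : ∀ c z → c ≡ c ⊕ z ⊗ 0ᵢ
    e = solve-∀ ℚi-ring
  c≤ : ∥ fromℤᵢ (ℤ.+ c) ∥≤ (T + 1ℚ)
  c≤ = subst (∥_∥≤ (T + 1ℚ)) (sym c≡) (∥∥-⊕ R≤T PQ≤1)
  c-small : fromℕ c ≤ T + 1ℚ
  c-small = p*p≤q*q⇒p≤q (∥_∥≤_.0≤x c≤) (cong (λ x → x * x) (fromℕ-def c) ≡≤ ≤-trans (≤-+ʳ (0≤p*p 0ℚ))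
      (∥_∥≤_.u²≤x² c≤))
  c-big : T + 1ℚ < fromℕ c
  c-big = <-≤-trans (subst (_< T + 1ℚ + 1ℚ) (+-identityʳ (T + 1ℚ)) (+-monoʳ-< (T + 1ℚ) 0<1)) (proj₂ large)

-- Coverings in the absence of roots

embed : Poly → List ℚi
embed = map fromℤᵢ

eval-embed : ∀ A z → evalᵢ A z ≡ eval (embed A) z
eval-embed []       z = refl
eval-embed (a ∷ as) z = cong (λ v → fromℤᵢ a ⊕ z ⊗ v) (eval-embed as z)

coef-embed : ∀ A i → coef (embed A) i ≡ fromℤᵢ (coeff A i)
coef-embed []       i       = refl
coef-embed (a ∷ as) zero    = refl
coef-embed (a ∷ as) (suc i) = coef-embed as i

coeff-+ₚ : ∀ A B i → coeff (A +ₚ B) i ≡ coeff A i ℤ.+ coeff B i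
coeff-+ₚ []       B        i       = sym (ℤP.+-identityˡ (coeff B i))
coeff-+ₚ (a ∷ as) []       i       = sym (ℤP.+-identityʳ (coeff (a ∷ as) i))
coeff-+ₚ (a ∷ as) (b ∷ bs) zero    = refl
coeff-+ₚ (a ∷ as) (b ∷ bs) (suc i) = coeff-+ₚ as bs i

coeff-scaleₚ : ∀ c B i → coeff (scaleₚ c B) i ≡ c ℤ.* coeff B i
coeff-scaleₚ c []       i       = sym (ℤP.*-zeroʳ c)
coeff-scaleₚ c (b ∷ bs) zero    = refl
coeff-scaleₚ c (b ∷ bs) (suc i) = coeff-scaleₚ c bs i

fromℤᵢ-coeff-*ₚ : ∀ A B i → fromℤᵢ (coeff (A *ₚ B) i) ≡ conv (coef (embed A)) (coef (embed B)) i
fromℤᵢ-coeff-*ₚ []       B i = sym (0-conv (coef (embed B)) i)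
fromℤᵢ-coeff-*ₚ (a ∷ as) B i = trans (cong fromℤᵢ (trans (coeff-+ₚ (scaleₚ a B) (ℤ.0ℤ ∷ (as *ₚ B)) i)
    (cong (ℤ._+ coeff (ℤ.0ℤ ∷ (as *ₚ B)) i) (coeff-scaleₚ a B i))))
  (trans (fromℤᵢ-+ (a ℤ.* coeff B i) (coeff (ℤ.0ℤ ∷ (as *ₚ B)) i))
    (trans (cong (_⊕ fromℤᵢ (coeff (ℤ.0ℤ ∷ (as *ₚ B)) i))
      (trans (fromℤᵢ-* a (coeff B i)) (cong (fromℤᵢ a ⊗_) (sym (coef-embed B i))))) (shift i)))
  where
  shift : ∀ i → fromℤᵢ a ⊗ coef (embed B) i ⊕ fromℤᵢ (coeff (ℤ.0ℤ ∷ (as *ₚ B)) i) ≡ conv (coef (embed (a ∷ as)))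
      (coef (embed B)) i
  shift zero    = ℚi.+-identityʳ (fromℤᵢ a ⊗ coef (embed B) 0)
  shift (suc i) = cong (fromℤᵢ a ⊗ coef (embed B) (suc i) ⊕_) (fromℤᵢ-coeff-*ₚ as B i)

conv-scaleʳ : ∀ c f g k → conv f (λ j → c ⊗ g j) k ≡ c ⊗ conv f g k
conv-scaleʳ c f g zero    = e (f 0) c (g 0)
  where
  e : ∀ a c b → a ⊗ (c ⊗ b) ≡ c ⊗ (a ⊗ b)
  e = solve-∀ ℚi-ring
conv-scaleʳ c f g (suc k) = trans (cong (f 0 ⊗ (c ⊗ g (suc k)) ⊕_) (conv-scaleʳ c (f ∘ suc) g k))
    (e c (f 0) (g (suc k)) (conv (f ∘ suc) g k))
  where
  e : ∀ c a b x → a ⊗ (c ⊗ b) ⊕ c ⊗ x ≡ c ⊗ (a ⊗ b ⊕ x)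
  e = solve-∀ ℚi-ring

re : ℚi → ℚi
re u = real (proj₁ u)

-- Integer coefficients commute with taking real parts; thus a quotient over ℚ(i) can be replaced by
-- its real part without enlarging the error.
re-conv : ∀ A g k → conv (coef (embed A)) (re ∘ g) k ≡ re (conv (coef (embed A)) g k)
re-conv A g k = go (coef (embed A)) (λ i → coeff A i / 1) (coef-embed A) k
  where
  re-scale : ∀ r u → real r ⊗ re u ≡ re (real r ⊗ u)
  re-scale r (a , b) = cong₂ _,_ (e₁ r a b) (e₂ r a)
    where
    e₁ : ∀ r a b → r * a - 0ℚ * 0ℚ ≡ r * a - 0ℚ * b
    e₁ = solve-∀ ℚ-ring
    e₂ : ∀ r a → r * 0ℚ + 0ℚ * a ≡ 0ℚ
    e₂ = solve-∀ ℚ-ring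
  term : ∀ {u} r v → u ≡ real r → u ⊗ re v ≡ re (u ⊗ v)
  term r v refl = re-scale r v
  go : ∀ f (r : ℕ → ℚ) → (∀ i → f i ≡ real (r i)) → ∀ k → conv f (re ∘ g) k ≡ re (conv f g k)
  go f r f≡ zero    = term (r 0) (g 0) (f≡ 0)
  go f r f≡ (suc k) = cong₂ _⊕_ (term (r 0) (g (suc k)) (f≡ 0)) (go (f ∘ suc) (r ∘ suc) (f≡ ∘ suc) k)

digits : ℕ → List ℤ
digits B = map ℤ.+_ (upTo (suc B)) ++ map (λ n → ℤ.- (ℤ.+ n)) (upTo (suc B))

∈-digits : ∀ {B} i → ℤ.∣ i ∣ ℕ.≤ B → i ∈ digits B
∈-digits (ℤ.+ n)    n≤B = ∈-++⁺ˡ (∈-map⁺ ℤ.+_ (∈-upTo⁺ (ℕ.s≤s n≤B)))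
∈-digits {B} ℤ.-[1+ n ] n≤B = ∈-++⁺ʳ (map ℤ.+_ (upTo (suc B))) (∈-map⁺ (λ n → ℤ.- (ℤ.+ n)) (∈-upTo⁺ (ℕ.s≤s n≤B)))

All-coeff : ∀ {P : ℤ → Set} A → (∀ i → P (coeff A i)) → All P A
All-coeff []       h = []
All-coeff (a ∷ as) h = h 0 ∷ All-coeff as (h ∘ suc)

fromℕ-cancel : ∀ {i j} → fromℕ i ≤ fromℕ j → i ℕ.≤ j
fromℕ-cancel {i} {j} h = ℤP.drop‿+≤+ (/1-cancel-≤ {ℤ.+ i} {ℤ.+ j} (sym (fromℕ-def i) ≡≤ h ≤≡ fromℕ-def j))

-- Taking floors of the real parts changes each coefficient of Q by at most 1, hence P Q by at most
-- the ℓ¹ norm of P. The digit bound B is therefore independent of A.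
round-division : ∀ P A Q → (∀ k → N₁ (coef (embed A) k ⊖ conv (coef (embed P)) (coef Q) k) ≤ 1ℚ) →
  ∀ {B} → 1ℚ + L₁ (embed P) ≤ fromℕ B →
  Σ Poly λ R → Σ Poly λ Q′ → InNX (digits B) R × (A ≈ₚ (R +ₚ (P *ₚ Q′)))
round-division P A Q close {B} ≤B = R , Qz , (proj₁ R-nonempty , proj₁ (proj₂ R-nonempty) , proj₂
    (proj₂ R-nonempty) , All-coeff R (λ i → ∈-digits (coeff R i) (fromℕ-cancel (R≤B i)))) , A≈
  where
  open ≤-Reasoning
  Qz X R : Poly
  Qz = map (floor ∘ proj₁) Q
  X = A +ₚ scaleₚ ℤ.-1ℤ (P *ₚ Qz)
  -- Adding the zero polynomial makes the list nonempty, as `InNX` demands.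
  R = (ℤ.0ℤ ∷ []) +ₚ X
  nonempty : ∀ X → Σ ℤ λ d → Σ (List ℤ) λ ds → (ℤ.0ℤ ∷ []) +ₚ X ≡ d ∷ ds
  nonempty []      = _ , _ , refl
  nonempty (_ ∷ _) = _ , _ , refl
  R-nonempty : Σ ℤ λ d → Σ (List ℤ) λ ds → R ≡ d ∷ ds
  R-nonempty = nonempty X
  coeff-R : ∀ i → coeff R i ≡ coeff A i ℤ.- coeff (P *ₚ Qz) i
  coeff-R i = trans (coeff-+ₚ (ℤ.0ℤ ∷ []) X i) (trans (cong₂ ℤ._+_ (coeff-0 i)
    (trans (coeff-+ₚ A (scaleₚ ℤ.-1ℤ (P *ₚ Qz)) i) (cong (λ x → coeff A i ℤ.+ x) (coeff-scaleₚ ℤ.-1ℤ (P *ₚ Qz) i))))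
      (e (coeff A i) (coeff (P *ₚ Qz) i)))
    where
    coeff-0 : ∀ i → coeff (ℤ.0ℤ ∷ []) i ≡ ℤ.0ℤ
    coeff-0 zero    = refl
    coeff-0 (suc i) = refl
    e : ∀ a b → ℤ.0ℤ ℤ.+ (a ℤ.+ ℤ.-1ℤ ℤ.* b) ≡ a ℤ.- b
    e = solveℤ-∀
  A≈ : A ≈ₚ (R +ₚ (P *ₚ Qz))
  A≈ i = sym (trans (coeff-+ₚ R (P *ₚ Qz) i) (trans (cong (ℤ._+ coeff (P *ₚ Qz) i) (coeff-R i))
      (e (coeff A i) (coeff (P *ₚ Qz) i))))
    where
    e : ∀ a b → a ℤ.- b ℤ.+ b ≡ a
    e = solveℤ-∀
  p : Seq
  p = coef (embed P)
  f : Seq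
  f = re ∘ coef Q
  f-floor : ∀ k → N₁ (f k ⊖ coef (embed Qz) k) ≤ 1ℚ
  f-floor k = go Q k
    where
    frac : ∀ x → N₁ (real x ⊖ fromℤᵢ (floor x)) ≤ 1ℚ
    frac x = N₁-real (x - floor x / 1) ≡≤ ∣p∣≤ (≤-from-slack (1ℚ + floor x / 1 - x) (0≤b-a (p≤1+floor x))
        (e₁ x (floor x / 1)))
      (≤-from-slack (1ℚ + (x - floor x / 1)) (0≤a+b 0≤1 (0≤b-a (floor-≤ x))) (e₂ x (floor x / 1)))
      where
      e₁ : ∀ x y → x - y + (1ℚ + y - x) ≡ 1ℚ
      e₁ = solve-∀ ℚ-ring
      e₂ : ∀ x y → - (x - y) + (1ℚ + (x - y)) ≡ 1ℚ
      e₂ = solve-∀ ℚ-ring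
    go : ∀ Q k → N₁ (re (coef Q k) ⊖ coef (embed (map (floor ∘ proj₁) Q)) k) ≤ 1ℚ
    go []      k       = N₁-0 ≡≤ 0≤1
    go (u ∷ Q) zero    = frac (proj₁ u)
    go (u ∷ Q) (suc k) = go Q k
  R≤B : ∀ i → fromℕ ℤ.∣ coeff R i ∣ ≤ fromℕ B
  R≤B i = begin
    fromℕ ℤ.∣ coeff R i ∣
      ≡⟨ N₁-fromℤᵢ (coeff R i) ⟨
    N₁ (fromℤᵢ (coeff R i))
      ≡⟨ cong N₁ (trans (cong fromℤᵢ (coeff-R i)) (trans (fromℤᵢ-⊖ (coeff A i) (coeff (P *ₚ Qz) i))
        (cong₂ _⊖_ (sym (coef-embed A i)) (fromℤᵢ-coeff-*ₚ P Qz i)))) ⟩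
    N₁ (coef (embed A) i ⊖ conv p (coef (embed Qz)) i)
      ≡⟨ cong N₁ (telescope (coef (embed A) i) (conv p f i) (conv p (coef (embed Qz)) i)) ⟩
    N₁ ((coef (embed A) i ⊖ conv p f i) ⊕ (conv p f i ⊖ conv p (coef (embed Qz)) i))
      ≤⟨ N₁-⊕ (coef (embed A) i ⊖ conv p f i) (conv p f i ⊖ conv p (coef (embed Qz)) i) ⟩
    N₁ (coef (embed A) i ⊖ conv p f i) + N₁ (conv p f i ⊖ conv p (coef (embed Qz)) i)
      ≤⟨ +-mono-≤ real-close (cong N₁ (sym (conv-⊖ʳ p f (coef (embed Qz)) i)) ≡≤ N₁-conv-listˡ
        (embed P) 0≤1 f-floor i) ⟩
    1ℚ + L₁ (embed P) * 1ℚ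
      ≡⟨ cong (1ℚ +_) (*-identityʳ (L₁ (embed P))) ⟩
    1ℚ + L₁ (embed P)
      ≤⟨ ≤B ⟩
    fromℕ B ∎
    where
    fromℤᵢ-⊖ : ∀ a b → fromℤᵢ (a ℤ.- b) ≡ fromℤᵢ a ⊖ fromℤᵢ b
    fromℤᵢ-⊖ a b = cong₂ _,_ (trans (/1-+ a (ℤ.- b)) (cong (a / 1 +_) (/1-neg b))) refl
    re-⊖ : ∀ {u v} → u ≡ re u → u ⊖ re v ≡ re (u ⊖ v)
    re-⊖ u≡ = cong₂ _,_ refl (cong (λ b → b - 0ℚ) (cong proj₂ u≡))
    real-close : N₁ (coef (embed A) i ⊖ conv p f i) ≤ 1ℚ
    real-close = cong N₁ (trans (cong (coef (embed A) i ⊖_) (re-conv P (coef Q) i))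
        (re-⊖ {coef (embed A) i} {conv p (coef Q) i} (trans (coef-embed A i) (cong re (sym (coef-embed A i))))))
      ≡≤ ≤-trans (N₁-real-part (coef (embed A) i ⊖ conv p (coef Q) i)) (close i)

zero-root : ∀ P → coeff P 0 ≡ ℤ.0ℤ → HasRootInOpenDisk P
zero-root P P₀≡0 = (λ _ → 0ᵢ)
  , (λ k → 0 , λ _ _ _ _ → 0≤1/suc k)
  , (λ k → 0 , λ _ _ → cong normSq (value P P₀≡0) ≡≤ 0≤1/suc k)
  , 0ℚ , 0<1 , 0 , λ _ _ → ≤-refl
  where
  0≤1/suc : ∀ k → 0ℚ ≤ ℤ.+ 1 / suc k
  0≤1/suc k = <⇒≤ (0<1/suc k) ≤≡ 1/suc-def k
  e : ∀ v → 0ᵢ ⊕ 0ᵢ ⊗ v ≡ 0ᵢ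
  e = solve-∀ ℚi-ring
  value : ∀ P → coeff P 0 ≡ ℤ.0ℤ → evalᵢ P 0ᵢ ≡ 0ᵢ
  value []       _    = refl
  value (p ∷ ps) refl = e (evalᵢ ps 0ᵢ)

module NonzeroConstant (p₀ : ℤ) (ps : List ℤ) (p₀≢0 : p₀ ≢ ℤ.0ℤ) (no-root : ¬ HasRootInOpenDisk (p₀ ∷ ps)) where

  open ≤-Reasoning

  P : Poly
  P = p₀ ∷ ps

  c d : ℚi
  c = fromℤᵢ p₀

  0<c : 0ℚ < normSq c
  0<c = ≰⇒> λ c≤0 → impossible ℤ.∣ p₀ ∣ (p₀≢0 ∘ ℤP.∣i∣≡0⇒i≡0)
    (sym (N₁-fromℤᵢ p₀) ≡≤ N₁≤ {c} {0ℚ} (≤-refl {0ℚ}) (+-mono-≤ {normSq c} {0ℚ} {normSq c} {0ℚ} c≤0 c≤0))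
    where
    impossible : ∀ n → n ≢ 0 → fromℕ n ≤ 0ℚ → ⊥
    impossible zero    n≢0 _ = n≢0 refl
    impossible (suc n) _ h = <-irrefl refl (<-≤-trans 0<1
        (≤-trans (≤-+ʳ {1ℚ} {fromℕ n} (0≤fromℕ n)) (sym (fromℕ-suc n) ≡≤ h)))

  d = proj₁ (inverse c 0<c)

  cd≡1 : c ⊗ d ≡ 1ᵢ
  cd≡1 = proj₂ (inverse c 0<c)

  bs : List ℚi
  bs = map (d ⊗_) (embed ps)

  n : ℕ
  n = length bs

  p : Seq
  p = coef (1ᵢ ∷ bs)

  eval-P : ∀ z → evalᵢ P z ≡ c ⊗ eval (1ᵢ ∷ bs) z
  eval-P z = trans (cong (λ v → c ⊕ z ⊗ v) (eval-embed ps z))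
    (sym (trans (cong (λ v → c ⊗ (1ᵢ ⊕ z ⊗ v)) (eval-scale (embed ps)))
      (trans (e₁ c d z (eval (embed ps) z)) (trans (cong (λ v → c ⊕ z ⊗ (v ⊗ eval (embed ps) z)) cd≡1)
        (e₂ c z (eval (embed ps) z))))))
    where
    eval-scale : ∀ as → eval (map (d ⊗_) as) z ≡ d ⊗ eval as z
    eval-scale []       = sym (ℚi.zeroʳ d)
    eval-scale (a ∷ as) = trans (cong (λ v → d ⊗ a ⊕ z ⊗ v) (eval-scale as)) (horner-scale d a z (eval as z))
    e₁ : ∀ c d z x → c ⊗ (1ᵢ ⊕ z ⊗ (d ⊗ x)) ≡ c ⊕ z ⊗ (c ⊗ d ⊗ x)
    e₁ = solve-∀ ℚi-ring
    e₂ : ∀ c z x → c ⊕ z ⊗ (1ᵢ ⊗ x) ≡ c ⊕ z ⊗ x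
    e₂ = solve-∀ ℚi-ring

  coef-P : ∀ k → coef (embed P) k ≡ c ⊗ p k
  coef-P zero    = sym (ℚi.*-identityʳ c)
  coef-P (suc k) = sym (trans (cong (c ⊗_) (coef-scale d (embed ps) k))
      (trans (sym (⊗-assoc c d (coef (embed ps) k))) (trans (cong (_⊗ coef (embed ps) k) cd≡1)
        (ℚi.*-identityˡ (coef (embed ps) k)))))

  B : Σ ℕ λ B → 1ℚ + L₁ (embed P) ≤ fromℕ B
  B = archimedean (1ℚ + L₁ (embed P))

  root-from : ∀ {r₀} (0≤r₀ : 0ℚ ≤ r₀) (r₀<1 : r₀ < 1ℚ) z → normSq z ≤ r₀ →
    N₁ (eval (1ᵢ ∷ bs) z) ≤ RootSequence.tolerance bs 0≤r₀ r₀<1 0 → HasRootInOpenDisk P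
  root-from 0≤r₀ r₀<1 z z≤r₀ pz≤ = q , q-cauchy , tends , r , r<1 , 0 , λ k _ → q-inside k
    where
    open RootSequence bs 0≤r₀ r₀<1 using (r; r<1; module From)
    open From z z≤r₀ pz≤
    tends : TendsToZero (λ k → normSq (evalᵢ P (q k)))
    tends k = N , λ j N≤j → begin
      normSq (evalᵢ P (q j))
        ≡⟨ trans (cong normSq (eval-P (q j))) (normSq-⊗ c (eval (1ᵢ ∷ bs) (q j))) ⟩
      normSq c * normSq (eval (1ᵢ ∷ bs) (q j))
        ≤⟨ *-monoˡ (0≤normSq c) (≤-trans (normSq≤N₁² (eval (1ᵢ ∷ bs) (q j)))
                                                          (*-mono (<⇒≤ (0<1/suc j)) (0≤N₁ (eval (1ᵢ ∷ bs) (q j)))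
                                                            (q-value j) (≤-trans (q-value j) (1/suc≤1 j)))) ⟩
      normSq c * (1/suc j * 1ℚ)                       ≡⟨ e (normSq c) (1/suc j) ⟩
      1/suc j * normSq c
        ≤⟨ *-monoʳ (0≤normSq c) (≤-trans (1/suc-antitone N≤j) (proj₂ precision)) ⟩
      proj₁ small * normSq c                          ≤⟨ proj₂ (proj₂ small) ⟩
      1/suc k                                         ≡⟨ 1/suc-def k ⟩
      ℤ.+ 1 / suc k                                   ∎
      where
      small : Σ ℚ λ s → 0ℚ < s × s * normSq c ≤ 1/suc k
      small = shrink (normSq c) (0≤normSq c) (0<1/suc k)
      precision : ∃ λ N → 1/suc N ≤ proj₁ small
      precision = 1/suc-small (proj₁ (proj₂ small))
      N : ℕ
      N = proj₁ precision
      e : ∀ c x → c * (x * 1ℚ) ≡ x * c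
      e = solve-∀ ℚ-ring

  -- The order of choices matters: A and the degree give L and η, then η gives r₀, r₀ the tolerance
  -- for a root, and L with this tolerance the accuracy δ. Only then are the w's chosen and tested;
  -- a failed test contradicts `no-root`.
  approximate-division : ∀ A → Σ (List ℚi) λ Q → ∀ k → N₁ (coef (embed A) k ⊖ conv (coef (embed P)) (coef Q) k) ≤ 1ℚ
  approximate-division A = divide (All.all? (λ w → normSq w ≤? 1ℚ + η) ws)
    where
    inverter : Σ ℚ λ L → Σ ℚ λ η → 0ℚ ≤ L × 0ℚ < η × ApproximatelyInvertible n (L₁ (embed A)) ½ L η
    inverter = approximately-invertible n (0≤L₁ (embed A)) 0<½
    L η : ℚ
    L = proj₁ inverter
    η = proj₁ (proj₂ inverter)
    0≤L : 0ℚ ≤ L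
    0≤L = proj₁ (proj₂ (proj₂ inverter))
    0<η : 0ℚ < η
    0<η = proj₁ (proj₂ (proj₂ (proj₂ inverter)))
    radius : Σ ℚ λ r₀ → 0ℚ < r₀ × (1ℚ + η) * r₀ ≡ 1ℚ
    radius = reciprocal (0<a+b 0<1 (<⇒≤ 0<η))
    r₀ : ℚ
    r₀ = proj₁ radius
    0<r₀ : 0ℚ < r₀
    0<r₀ = proj₁ (proj₂ radius)
    0≤r₀ : 0ℚ ≤ r₀
    0≤r₀ = <⇒≤ 0<r₀
    r₀<1 : r₀ < 1ℚ
    r₀<1 = <-≤-trans (subst (_< r₀ + η * r₀) (+-identityʳ r₀) (+-monoʳ-< r₀ (0<a*b 0<η 0<r₀)))
        (≤-reflexive (trans (e η r₀) (proj₂ (proj₂ radius))))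
      where
      e : ∀ η r → r + η * r ≡ (1ℚ + η) * r
      e = solve-∀ ℚ-ring
    tol : ℚ
    tol = RootSequence.tolerance bs 0≤r₀ r₀<1 0
    -- The factorisation error δ is magnified by L in the product with Q, and by the geometric sum
    -- in the value at 1/w.
    accuracy : Σ ℚ λ δ → 0ℚ < δ × δ * L ≤ ½ × δ * geometric (suc n) ≤ tol × δ * 0ℚ ≤ 1ℚ
    accuracy = shrink₃ 0≤L (0≤geometric (suc n)) (≤-refl {0ℚ}) 0<½ (RootSequence.0<tolerance bs 0≤r₀ r₀<1 0) 0<1
    δ : ℚ
    δ = proj₁ accuracy
    0<δ : 0ℚ < δ
    0<δ = proj₁ (proj₂ accuracy)
    factors : Σ (List ℚi) λ ws → length ws ≡ n × (∀ k → N₁ (p k ⊖ DD ws δ₀ k) ≤ δ)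
    factors = approximate-factorisation n bs refl 0<δ
    ws : List ℚi
    ws = proj₁ factors

    inner-root : ∀ {w} → w ∈ ws → ¬ (normSq w ≤ 1ℚ + η) → ⊥
    inner-root {w} w∈ws w≰ = no-root (root-from 0≤r₀ r₀<1 z z≤r₀ pz≤)
      where
      1+η≤w : 1ℚ + η ≤ normSq w
      1+η≤w = <⇒≤ (≰⇒> w≰)
      inv : Σ ℚi λ z → w ⊗ z ≡ 1ᵢ
      inv = inverse w (<-≤-trans (0<a+b 0<1 (<⇒≤ 0<η)) 1+η≤w)
      z : ℚi
      z = proj₁ inv
      wz≡1 : w ⊗ z ≡ 1ᵢ
      wz≡1 = proj₂ inv
      z≤r₀ : normSq z ≤ r₀
      z≤r₀ = begin
        normSq z                           ≡⟨ *-identityʳ (normSq z) ⟨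
        normSq z * 1ℚ                      ≡⟨ cong (normSq z *_) (proj₂ (proj₂ radius)) ⟨
        normSq z * ((1ℚ + η) * r₀)         ≤⟨ *-monoˡ (0≤normSq z) (*-monoʳ 0≤r₀ 1+η≤w) ⟩
        normSq z * (normSq w * r₀)         ≡⟨ e (normSq z) (normSq w) r₀ ⟩
        normSq w * normSq z * r₀           ≡⟨ cong (_* r₀) (trans (sym (normSq-⊗ w z)) (cong normSq wz≡1)) ⟩
        1ℚ * r₀                            ≡⟨ *-identityˡ r₀ ⟩
        r₀                                 ∎
        where
        e : ∀ a b c → a * (b * c) ≡ b * a * c
        e = solve-∀ ℚ-ring
      z≤1 : normSq z ≤ 1ℚ
      z≤1 = ≤-trans z≤r₀ (<⇒≤ r₀<1)
      z≤4 : N₁ z ≤ 4ℚ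
      z≤4 = N₁≤ 0≤4 (≤-trans (+-mono-≤ z≤1 z≤1) (from-yes (1ℚ + 1ℚ ≤? 4ℚ * 4ℚ)))
      pz≤ : N₁ (eval (1ᵢ ∷ bs) z) ≤ tol
      pz≤ = cong N₁ (trans (u≡u⊖0 (eval (1ᵢ ∷ bs) z)) (cong (eval (1ᵢ ∷ bs) z ⊖_) (sym (product-root w∈ws wz≡1))))
        ≡≤ ≤-trans (N₁-eval-product bs ws (proj₁ (proj₂ factors)) (proj₂ (proj₂ factors)) z≤4)
          (proj₁ (proj₂ (proj₂ (proj₂ accuracy))))

    divide : Dec (All (λ w → normSq w ≤ 1ℚ + η) ws) → Σ (List ℚi) λ Q → ∀ k → N₁
        (coef (embed A) k ⊖ conv (coef (embed P)) (coef Q) k) ≤ 1ℚ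
    divide (no some) = ⊥-elim (inner-root (proj₁ (proj₂ found)) (proj₂ (proj₂ found)))
      where
      found : Σ ℚi λ w → w ∈ ws × ¬ (normSq w ≤ 1ℚ + η)
      found = find (¬All⇒Any¬ (λ w → normSq w ≤? 1ℚ + η) ws some)
    divide (yes all) = map (d ⊗_) Q , close
      where
      inverted : Σ (List ℚi) λ Q → L₁ Q ≤ L × (∀ k → N₁ (coef (embed A) k ⊖ DD ws (coef Q) k) ≤ ½)
      inverted = proj₂ (proj₂ (proj₂ (proj₂ inverter))) ws (proj₁ (proj₂ factors)) all (embed A) ≤-refl
      Q : List ℚi
      Q = proj₁ inverted
      q : Seq
      q = coef Q
      conv-P : ∀ k → conv (coef (embed P)) (coef (map (d ⊗_) Q)) k ≡ conv p q k
      conv-P k = trans (conv-cong coef-P (coef-scale d Q) k)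
          (trans (conv-scaleˡ c p (λ j → d ⊗ q j) k) (trans (cong (c ⊗_) (conv-scaleʳ d p q k))
        (trans (sym (⊗-assoc c d (conv p q k))) (trans (cong (_⊗ conv p q k) cd≡1) (ℚi.*-identityˡ (conv p q k))))))
      error : ∀ k → N₁ (conv p q k ⊖ DD ws q k) ≤ ½
      error k = begin
        N₁ (conv p q k ⊖ DD ws q k)
          ≡⟨ cong N₁ (trans (cong (conv p q k ⊖_) (sym (DD-δ₀-conv ws q k))) (sym (conv-⊖ˡ p (DD ws δ₀) q k))) ⟩
        N₁ (conv (p ⊖ₛ DD ws δ₀) q k)                   ≤⟨ N₁-conv-listʳ Q (<⇒≤ 0<δ) (proj₂ (proj₂ factors)) k ⟩
        δ * L₁ Q                                        ≤⟨ *-monoˡ (<⇒≤ 0<δ) (proj₁ (proj₂ inverted)) ⟩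
        δ * L                                           ≤⟨ proj₁ (proj₂ (proj₂ accuracy)) ⟩
        ½                                               ∎
      close : ∀ k → N₁ (coef (embed A) k ⊖ conv (coef (embed P)) (coef (map (d ⊗_) Q)) k) ≤ 1ℚ
      close k = begin
        N₁ (coef (embed A) k ⊖ conv (coef (embed P)) (coef (map (d ⊗_) Q)) k)
          ≡⟨ cong (λ v → N₁ (coef (embed A) k ⊖ v)) (conv-P k) ⟩
        N₁ (coef (embed A) k ⊖ conv p q k)
          ≡⟨ cong N₁ (difference (coef (embed A) k) (conv p q k) (DD ws q k)) ⟩
        N₁ ((coef (embed A) k ⊖ DD ws q k) ⊖ (conv p q k ⊖ DD ws q k))
          ≤⟨ N₁-⊖ (coef (embed A) k ⊖ DD ws q k) (conv p q k ⊖ DD ws q k) ⟩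
        N₁ (coef (embed A) k ⊖ DD ws q k) + N₁ (conv p q k ⊖ DD ws q k)
          ≤⟨ +-mono-≤ (proj₂ (proj₂ inverted) k) (error k) ⟩
        ½ + ½                                                                   ≡⟨⟩
        1ℚ                                                                      ∎

  covers : CoversZX (digits (proj₁ B)) P
  covers A = round-division P A (proj₁ division) (proj₂ division) (proj₂ B)
    where
    division : Σ (List ℚi) λ Q → ∀ k → N₁ (coef (embed A) k ⊖ conv (coef (embed P)) (coef Q) k) ≤ 1ℚ
    division = approximate-division A

no-root⇒covers : ∀ P → ¬ HasRootInOpenDisk P → Σ (List ℤ) λ 𝒩 → CoversZX 𝒩 P
no-root⇒covers [] no-root = ⊥-elim (no-root (zero-root [] refl))
no-root⇒covers (p₀ ∷ ps) no-root = decide (p₀ ℤP.≟ ℤ.0ℤ)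
  where
  decide : Dec (p₀ ≡ ℤ.0ℤ) → Σ (List ℤ) λ 𝒩 → CoversZX 𝒩 (p₀ ∷ ps)
  decide (yes p₀≡0) = ⊥-elim (no-root (zero-root (p₀ ∷ ps) p₀≡0))
  decide (no p₀≢0)  = digits (proj₁ B) , covers
    where open NonzeroConstant p₀ ps p₀≢0 no-root

theorem2 : (P : Poly) →
    (Σ (List ℤ) (λ 𝒩 → CoversZX 𝒩 P)) ⇔ (¬ HasRootInOpenDisk P)
theorem2 P = mk⇔ (λ (𝒩 , covers) → covers⇒no-root {P} {𝒩} covers) (no-root⇒covers P)
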